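{- Let $(W,S,*)$ be a twisted Coxeter system. For every $w\in\mathcal{I}_*$, the set $\hat{\mathcal{R}}_*(1,w)$ is an equivalence class of finite words in $S$ under $\sim_{\mathcal{I}_*}$.
   Context: A twisted Coxeter system $(W,S,\star)$ is a Coxeter system $(W,S)$ with length $\ell$ and an automorphism $\star$ of $W$ with $S^\star=S$, $\star^2=\mathrm{id}$; $\mathcal{I}_\star=\{w:w^{ -1}=w^\star\}$. The Demazure product $\circ$ is the unique associative operation on $W$ with $s\circ w = sw$ if $\ell(sw)>\ell(w)$ and $s\circ w=w$ otherwise, and $w\circ s=ws$ if $\ell(ws)>\ell(w)$ and $w\circ s = w$ otherwise, for $s\in S$; put $x\ltimes_\star w=(w^\star)^{ -1}\circ x\circ w$. $\hat{\mathcal{R}}_\star(x,y)$ is the set of words $(s_1,\dots,s_k)$ in $S$ of shortest length with $(\cdots(x\ltimes_\star s_1)\cdots)\ltimes_\star s_k=y$, and $\hat\ell_\star(y)$ is the length of words in $\hat{\mathcal{R}}_\star(1,y)$. Let $m(s,t)$ be the order of $st$. For a word $\mathbf{a}=(a_1,\dots,a_j)$ let $u=\hat\delta_*(\mathbf{a})=(\cdots(1\ltimes_* a_1)\cdots)\ltimes_* a_j$ and $\theta_{\mathbf{a}}(g)=(ugu^{ -1})^*$. For $s,t\in S$ with $m(s,t)<\infty$ let $\Delta$ be the longest element of $W_{\{s,t\}}=\langle s,t\rangle$; define $m(s,t;\theta_{\mathbf{a}})=\hat\ell_\theta(\Delta)$ computed in the twisted Coxeter system $(W_{\{s,t\}},\{s,t\},\theta)$,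 where $\theta$ is the diagram automorphism extending the permutation $\theta_{\mathbf{a}}|_{\{s,t\}}$, if $\theta_{\mathbf{a}}(\{s,t\})=\{s,t\}$; and $m(s,t;\theta_{\mathbf{a}})=\ell(\Delta)$ otherwise. $\sim_{\mathcal{I}_*}$ is the transitive closure of the relation $(a_1,\dots,a_j,s,t,s,t,\dots,b_1,\dots,b_k)\sim_{\mathcal{I}_*}(a_1,\dots,a_j,t,s,t,s,\dots,b_1,\dots,b_k)$, where the alternating middle segments have $m=m(s,t;\theta_{\mathbf{a}})$ terms, $\mathbf{a}=(a_1,\dots,a_j)$, and $s,t,a_i,b_i\in S$ with $m(s,t)<\infty$. -}

module Defs where

open import Data.Nat using (ℕ; zero; suc; _*_; _≤_; _<_)
open import Data.Bool using (Bool; true; false; not)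
open import Data.List using (List; []; _∷_; _++_; [_]; length; reverse; map)
open import Data.Product using (Σ; ∃; ∃-syntax; _×_; _,_)
open import Data.Sum using (_⊎_)
open import Function using (id)
open import Relation.Nullary using (¬_)
open import Relation.Binary.PropositionalEquality using (_≡_; _≢_)
open import Relation.Binary.Construct.Closure.Equivalence using (EqClosure)
open import Relation.Binary.Construct.Closure.ReflexiveTransitive using (Star)

-- A Coxeter matrix on an arbitrary set S of generators; m s t ≡ 0 encodes m(s,t) = ∞.
record CoxeterMatrix : Set₁ where
  field
    S      : Set
    m      : S → S → ℕ
    m-sym  : ∀ s t → m s t ≡ m t s
    m-diag : ∀ s → m s s ≡ 1
    m-off  : ∀ s t → s ≢ t → m s t ≢ 1

-- A twist: the automorphism * of W with S* = S and *² = id, recorded by its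
-- restriction σ to S (an involutive permutation of S preserving m).
record Twist (C : CoxeterMatrix) : Set where
  open CoxeterMatrix C
  field
    σ       : S → S
    σ-invol : ∀ s → σ (σ s) ≡ s
    σ-m     : ∀ s t → m (σ s) (σ t) ≡ m s t

alt : {S : Set} → S → S → ℕ → List S
alt s t zero    = []
alt s t (suc k) = s ∷ alt t s k

-- Coxeter group W = ⟨ S | (st)^m(s,t) = 1 ⟩ realised as words modulo the
-- congruence generated by the defining relations; σ is the twist on generators.
module Core {S : Set} (m : S → S → ℕ) (σ : S → S) where

  Word : Set
  Word = List S

  data Rel₀ : Word → Word → Set where
    cancel : ∀ u v s t k → m s t ≡ suc k →
             Rel₀ (u ++ alt s t (2 * m s t) ++ v) (u ++ v)

  _≈_ : Word → Word → Set
  _≈_ = EqClosure Rel₀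

  star : Word → Word
  star = map σ

  inv : Word → Word
  inv = reverse

  Len : Word → ℕ → Set
  Len w k = (∃[ v ] (v ≈ w × length v ≡ k)) × (∀ v → v ≈ w → k ≤ length v)

  RDem : Word → S → Word → Set
  RDem x s y =
      (∃[ a ] ∃[ b ] (Len x a × Len (x ++ [ s ]) b × a < b × y ≈ (x ++ [ s ])))
    ⊎ (∃[ a ] ∃[ b ] (Len x a × Len (x ++ [ s ]) b × b ≤ a × y ≈ x))

  LDem : S → Word → Word → Set
  LDem s x y =
      (∃[ a ] ∃[ b ] (Len x a × Len (s ∷ x) b × a < b × y ≈ (s ∷ x)))
    ⊎ (∃[ a ] ∃[ b ] (Len x a × Len (s ∷ x) b × b ≤ a × y ≈ x))

  -- x ⋉ s ≈ y, where x ⋉ s = (s*)⁻¹ ∘ x ∘ s = s* ∘ (x ∘ s)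
  Step : Word → S → Word → Set
  Step x s y = ∃[ z ] (RDem x s z × LDem (σ s) z y)

  data Reach : Word → Word → Word → Set where
    done : ∀ {x y} → x ≈ y → Reach x [] y
    step : ∀ {x z y s w} → Step x s z → Reach z w y → Reach x (s ∷ w) y

  HatR : Word → Word → Word → Set
  HatR x y w = Reach x w y × (∀ v → Reach x v y → length w ≤ length v)

  HatLen : Word → ℕ → Set
  HatLen y k = ∃[ w ] (HatR [] y w × length w ≡ k)

  Inv : Word → Set
  Inv w = inv w ≈ star w

-- Coxeter matrix of the dihedral parabolic subgroup W_{s,t}, generators false ↦ s, true ↦ t
dihedral : ℕ → Bool → Bool → ℕ
dihedral k false false = 1
dihedral k true  true  = 1
dihedral k false true  = k
dihedral k true  false = k

module Twisted (C : CoxeterMatrix) (T : Twist C) where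
  open CoxeterMatrix C
  open Twist T
  open Core m σ public

  -- θ_a(g) = (u g u⁻¹)* with u = δ̂(a)
  θ : Word → Word → Word
  θ u g = star (u ++ g ++ inv u)

  data MVal (a : Word) (s t : S) : ℕ → Set where
    fixes : ∀ {u k} → Reach [] a u → θ u [ s ] ≈ [ s ] → θ u [ t ] ≈ [ t ] →
            Core.HatLen (dihedral (m s t)) id (alt false true (m s t)) k →
            MVal a s t k
    swaps : ∀ {u k} → Reach [] a u → θ u [ s ] ≈ [ t ] → θ u [ t ] ≈ [ s ] →
            Core.HatLen (dihedral (m s t)) not (alt false true (m s t)) k →
            MVal a s t k
    other : ∀ {u} → Reach [] a u →
            ¬ (θ u [ s ] ≈ [ s ] × θ u [ t ] ≈ [ t ]) →
            ¬ (θ u [ s ] ≈ [ t ] × θ u [ t ] ≈ [ s ]) →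
            MVal a s t (m s t)

  data BraidStep : Word → Word → Set where
    braid : ∀ a b s t k j → m s t ≡ suc j → MVal a s t k →
            BraidStep (a ++ alt s t k ++ b) (a ++ alt t s k ++ b)

  _∼_ : Word → Word → Set
  _∼_ = Star BraidStep

{-# OPTIONS --safe #-}
-- Two reduced words for w that end in s and t meet in the orbit of w under s and t.  Going down
-- from w by s and t alternately leads to an element x without descents in {s, t}, from which both
-- alternating words of one length k ascend to w; induction on the length then connects either
-- word to one of these two.  If θ_x preserves {s, t}, then g ↦ x g intertwines the twisted action of
-- the dihedral group on itself with that on the orbit, so k is the twisted length of Δ.  Otherwise
-- at least m − 1 left factors of Δ* ∘ x ∘ Δ are not absorbed, so its length is at least
-- ℓ(x) + 2m − 1; as each of the k ≤ m steps adds at most 2, k = m.  Conversely δ̂ is invariant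
-- under the braid steps because words with the same Demazure product act in the same way.
--
-- The Coxeter group theory needed (lengths, the word problem, exchange) has to be effective and
-- valid over an arbitrary Coxeter matrix, where Tits' argument uses the numbers 2cos(π/m).
-- These are replaced by adjacency operators of paths, non-negative integer matrices killed by
-- the same Chebyshev polynomials, whose lower Chebyshev polynomials preserve positivity.  The
-- operators for different m need not commute, since the argument only looks at two letters at a time.
module Submission where

open import Defs
open import Data.Bool using (Bool; true; false; not; _xor_)
import Data.Bool.Properties as Boolₚ
open import Data.Empty using (⊥; ⊥-elim)
open import Data.Integer as ℤ using (ℤ; 0ℤ; 1ℤ; +<+)
import Data.Integer.Properties as ℤₚ
open import Data.Integer.Tactic.RingSolver using (solve-∀)
open import Data.List using (List; []; _∷_; _++_; [_]; length; reverse; map; initLast; _∷ʳ′_)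
import Data.List.Properties as Lₚ
open import Data.Nat as ℕ using (ℕ; zero; suc; z≤n; s≤s; s≤s⁻¹; _≤_; _<_; _+_)
open import Data.Nat.DivMod using (_/_; _%_; m≡m%n+[m/n]*n; m%n<n; [m+kn]%n≡m%n; m<n⇒m%n≡m; m<n⇒m/n≡0; m*n/n≡m; +-distrib-/-∣ʳ)
open import Data.Nat.Divisibility using (n∣m*n)
import Data.Nat.Properties as ℕₚ
open import Data.Product using (∃-syntax; _×_; _,_; proj₁; proj₂)
open import Data.Sum using (_⊎_; inj₁; inj₂)
open import Data.Unit using (⊤; tt)
open import Function.Bundles using (_⇔_; mk⇔)
open import Relation.Nullary using (¬_; Dec; yes; no)
open import Relation.Nullary.Decidable using (map′; _×-dec_; decidable-stable)
open import Relation.Binary.Definitions using (tri<; tri≈; tri>)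
open import Relation.Binary.PropositionalEquality hiding (resp; [_])
open import Relation.Binary.Construct.Closure.ReflexiveTransitive as Star using (ε; _◅_; _◅◅_)
open import Relation.Binary.Construct.Closure.Symmetric using (fwd; bwd)
import Relation.Binary.Construct.Closure.Equivalence as Eq
import Relation.Binary.Reasoning.Setoid as SetoidReasoning

-- Chebyshev operators

-- Tits' argument asks two things of c = 2cos(π/m): U_m(c) = 0, which gives the braid relation, and
-- U_k(c) > 0 for 0 < k < m, which gives the signs of the roots met inside a dihedral coset. The
-- adjacency matrix of the path on m - 1 vertices has both properties, the second because by the
-- Clebsch-Gordan rule U_k of it is a 0-1 matrix without zero rows. Since operators for different m
-- meet in one representation, they all act on sequences ℕ → ℤ, cut into blocks of m - 1 entries.
-- With such coefficients it is not clear beforehand that a root has a sign at all. One induction on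
-- words shows that it has one and, if the sign at s is negative, finds a shorter word for w s.
-- Length, the word problem and exchange are drawn from this. Connectedness is proved for all
-- ascending words, those in which no letter is idle, and not only for the shortest ones. As braid
-- steps preserve length, it follows that all ascending words for w are equally long and hence
-- shortest.

Seq : Set
Seq = ℕ → ℤ

infixl 6 _⊕_
_⊕_ : Seq → Seq → Seq
(x ⊕ y) i = x i ℤ.+ y i

⊖_ : Seq → Seq
(⊖ x) i = ℤ.- x i

𝟘 : Seq
𝟘 _ = 0ℤ

Positive : Seq → Set
Positive x = ∀ i → 0ℤ ℤ.< x i

record Linear (c : Seq → Seq) : Set where
  field
    resp : ∀ {x y} → x ≗ y → c x ≗ c y
    add  : ∀ x y → c (x ⊕ y) ≗ c x ⊕ c y
    neg  : ∀ x → c (⊖ x) ≗ ⊖ c x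

  zer : c 𝟘 ≗ 𝟘
  zer i = trans (rearrange (c 𝟘 i)) (trans (cong (ℤ._+ ℤ.- c 𝟘 i) (sym (add 𝟘 𝟘 i))) (ℤₚ.+-inverseʳ (c 𝟘 i)))
    where
    rearrange : ∀ a → a ≡ (a ℤ.+ a) ℤ.+ ℤ.- a
    rearrange = solve-∀

-- At c = 2cos φ this is multiplication by sin(kφ)/sin φ, the coefficient in dihedral root strings:
-- the Chebyshev polynomials of the second kind, rescaled.
U : (Seq → Seq) → ℕ → Seq → Seq
U c zero          x = 𝟘
U c (suc zero)    x = x
U c (suc (suc k)) x = U c (suc k) (c x) ⊕ ⊖ U c k x

private
  interchange : ∀ a b d e → (a ℤ.+ b) ℤ.+ ℤ.- (d ℤ.+ e) ≡ (a ℤ.+ ℤ.- d) ℤ.+ (b ℤ.+ ℤ.- e)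
  interchange = solve-∀

  neg-sub : ∀ a b → ℤ.- a ℤ.+ ℤ.- (ℤ.- b) ≡ ℤ.- (a ℤ.+ ℤ.- b)
  neg-sub = solve-∀

module _ {c : Seq → Seq} (L : Linear c) where
  open Linear L

  U-linear : ∀ k → Linear (U c k)
  U-linear zero = record
    { resp = λ _ _ → refl ; add = λ _ _ _ → refl ; neg = λ _ _ → refl }
  U-linear (suc zero) = record
    { resp = λ e → e ; add = λ _ _ _ → refl ; neg = λ _ _ → refl }
  U-linear (suc (suc k)) = record
    { resp = λ e i → cong₂ (λ a b → a ℤ.+ ℤ.- b) (L₁.resp (resp e) i) (L₀.resp e i)
    ; add  = λ x y i → trans
        (cong₂ (λ a b → a ℤ.+ ℤ.- b)
          (trans (L₁.resp (add x y) i) (L₁.add (c x) (c y) i)) (L₀.add x y i))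
        (interchange (U c (suc k) (c x) i) _ (U c k x i) _)
    ; neg  = λ x i → trans
        (cong₂ (λ a b → a ℤ.+ ℤ.- b)
          (trans (L₁.resp (neg x) i) (L₁.neg (c x) i)) (L₀.neg x i))
        (neg-sub (U c (suc k) (c x) i) (U c k x i)) }
    where module L₁ = Linear (U-linear (suc k))
          module L₀ = Linear (U-linear k)

  U-commute : ∀ {d} → Linear d → (∀ x → c (d x) ≗ d (c x)) →
              ∀ k x → U c k (d x) ≗ d (U c k x)
  U-commute D com zero x i = sym (Linear.zer D i)
  U-commute D com (suc zero) x i = refl
  U-commute {d} D com (suc (suc k)) x i = begin
    U c (suc k) (c (d x)) i ℤ.+ ℤ.- U c k (d x) i
      ≡⟨ cong₂ (λ a b → a ℤ.+ ℤ.- b)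
           (trans (Linear.resp (U-linear (suc k)) (com x) i) (U-commute D com (suc k) (c x) i))
           (U-commute D com k x i) ⟩
    d (U c (suc k) (c x)) i ℤ.+ ℤ.- d (U c k x) i
      ≡⟨ cong (λ a → d (U c (suc k) (c x)) i ℤ.+ a) (sym (Linear.neg D (U c k x) i)) ⟩
    d (U c (suc k) (c x)) i ℤ.+ d (⊖ U c k x) i
      ≡⟨ sym (Linear.add D _ _ i) ⟩
    d (U c (suc k) (c x) ⊕ ⊖ U c k x) i ∎
    where open ≡-Reasoning

  U-step : ∀ k x → U c (suc (suc k)) x ≗ c (U c (suc k) x) ⊕ ⊖ U c k x
  U-step k x i = cong (ℤ._+ ℤ.- U c k x i) (U-commute L (λ _ _ → refl) (suc k) x i)

  U-U : ∀ j k x → U c j (U c k x) ≗ U c k (U c j x)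
  U-U j k = U-commute (U-linear k) (λ x i → sym (U-commute L (λ _ _ → refl) k x i)) j

-- The adjacency operator of the path 1 — 2 — ⋯ — N, acting on each block
-- {qN, …, qN+N-1} of ℕ; its eigenvalues are 2cos(jπ/(N+1)), 1 ≤ j ≤ N.
-- entry f q j is the value of f at vertex j of block q, with entry 0 and N+1 zero.
module Path (n : ℕ) where

  N : ℕ
  N = suc n

  entry′ : (f : Seq) (q j : ℕ) → Dec (j ℕ.< N) → ℤ
  entry′ f q j (yes _) = f (j ℕ.+ q ℕ.* N)
  entry′ f q j (no _)  = 0ℤ

  entry : Seq → ℕ → ℕ → ℤ
  entry f q zero    = 0ℤ
  entry f q (suc j) = entry′ f q j (j ℕ.<? N)

  path : Seq → Seq
  path f i = entry f (i / N) (suc (suc (i % N))) ℤ.+ entry f (i / N) (i % N)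

  entry-resp : ∀ {x y} q → x ≗ y → entry x q ≗ entry y q
  entry-resp q e zero = refl
  entry-resp q e (suc j) with j ℕ.<? N
  ... | yes _ = e _
  ... | no _  = refl

  entry-add : ∀ x y q j → entry (x ⊕ y) q j ≡ entry x q j ℤ.+ entry y q j
  entry-add x y q zero = refl
  entry-add x y q (suc j) with j ℕ.<? N
  ... | yes _ = refl
  ... | no _  = refl

  entry-neg : ∀ x q j → entry (⊖ x) q j ≡ ℤ.- entry x q j
  entry-neg x q zero = refl
  entry-neg x q (suc j) with j ℕ.<? N
  ... | yes _ = refl
  ... | no _  = refl

  entry-top : ∀ f q → entry f q (suc N) ≡ 0ℤ
  entry-top f q with N ℕ.<? N
  ... | yes N<N = ⊥-elim (ℕₚ.<-irrefl refl N<N)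
  ... | no _    = refl

  entry-inside : ∀ f q j → j ℕ.< N → entry f q (suc j) ≡ f (j ℕ.+ q ℕ.* N)
  entry-inside f q j j<N with j ℕ.<? N
  ... | yes _  = refl
  ... | no j≮N = ⊥-elim (j≮N j<N)

  as-entry : ∀ f i → f i ≡ entry f (i / N) (suc (i % N))
  as-entry f i = trans (cong f (m≡m%n+[m/n]*n i N)) (sym (entry-inside f (i / N) (i % N) (m%n<n i N)))

  entry-path : ∀ f q j → j ℕ.< N →
               entry (path f) q (suc j) ≡ entry f q (suc (suc j)) ℤ.+ entry f q j
  entry-path f q j j<N rewrite entry-inside (path f) q j j<N =
    cong₂ (λ a b → entry f a (suc (suc b)) ℤ.+ entry f a b) quot rem
    where
    rem : (j ℕ.+ q ℕ.* N) % N ≡ j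
    rem = trans ([m+kn]%n≡m%n j q N) (m<n⇒m%n≡m j<N)
    quot : (j ℕ.+ q ℕ.* N) / N ≡ q
    quot = trans (+-distrib-/-∣ʳ j (n∣m*n q))
                 (cong₂ ℕ._+_ (m<n⇒m/n≡0 j<N) (m*n/n≡m q N))

  path-linear : Linear path
  path-linear = record
    { resp = λ e i → cong₂ ℤ._+_ (entry-resp (i / N) e (suc (suc (i % N)))) (entry-resp (i / N) e (i % N))
    ; add = λ x y i → trans
        (cong₂ ℤ._+_ (entry-add x y (i / N) (suc (suc (i % N)))) (entry-add x y (i / N) (i % N)))
        (shuffle (entry x (i / N) (suc (suc (i % N)))) _ (entry x (i / N) (i % N)) _)
    ; neg = λ x i → trans
        (cong₂ ℤ._+_ (entry-neg x (i / N) (suc (suc (i % N)))) (entry-neg x (i / N) (i % N)))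
        (sym (ℤₚ.neg-distrib-+ (entry x (i / N) (suc (suc (i % N)))) _)) }
    where
    shuffle : ∀ a b d e → (a ℤ.+ b) ℤ.+ (d ℤ.+ e) ≡ (a ℤ.+ d) ℤ.+ (b ℤ.+ e)
    shuffle = solve-∀

  Uₙ : ℕ → Seq → Seq
  Uₙ = U path

  private
    cancelˡ : ∀ a b → (a ℤ.+ b) ℤ.+ ℤ.- b ≡ a
    cancelˡ = solve-∀
    cancelʳ : ∀ a b → (a ℤ.+ b) ℤ.+ ℤ.- a ≡ b
    cancelʳ = solve-∀

    entry-U-step : ∀ f q i k → entry (Uₙ (suc (suc k)) f) q i ≡
                   entry (Uₙ (suc k) (path f)) q i ℤ.+ ℤ.- entry (Uₙ k f) q i
    entry-U-step f q i k = trans (entry-add _ _ q i)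
      (cong (λ a → entry (Uₙ (suc k) (path f)) q i ℤ.+ a) (entry-neg (Uₙ k f) q i))

  entry-𝟘 : ∀ q i → entry 𝟘 q i ≡ 0ℤ
  entry-𝟘 q zero = refl
  entry-𝟘 q (suc i) with i ℕ.<? N
  ... | yes _ = refl
  ... | no _  = refl

  -- The Chebyshev recursion walks along the path: the sum of the two neighbours of a vertex minus
  -- the previous vertex is the next one. The range includes the fictitious vertex N + 1, whose
  -- entry is zero.
  first : ∀ f q k → k ℕ.≤ suc N → entry (Uₙ k f) q 1 ≡ entry f q k
  first f q zero _ = entry-𝟘 q 1
  first f q (suc zero) _ = refl
  first f q (suc (suc k)) (s≤s k<N) = begin
    entry (Uₙ (suc (suc k)) f) q 1                             ≡⟨ entry-U-step f q 1 k ⟩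
    entry (Uₙ (suc k) (path f)) q 1 ℤ.+ ℤ.- entry (Uₙ k f) q 1
      ≡⟨ cong₂ (λ a b → a ℤ.+ ℤ.- b) (first (path f) q (suc k) (ℕₚ.m≤n⇒m≤1+n k<N))
                                     (first f q k (ℕₚ.≤-trans (ℕₚ.n≤1+n k) (ℕₚ.m≤n⇒m≤1+n k<N))) ⟩
    entry (path f) q (suc k) ℤ.+ ℤ.- entry f q k
      ≡⟨ cong (ℤ._+ ℤ.- entry f q k) (entry-path f q k k<N) ⟩
    (entry f q (suc (suc k)) ℤ.+ entry f q k) ℤ.+ ℤ.- entry f q k ≡⟨ cancelˡ (entry f q (suc (suc k))) _ ⟩
    entry f q (suc (suc k)) ∎
    where open ≡-Reasoning

  last : ∀ f q k j → k ℕ.+ j ≡ suc N → entry (Uₙ k f) q N ≡ entry f q j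
  last f q zero j refl = trans (entry-𝟘 q N) (sym (entry-top f q))
  last f q (suc zero) j refl = refl
  last f q (suc (suc k)) j e = begin
    entry (Uₙ (suc (suc k)) f) q N                             ≡⟨ entry-U-step f q N k ⟩
    entry (Uₙ (suc k) (path f)) q N ℤ.+ ℤ.- entry (Uₙ k f) q N
      ≡⟨ cong₂ (λ a b → a ℤ.+ ℤ.- b)
          (last (path f) q (suc k) (suc j) (cong suc (trans (ℕₚ.+-suc k j) e′)))
          (last f q k (suc (suc j)) (trans (ℕₚ.+-suc k (suc j)) (cong suc (trans (ℕₚ.+-suc k j) e′)))) ⟩
    entry (path f) q (suc j) ℤ.+ ℤ.- entry f q (suc (suc j))
      ≡⟨ cong (ℤ._+ ℤ.- entry f q (suc (suc j)))
          (entry-path f q j (subst (suc j ℕ.≤_) e′ (s≤s (ℕₚ.m≤n+m j k)))) ⟩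
    (entry f q (suc (suc j)) ℤ.+ entry f q j) ℤ.+ ℤ.- entry f q (suc (suc j))
      ≡⟨ cancelʳ (entry f q (suc (suc j))) _ ⟩
    entry f q j ∎
    where open ≡-Reasoning
          e′ : suc (k ℕ.+ j) ≡ N
          e′ = ℕₚ.suc-injective e

  -- Vertex i is read off as the first entry after applying U i, and U i commutes with U k.
  entry-symmetric : ∀ f q i k → i ℕ.≤ suc N → k ℕ.≤ suc N →
                    entry (Uₙ k f) q i ≡ entry (Uₙ i f) q k
  entry-symmetric f q i k i≤ k≤ = begin
    entry (Uₙ k f) q i          ≡⟨ first (Uₙ k f) q i i≤ ⟨
    entry (Uₙ i (Uₙ k f)) q 1   ≡⟨ entry-resp q (U-U path-linear i k f) 1 ⟩
    entry (Uₙ k (Uₙ i f)) q 1   ≡⟨ first (Uₙ i f) q k k≤ ⟩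
    entry (Uₙ i f) q k          ∎
    where open ≡-Reasoning

  -- Reading from the far end of the path reverses i, and symmetry in i and k then reverses k as
  -- well. Pairs with i + k beyond N + 1 are thereby brought back below it.
  entry-flip : ∀ f q i k i′ k′ → i ℕ.+ i′ ≡ suc N → k ℕ.+ k′ ≡ suc N →
               entry (Uₙ k f) q i ≡ entry (Uₙ k′ f) q i′
  entry-flip f q i k i′ k′ ei ek = begin
    entry (Uₙ k f) q i            ≡⟨ last (Uₙ k f) q i′ i (trans (ℕₚ.+-comm i′ i) ei) ⟨
    entry (Uₙ i′ (Uₙ k f)) q N    ≡⟨ entry-resp q (U-U path-linear i′ k f) N ⟩
    entry (Uₙ k (Uₙ i′ f)) q N    ≡⟨ last (Uₙ i′ f) q k k′ ek ⟩
    entry (Uₙ i′ f) q k′          ≡⟨ entry-symmetric f q k′ i′ (bound k ek) (bound i ei) ⟩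
    entry (Uₙ k′ f) q i′          ∎
    where open ≡-Reasoning
          bound : ∀ a {b} → a ℕ.+ b ≡ suc N → b ℕ.≤ suc N
          bound a {b} e = subst (b ℕ.≤_) e (ℕₚ.m≤n+m b a)

  U-top : ∀ f → Uₙ (suc N) f ≗ 𝟘
  U-top f i = begin
    Uₙ (suc N) f i                              ≡⟨ as-entry (Uₙ (suc N) f) i ⟩
    entry (Uₙ (suc N) f) (i / N) (suc (i % N))
      ≡⟨ entry-symmetric f (i / N) (suc (i % N)) (suc N) (ℕₚ.m≤n⇒m≤1+n (m%n<n i N)) ℕₚ.≤-refl ⟩
    entry (Uₙ (suc (i % N)) f) (i / N) (suc N)  ≡⟨ entry-top _ (i / N) ⟩
    0ℤ ∎
    where open ≡-Reasoning

  -- The Clebsch-Gordan rule in recursive form: while k + i ≤ N + 1, entry i of U_k f is the sum of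
  -- the entries |k - i| + 1, |k - i| + 3, ..., k + i - 1 of f, and a diagonal step adds the last of
  -- these terms.
  diagonal : ∀ f q k i → suc (k ℕ.+ i) ℕ.≤ suc N →
             entry (Uₙ (suc k) f) q (suc i) ≡ entry (Uₙ k f) q i ℤ.+ entry f q (suc (k ℕ.+ i))
  diagonal f q zero i _ = sym (trans (cong (ℤ._+ entry f q (suc i)) (entry-𝟘 q i)) (ℤₚ.+-identityˡ _))
  diagonal f q (suc k) i (s≤s h) = begin
    entry (Uₙ (suc (suc k)) f) q (suc i)
      ≡⟨ entry-resp q (U-step path-linear k f) (suc i) ⟩
    entry (path (Uₙ (suc k) f) ⊕ ⊖ Uₙ k f) q (suc i)
      ≡⟨ trans (entry-add _ _ q (suc i)) (cong₂ ℤ._+_ (entry-path (Uₙ (suc k) f) q i (ℕₚ.≤-trans (s≤s (ℕₚ.m≤n+m i k)) h))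
               (entry-neg (Uₙ k f) q (suc i))) ⟩
    (entry (Uₙ (suc k) f) q (suc (suc i)) ℤ.+ entry (Uₙ (suc k) f) q i) ℤ.+ ℤ.- entry (Uₙ k f) q (suc i)
      ≡⟨ cong (λ a → (a ℤ.+ entry (Uₙ (suc k) f) q i) ℤ.+ ℤ.- entry (Uₙ k f) q (suc i))
           (trans (diagonal f q k (suc i) (s≤s (subst (ℕ._≤ N) (sym (ℕₚ.+-suc k i)) h)))
                  (cong (λ a → entry (Uₙ k f) q (suc i) ℤ.+ entry f q (suc a)) (ℕₚ.+-suc k i))) ⟩
    ((entry (Uₙ k f) q (suc i) ℤ.+ entry f q (suc (suc k ℕ.+ i))) ℤ.+ entry (Uₙ (suc k) f) q i)
      ℤ.+ ℤ.- entry (Uₙ k f) q (suc i)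
      ≡⟨ rearrange (entry (Uₙ k f) q (suc i)) (entry f q (suc (suc k ℕ.+ i))) (entry (Uₙ (suc k) f) q i) ⟩
    entry (Uₙ (suc k) f) q i ℤ.+ entry f q (suc (suc k ℕ.+ i)) ∎
    where
    open ≡-Reasoning
    rearrange : ∀ a b d → ((a ℤ.+ b) ℤ.+ d) ℤ.+ ℤ.- a ≡ d ℤ.+ b
    rearrange = solve-∀

  module _ {f : Seq} (f>0 : Positive f) where

    entry-positive : ∀ q i → i ℕ.< N → 0ℤ ℤ.< entry f q (suc i)
    entry-positive q i i<N = subst (0ℤ ℤ.<_) (sym (entry-inside f q i i<N)) (f>0 _)

    triangle : ∀ q k i → suc k ℕ.+ suc i ℕ.≤ suc N → 0ℤ ℤ.< entry (Uₙ (suc k) f) q (suc i)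
    triangle q zero i (s≤s h) = entry-positive q i h
    triangle q (suc k) i h = subst (0ℤ ℤ.<_) (sym (diagonal f q (suc k) i (ℕₚ.≤-trans le (ℕₚ.n≤1+n N))))
      (ℤₚ.+-mono-≤-< (rest i h) (entry-positive q (suc k ℕ.+ i) le))
      where
      le : suc (suc k ℕ.+ i) ℕ.≤ N
      le = subst (ℕ._≤ N) (ℕₚ.+-suc (suc k) i) (s≤s⁻¹ h)
      rest : ∀ i → suc (suc k) ℕ.+ suc i ℕ.≤ suc N → 0ℤ ℤ.≤ entry (Uₙ (suc k) f) q i
      rest zero _ = ℤₚ.≤-refl
      rest (suc i) h′ = ℤₚ.<⇒≤ (triangle q k i (ℕₚ.≤-trans
        (ℕₚ.+-mono-≤ (ℕₚ.n≤1+n (suc k)) (ℕₚ.n≤1+n (suc i))) h′))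

    entry-U-positive : ∀ q k i → k ℕ.< N → i ℕ.< N → 0ℤ ℤ.< entry (Uₙ (suc k) f) q (suc i)
    entry-U-positive q k i k<N i<N with (suc k ℕ.+ suc i) ℕ.≤? suc N
    ... | yes h = triangle q k i h
    ... | no h with ℕₚ.m<n⇒0<n∸m k<N | ℕₚ.m<n⇒0<n∸m i<N
    ...   | k⁺ | i⁺ with N ℕ.∸ k in ek | N ℕ.∸ i in ei
    ...     | suc k′ | suc i′ = subst (0ℤ ℤ.<_)
                (sym (entry-flip f q (suc i) (suc k) (suc i′) (suc k′) (cong suc eqi) (cong suc eqk)))
                (triangle q k′ i′ bound)
      where
      eqk : k ℕ.+ suc k′ ≡ N
      eqk = trans (cong (k ℕ.+_) (sym ek)) (ℕₚ.m+[n∸m]≡n (ℕₚ.<⇒≤ k<N))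
      eqi : i ℕ.+ suc i′ ≡ N
      eqi = trans (cong (i ℕ.+_) (sym ei)) (ℕₚ.m+[n∸m]≡n (ℕₚ.<⇒≤ i<N))
      bound : suc k′ ℕ.+ suc i′ ℕ.≤ suc N
      bound = ℕₚ.+-cancelˡ-≤ (suc k ℕ.+ suc i) _ _ (subst (ℕ._≤ (suc k ℕ.+ suc i) ℕ.+ suc N) total
                (ℕₚ.+-monoˡ-≤ (suc N) (ℕₚ.<⇒≤ (ℕₚ.≰⇒> h))))
        where
        shuffle : ∀ a b d e → (a ℕ.+ b) ℕ.+ (d ℕ.+ e) ≡ (a ℕ.+ d) ℕ.+ (b ℕ.+ e)
        shuffle a b d e = trans (ℕₚ.+-assoc a b (d ℕ.+ e)) (trans (cong (a ℕ.+_)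
          (trans (sym (ℕₚ.+-assoc b d e)) (trans (cong (ℕ._+ e) (ℕₚ.+-comm b d)) (ℕₚ.+-assoc d b e))))
          (sym (ℕₚ.+-assoc a d (b ℕ.+ e))))
        total : suc N ℕ.+ suc N ≡ (suc k ℕ.+ suc i) ℕ.+ (suc k′ ℕ.+ suc i′)
        total = trans (cong₂ (λ a b → suc a ℕ.+ suc b) (sym eqk) (sym eqi))
                      (shuffle (suc k) (suc k′) (suc i) (suc i′))

    U-positive : ∀ k → k ℕ.< N → Positive (Uₙ (suc k) f)
    U-positive k k<N i = subst (0ℤ ℤ.<_) (sym (as-entry (Uₙ (suc k) f) i))
      (entry-U-positive (i / N) k (i % N) k<N (m%n<n i N))

-- The analogue of 2cos(π/m), with 0 encoding m = ∞ (value 2); m = 1 gives -2.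
cox : ℕ → Seq → Seq
cox zero          x = x ⊕ x
cox (suc zero)    x = ⊖ (x ⊕ x)
cox (suc (suc n)) x = Path.path n x

cox-linear : ∀ m → Linear (cox m)
cox-linear zero = record
  { resp = λ e i → cong₂ ℤ._+_ (e i) (e i)
  ; add = λ x y i → shuffle (x i) (y i)
  ; neg = λ x i → sym (ℤₚ.neg-distrib-+ (x i) (x i)) }
  where
  shuffle : ∀ a b → (a ℤ.+ b) ℤ.+ (a ℤ.+ b) ≡ (a ℤ.+ a) ℤ.+ (b ℤ.+ b)
  shuffle = solve-∀
cox-linear (suc zero) = record
  { resp = λ e i → cong ℤ.-_ (cong₂ ℤ._+_ (e i) (e i))
  ; add = λ x y i → shuffle (x i) (y i)
  ; neg = λ x i → flipped (x i) }
  where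
  shuffle : ∀ a b → ℤ.- ((a ℤ.+ b) ℤ.+ (a ℤ.+ b)) ≡ ℤ.- (a ℤ.+ a) ℤ.+ ℤ.- (b ℤ.+ b)
  shuffle = solve-∀
  flipped : ∀ a → ℤ.- (ℤ.- a ℤ.+ ℤ.- a) ≡ ℤ.- (ℤ.- (a ℤ.+ a))
  flipped = solve-∀
cox-linear (suc (suc n)) = Path.path-linear n

U-cox-top : ∀ n x → U (cox (suc (suc n))) (suc (suc n)) x ≗ 𝟘
U-cox-top n = Path.U-top n

U-cox-positive : ∀ m k {x} → Positive x → suc k ℕ.< m ⊎ m ≡ 0 → Positive (U (cox m) (suc k) x)
U-cox-positive .0 k {x} x>0 (inj₂ refl) i = subst (0ℤ ℤ.<_) (sym (linear k x i)) (go k)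
  where
  multiple : ℕ → ℤ → ℤ
  multiple zero    a = a
  multiple (suc k) a = a ℤ.+ multiple k a
  double : ∀ k a → multiple k (a ℤ.+ a) ≡ multiple k a ℤ.+ multiple k a
  double zero a = refl
  double (suc k) a = trans (cong (λ b → (a ℤ.+ a) ℤ.+ b) (double k a)) (shuffle a (multiple k a))
    where shuffle : ∀ a b → (a ℤ.+ a) ℤ.+ (b ℤ.+ b) ≡ (a ℤ.+ b) ℤ.+ (a ℤ.+ b)
          shuffle = solve-∀
  -- At c = 2 the Chebyshev value with index k + 1 is the number k + 1.
  linear : ∀ k x i → U (cox 0) (suc k) x i ≡ multiple k (x i)
  linear zero x i = refl
  linear (suc zero) x i = ℤₚ.+-identityʳ _
  linear (suc (suc k)) x i = trans
    (cong₂ (λ a b → a ℤ.+ ℤ.- b) (trans (linear (suc k) (x ⊕ x) i) (double (suc k) (x i))) (linear k x i))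
    (shuffle (x i) (multiple k (x i)))
    where shuffle : ∀ a b → ((a ℤ.+ b) ℤ.+ (a ℤ.+ b)) ℤ.+ ℤ.- b ≡ a ℤ.+ (a ℤ.+ b)
          shuffle = solve-∀
  go : ∀ k → 0ℤ ℤ.< multiple k (x i)
  go zero = x>0 i
  go (suc k) = ℤₚ.+-mono-< (x>0 i) (go k)
U-cox-positive (suc (suc n)) k x>0 (inj₁ (s≤s k<)) = Path.U-positive n x>0 k k<
U-cox-positive (suc zero) k x>0 (inj₁ (s≤s ()))

-- Alternating words

-- Letters are counted from 0.
letter : {S : Set} → S → S → ℕ → S
letter s t zero    = s
letter s t (suc k) = letter t s k

module _ {S : Set} where

  alt-snoc : ∀ (s t : S) k → alt s t (suc k) ≡ alt s t k ++ [ letter s t k ]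
  alt-snoc s t zero    = refl
  alt-snoc s t (suc k) = cong (s ∷_) (alt-snoc t s k)

  alt-+ : ∀ (s t : S) j k → alt s t (j ℕ.+ k) ≡ alt s t j ++ alt (letter s t j) (letter t s j) k
  alt-+ s t zero    k = refl
  alt-+ s t (suc j) k = cong (s ∷_) (alt-+ t s j k)

  reverse-alt : ∀ (s t : S) k → reverse (alt s t k) ≡ alt (letter t s k) (letter s t k) k
  reverse-alt s t zero    = refl
  reverse-alt s t (suc k) = begin
    reverse (alt s t (suc k))                       ≡⟨ cong reverse (alt-snoc s t k) ⟩
    reverse (alt s t k ++ [ letter s t k ])         ≡⟨ Lₚ.reverse-++ (alt s t k) _ ⟩
    letter s t k ∷ reverse (alt s t k)              ≡⟨ cong (letter s t k ∷_) (reverse-alt s t k) ⟩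
    letter s t k ∷ alt (letter t s k) (letter s t k) k ∎
    where open ≡-Reasoning

  alt-double : ∀ (s t : S) k → alt s t (2 ℕ.* k) ≡ alt s t k ++ reverse (alt t s k)
  alt-double s t k = trans (cong (alt s t) (cong (k ℕ.+_) (ℕₚ.+-identityʳ k)))
    (trans (alt-+ s t k k) (cong (alt s t k ++_) (sym (reverse-alt t s k))))

  length-alt : ∀ (s t : S) k → length (alt s t k) ≡ k
  length-alt s t zero    = refl
  length-alt s t (suc k) = cong suc (length-alt t s k)

  map-alt : ∀ {R : Set} (f : S → R) s t k → map f (alt s t k) ≡ alt (f s) (f t) k
  map-alt f s t zero    = refl
  map-alt f s t (suc k) = cong (f s ∷_) (map-alt f t s k)

  length-∷ʳ : ∀ (w : List S) s → length (w ++ [ s ]) ≡ suc (length w)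
  length-∷ʳ w s = trans (Lₚ.length-++ w) (ℕₚ.+-comm (length w) 1)

-- Since S has no decidable equality, the letters s, t with m s t ≡ 1 are only
-- known to be equal in W; m-cong says that m cannot tell them apart.
record System : Set₁ where
  field
    S       : Set
    m       : S → S → ℕ
    σ       : S → S
    m-sym   : ∀ s t → m s t ≡ m t s
    m-diag  : ∀ s → m s s ≡ 1
    m-cong  : ∀ {s t} → m s t ≡ 1 → ∀ r → m s r ≡ m t r
    σ-invol : ∀ s → σ (σ s) ≡ s
    σ-m     : ∀ s t → m (σ s) (σ t) ≡ m s t

-- Group calculus with words modulo the Coxeter relations

module Words (Y : System) where
  open System Y
  open Core m σ renaming (_≈_ to infix 4 _≈_)

  ≈refl : ∀ {u} → u ≈ u
  ≈refl = ε

  ≈sym : ∀ {u v} → u ≈ v → v ≈ u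
  ≈sym = Eq.symmetric Rel₀

  ≈trans : ∀ {u v w} → u ≈ v → v ≈ w → u ≈ w
  ≈trans = _◅◅_

  ≡⇒≈ : ∀ {u v} → u ≡ v → u ≈ v
  ≡⇒≈ refl = ε

  module ≈-Reasoning = SetoidReasoning (Eq.setoid Rel₀)

  private
    gmap : ∀ (f : Word → Word) → (∀ {u v} → Rel₀ u v → Rel₀ (f u) (f v)) → ∀ {u v} → u ≈ v → f u ≈ f v
    gmap f h = Eq.gmap f h

  ++ˡ : ∀ a {u v} → u ≈ v → a ++ u ≈ a ++ v
  ++ˡ a = gmap (a ++_) onRel
    where
    onRel : ∀ {u v} → Rel₀ u v → Rel₀ (a ++ u) (a ++ v)
    onRel (cancel u v s t k e) = subst₂ Rel₀ (Lₚ.++-assoc a u _) (Lₚ.++-assoc a u v) (cancel (a ++ u) v s t k e)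

  ++ʳ : ∀ b {u v} → u ≈ v → u ++ b ≈ v ++ b
  ++ʳ b = gmap (_++ b) onRel
    where
    onRel : ∀ {u v} → Rel₀ u v → Rel₀ (u ++ b) (v ++ b)
    onRel (cancel u v s t k e) = subst₂ Rel₀
      (sym (trans (Lₚ.++-assoc u _ b) (cong (u ++_) (Lₚ.++-assoc (alt s t (2 ℕ.* m s t)) v b))))
      (sym (Lₚ.++-assoc u v b)) (cancel u (v ++ b) s t k e)

  assoc : ∀ a b {c} → (a ++ b) ++ c ≈ a ++ (b ++ c)
  assoc a b {c} = ≡⇒≈ (Lₚ.++-assoc a b c)

  relation : ∀ s t {k} → m s t ≡ suc k → alt s t (2 ℕ.* m s t) ≈ []
  relation s t {k} e = subst (_≈ []) (Lₚ.++-identityʳ _) (fwd (cancel [] [] s t k e) ◅ ε)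

  square : ∀ s → s ∷ s ∷ [] ≈ []
  square s = subst (λ k → alt s s (2 ℕ.* k) ≈ []) (m-diag s) (relation s s (m-diag s))

  square-inner : ∀ s w → s ∷ s ∷ w ≈ w
  square-inner s w = ++ʳ w (square s)

  square-end : ∀ w s → (w ++ [ s ]) ++ [ s ] ≈ w
  square-end w s = ≈trans (assoc w [ s ]) (≈trans (++ˡ w (square s)) (≡⇒≈ (Lₚ.++-identityʳ w)))

  inv-∷ : ∀ s w → inv (s ∷ w) ≡ inv w ++ [ s ]
  inv-∷ s w = Lₚ.unfold-reverse s w

  inv-++ : ∀ u v → inv (u ++ v) ≡ inv v ++ inv u
  inv-++ = Lₚ.reverse-++

  inv-inv : ∀ w → inv (inv w) ≡ w
  inv-inv = Lₚ.reverse-involutive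

  inverseʳ : ∀ w → w ++ inv w ≈ []
  inverseʳ [] = ε
  inverseʳ (s ∷ w) = begin
    s ∷ (w ++ inv (s ∷ w))        ≡⟨ cong (λ v → s ∷ (w ++ v)) (inv-∷ s w) ⟩
    s ∷ (w ++ (inv w ++ [ s ]))   ≡⟨ cong (s ∷_) (sym (Lₚ.++-assoc w (inv w) [ s ])) ⟩
    s ∷ ((w ++ inv w) ++ [ s ])   ≈⟨ ++ˡ [ s ] (++ʳ [ s ] (inverseʳ w)) ⟩
    s ∷ s ∷ []                    ≈⟨ square s ⟩
    []                            ∎
    where open ≈-Reasoning

  inverseˡ : ∀ w → inv w ++ w ≈ []
  inverseˡ w = subst (λ v → inv w ++ v ≈ []) (inv-inv w) (inverseʳ (inv w))

  quotient : ∀ u v → u ++ inv v ≈ [] → u ≈ v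
  quotient u v e = begin
    u                    ≡⟨ sym (Lₚ.++-identityʳ u) ⟩
    u ++ []              ≈⟨ ++ˡ u (≈sym (inverseˡ v)) ⟩
    u ++ (inv v ++ v)    ≡⟨ sym (Lₚ.++-assoc u (inv v) v) ⟩
    (u ++ inv v) ++ v    ≈⟨ ++ʳ v e ⟩
    v                    ∎
    where open ≈-Reasoning

  cancelˡ : ∀ a {u v} → a ++ u ≈ a ++ v → u ≈ v
  cancelˡ a {u} {v} e = begin
    u                    ≈⟨ ++ʳ u (≈sym (inverseˡ a)) ⟩
    (inv a ++ a) ++ u    ≡⟨ Lₚ.++-assoc (inv a) a u ⟩
    inv a ++ (a ++ u)    ≈⟨ ++ˡ (inv a) e ⟩
    inv a ++ (a ++ v)    ≡⟨ sym (Lₚ.++-assoc (inv a) a v) ⟩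
    (inv a ++ a) ++ v    ≈⟨ ++ʳ v (inverseˡ a) ⟩
    v                    ∎
    where open ≈-Reasoning

  cancelʳ : ∀ b {u v} → u ++ b ≈ v ++ b → u ≈ v
  cancelʳ b {u} {v} e = quotient u v (begin
    u ++ inv v                     ≡⟨ cong (_++ inv v) (sym (Lₚ.++-identityʳ u)) ⟩
    (u ++ []) ++ inv v             ≈⟨ ++ʳ (inv v) (++ˡ u (≈sym (inverseʳ b))) ⟩
    (u ++ (b ++ inv b)) ++ inv v   ≡⟨ cong (_++ inv v) (sym (Lₚ.++-assoc u b (inv b))) ⟩
    ((u ++ b) ++ inv b) ++ inv v   ≈⟨ ++ʳ (inv v) (++ʳ (inv b) e) ⟩
    ((v ++ b) ++ inv b) ++ inv v   ≡⟨ cong (_++ inv v) (Lₚ.++-assoc v b (inv b)) ⟩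
    (v ++ (b ++ inv b)) ++ inv v   ≈⟨ ++ʳ (inv v) (++ˡ v (inverseʳ b)) ⟩
    (v ++ []) ++ inv v             ≡⟨ cong (_++ inv v) (Lₚ.++-identityʳ v) ⟩
    v ++ inv v                     ≈⟨ inverseʳ v ⟩
    []                             ∎)
    where open ≈-Reasoning

  inv-cong : ∀ {u v} → u ≈ v → inv u ≈ inv v
  inv-cong {u} {v} e = quotient (inv u) (inv v) (begin
    inv u ++ inv (inv v)  ≡⟨ cong (inv u ++_) (inv-inv v) ⟩
    inv u ++ v            ≈⟨ ++ˡ (inv u) (≈sym e) ⟩
    inv u ++ u            ≈⟨ inverseˡ u ⟩
    []                    ∎)
    where open ≈-Reasoning

  inv-cancel : ∀ {u v} → inv u ≈ inv v → u ≈ v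
  inv-cancel {u} {v} e = subst₂ _≈_ (inv-inv u) (inv-inv v) (inv-cong e)

  star-cong : ∀ {u v} → u ≈ v → star u ≈ star v
  star-cong = gmap star onRel
    where
    onRel : ∀ {u v} → Rel₀ u v → Rel₀ (star u) (star v)
    onRel (cancel u v s t k e) = subst₂ Rel₀
      (sym (trans (Lₚ.map-++ σ u _) (cong (star u ++_) (trans (Lₚ.map-++ σ (alt s t (2 ℕ.* m s t)) v)
        (cong (_++ star v) (trans (map-alt σ s t (2 ℕ.* m s t)) (cong (λ j → alt (σ s) (σ t) (2 ℕ.* j)) (sym (σ-m s t)))))))))
      (sym (Lₚ.map-++ σ u v))
      (cancel (star u) (star v) (σ s) (σ t) k (trans (σ-m s t) e))

  star-star : ∀ w → star (star w) ≡ w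
  star-star [] = refl
  star-star (s ∷ w) = cong₂ _∷_ (σ-invol s) (star-star w)

  star-inv : ∀ w → star (inv w) ≡ inv (star w)
  star-inv w = Lₚ.reverse-map σ w

  braid-relation : ∀ s t {k} → m s t ≡ suc k → alt s t (m s t) ≈ alt t s (m s t)
  braid-relation s t e = quotient _ _ (subst (_≈ []) (alt-double s t (m s t)) (relation s t e))

  same-letter : ∀ {s t} → m s t ≡ 1 → [ s ] ≈ [ t ]
  same-letter {s} {t} e = subst (λ k → alt s t k ≈ alt t s k) e (braid-relation s t e)

-- The reflection action on functions S → Seq, dual to the geometric representation

module Action (Y : System) where
  open System Y
  open Core m σ renaming (_≈_ to infix 4 _≈_)
  open Words Y

  Vector : Set
  Vector = S → Seq

  infix 4 _≐_
  _≐_ : Vector → Vector → Set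
  φ ≐ ψ = ∀ r → φ r ≗ ψ r

  Respectful : Vector → Set
  Respectful φ = ∀ {s t} → m s t ≡ 1 → φ s ≗ φ t

  C : S → S → Seq → Seq
  C s r = cox (m s r)

  C-linear : ∀ s r → Linear (C s r)
  C-linear s r = cox-linear (m s r)

  -- Dual to the reflection α_r ↦ α_r + c α_s of simple roots, so that `act w φ r` plays the part of
  -- the value of φ at the root w(α_r). Passing to the dual makes the leftmost letter act first.
  reflect : S → Vector → Vector
  reflect s φ r = φ r ⊕ C s r (φ s)

  act : Word → Vector → Vector
  act []      φ = φ
  act (s ∷ w) φ = act w (reflect s φ)

  act-++ : ∀ u v φ → act (u ++ v) φ ≡ act v (act u φ)
  act-++ []      v φ = refl
  act-++ (s ∷ u) v φ = act-++ u v (reflect s φ)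

  reflect-resp : ∀ s {φ ψ} → φ ≐ ψ → reflect s φ ≐ reflect s ψ
  reflect-resp s e r i = cong₂ ℤ._+_ (e r i) (Linear.resp (C-linear s r) (e s) i)

  act-resp : ∀ w {φ ψ} → φ ≐ ψ → act w φ ≐ act w ψ
  act-resp []      e = e
  act-resp (s ∷ w) e = act-resp w (reflect-resp s e)

  reflect-respectful : ∀ s {φ} → Respectful φ → Respectful (reflect s φ)
  reflect-respectful s {φ} R {r} {r′} e i = cong₂ ℤ._+_ (R e i)
    (cong (λ k → cox k (φ s) i) (trans (m-sym s r) (trans (m-cong e s) (m-sym r′ s))))

  act-respectful : ∀ w {φ} → Respectful φ → Respectful (act w φ)
  act-respectful []      R = R
  act-respectful (s ∷ w) R = act-respectful w (reflect-respectful s R)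

  reflect-self : ∀ s φ → reflect s φ s ≗ ⊖ φ s
  reflect-self s φ i = trans (cong (λ k → φ s i ℤ.+ cox k (φ s) i) (m-diag s)) (arith (φ s i))
    where arith : ∀ a → a ℤ.+ ℤ.- (a ℤ.+ a) ≡ ℤ.- a
          arith = solve-∀

  reflect-reflect : ∀ s φ → reflect s (reflect s φ) ≐ φ
  reflect-reflect s φ r i = trans
    (cong (λ a → (φ r i ℤ.+ C s r (φ s) i) ℤ.+ a)
      (trans (Linear.resp (C-linear s r) (reflect-self s φ) i) (Linear.neg (C-linear s r) (φ s) i)))
    (arith (φ r i) (C s r (φ s) i))
    where arith : ∀ a b → (a ℤ.+ b) ℤ.+ ℤ.- b ≡ a
          arith = solve-∀

  act-inverse : ∀ w φ → act (w ++ inv w) φ ≐ φ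
  act-inverse [] φ r i = refl
  act-inverse (s ∷ w) φ r i = begin
    act (w ++ inv (s ∷ w)) ψ r i           ≡⟨ cong (λ v → act (w ++ v) ψ r i) (inv-∷ s w) ⟩
    act (w ++ (inv w ++ [ s ])) ψ r i      ≡⟨ cong (λ v → act v ψ r i) (sym (Lₚ.++-assoc w (inv w) [ s ])) ⟩
    act ((w ++ inv w) ++ [ s ]) ψ r i      ≡⟨ cong (λ χ → χ r i) (act-++ (w ++ inv w) [ s ] ψ) ⟩
    reflect s (act (w ++ inv w) ψ) r i     ≡⟨ reflect-resp s (act-inverse w ψ) r i ⟩
    reflect s ψ r i                        ≡⟨ reflect-reflect s φ r i ⟩
    φ r i                                  ∎
    where open ≡-Reasoning
          ψ : Vector
          ψ = reflect s φ

  -- The rank two root formula: consecutive Chebyshev values are the coordinates of the root of the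
  -- next letter. Only the operator of the pair s, t enters, which is why the operators of other
  -- pairs need not commute with it.
  act-alt-next : ∀ s t k φ →
    act (alt s t k) φ (letter s t k) ≗ U (C s t) (suc k) (φ s) ⊕ U (C s t) k (φ t)
  act-alt-next s t zero φ i = sym (ℤₚ.+-identityʳ _)
  act-alt-next s t (suc k) φ i = begin
    act (alt t s k) ψ (letter t s k) i           ≡⟨ act-alt-next t s k ψ i ⟩
    U (C t s) (suc k) (ψ t) i ℤ.+ U (C t s) k (ψ s) i
      ≡⟨ cong (λ n → U (cox n) (suc k) (ψ t) i ℤ.+ U (cox n) k (ψ s) i) (m-sym t s) ⟩
    U c (suc k) (φ t ⊕ c (φ s)) i ℤ.+ U c k (ψ s) i
      ≡⟨ cong₂ ℤ._+_ (Linear.add (U-linear L (suc k)) (φ t) (c (φ s)) i)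
          (trans (Linear.resp (U-linear L k) (reflect-self s φ) i) (Linear.neg (U-linear L k) (φ s) i)) ⟩
    (U c (suc k) (φ t) i ℤ.+ U c (suc k) (c (φ s)) i) ℤ.+ ℤ.- U c k (φ s) i
      ≡⟨ arith (U c (suc k) (φ t) i) _ _ ⟩
    (U c (suc k) (c (φ s)) i ℤ.+ ℤ.- U c k (φ s) i) ℤ.+ U c (suc k) (φ t) i ∎
    where
    open ≡-Reasoning
    ψ : Vector
    ψ = reflect s φ
    c = C s t
    L = C-linear s t
    arith : ∀ a b d → (a ℤ.+ b) ℤ.+ d ≡ (b ℤ.+ d) ℤ.+ a
    arith = solve-∀

  act-alt-snoc : ∀ s t k φ r → act (alt s t (suc k)) φ r ≗
    act (alt s t k) φ r ⊕ C (letter s t k) r (U (C s t) (suc k) (φ s) ⊕ U (C s t) k (φ t))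
  act-alt-snoc s t k φ r i = begin
    act (alt s t (suc k)) φ r i                     ≡⟨ cong (λ w → act w φ r i) (alt-snoc s t k) ⟩
    act (alt s t k ++ [ letter s t k ]) φ r i       ≡⟨ cong (λ χ → χ r i) (act-++ (alt s t k) [ letter s t k ] φ) ⟩
    act (alt s t k) φ r i ℤ.+ C (letter s t k) r (act (alt s t k) φ (letter s t k)) i
      ≡⟨ cong (λ a → act (alt s t k) φ r i ℤ.+ a) (Linear.resp (C-linear (letter s t k) r) (act-alt-next s t k φ) i) ⟩
    act (alt s t k) φ r i ℤ.+ C (letter s t k) r (U (C s t) (suc k) (φ s) ⊕ U (C s t) k (φ t)) i ∎
    where open ≡-Reasoning

  -- For k + 1 = m the U-terms vanish, which gives the braid relation.
  act-alt-difference : ∀ s t k φ r →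
    act (alt s t (suc k)) φ r ⊕ C (letter t s k) r (U (C s t) (suc k) (φ t)) ≗
    act (alt t s (suc k)) φ r ⊕ C (letter s t k) r (U (C s t) (suc k) (φ s))
  act-alt-difference s t zero φ r i = arith (φ r i) (C s r (φ s) i) (C t r (φ t) i)
    where arith : ∀ a b d → (a ℤ.+ b) ℤ.+ d ≡ (a ℤ.+ d) ℤ.+ b
          arith = solve-∀
  act-alt-difference s t (suc k) φ r i = begin
    act (alt s t (suc (suc k))) φ r i ℤ.+ P (u₂ (φ t)) i
      ≡⟨ cong (λ a → a ℤ.+ P (u₂ (φ t)) i) (trans (act-alt-snoc s t (suc k) φ r i)
            (cong (λ a → G ℤ.+ a) (Linear.add (C-linear (letter t s k) r) (u₂ (φ s)) (u₁ (φ t)) i))) ⟩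
    (G ℤ.+ (Q (u₂ (φ s)) i ℤ.+ Q (u₁ (φ t)) i)) ℤ.+ P (u₂ (φ t)) i
      ≡⟨ arith₁ G (Q (u₂ (φ s)) i) (Q (u₁ (φ t)) i) (P (u₂ (φ t)) i) ⟩
    (G ℤ.+ Q (u₁ (φ t)) i) ℤ.+ (Q (u₂ (φ s)) i ℤ.+ P (u₂ (φ t)) i)
      ≡⟨ cong (λ a → a ℤ.+ (Q (u₂ (φ s)) i ℤ.+ P (u₂ (φ t)) i)) (act-alt-difference s t k φ r i) ⟩
    (H ℤ.+ P (u₁ (φ s)) i) ℤ.+ (Q (u₂ (φ s)) i ℤ.+ P (u₂ (φ t)) i)
      ≡⟨ arith₂ H _ _ _ ⟩
    (H ℤ.+ (P (u₂ (φ t)) i ℤ.+ P (u₁ (φ s)) i)) ℤ.+ Q (u₂ (φ s)) i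
      ≡⟨ cong (λ a → a ℤ.+ Q (u₂ (φ s)) i) (sym (trans (act-alt-snoc t s (suc k) φ r i)
            (trans (cong (λ n → H ℤ.+ P (U (cox n) (suc (suc k)) (φ t) ⊕ U (cox n) (suc k) (φ s)) i) (m-sym t s))
            (cong (λ a → H ℤ.+ a) (Linear.add (C-linear (letter s t k) r) (u₂ (φ t)) (u₁ (φ s)) i))))) ⟩
    act (alt t s (suc (suc k))) φ r i ℤ.+ Q (u₂ (φ s)) i ∎
    where
    open ≡-Reasoning
    P Q u₁ u₂ : Seq → Seq
    P = C (letter s t k) r
    Q = C (letter t s k) r
    u₁ = U (C s t) (suc k)
    u₂ = U (C s t) (suc (suc k))
    G H : ℤ
    G = act (alt s t (suc k)) φ r i
    H = act (alt t s (suc k)) φ r i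
    arith₁ : ∀ a b d e → (a ℤ.+ (b ℤ.+ d)) ℤ.+ e ≡ (a ℤ.+ d) ℤ.+ (b ℤ.+ e)
    arith₁ = solve-∀
    arith₂ : ∀ a b d e → (a ℤ.+ b) ℤ.+ (d ℤ.+ e) ≡ (a ℤ.+ (e ℤ.+ b)) ℤ.+ d
    arith₂ = solve-∀

  act-braid : ∀ s t {k} → m s t ≡ suc k → ∀ {φ} → Respectful φ →
              act (alt s t (m s t)) φ ≐ act (alt t s (m s t)) φ
  -- For m = 1 the polynomial U_1 is the identity and nothing vanishes; here the two letters are
  -- equal in W, and `Respectful` does the work instead.
  act-braid s t {zero} e {φ} R r i rewrite e =
    cong (λ a → φ r i ℤ.+ a) (trans (cong (λ n → cox n (φ s) i) (m-cong e r)) (Linear.resp (C-linear t r) (R e) i))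
  act-braid s t {suc k} e {φ} R r i = subst (λ n → act (alt s t n) φ r i ≡ act (alt t s n) φ r i) (sym e) (begin
    act (alt s t (suc (suc k))) φ r i  ≡⟨ sym (vanish (letter t s (suc k)) (φ t) _) ⟩
    _                                  ≡⟨ act-alt-difference s t (suc k) φ r i ⟩
    _                                  ≡⟨ vanish (letter s t (suc k)) (φ s) _ ⟩
    act (alt t s (suc (suc k))) φ r i  ∎)
    where
    open ≡-Reasoning
    top : ∀ x → U (C s t) (suc (suc k)) x ≗ 𝟘
    top x = subst (λ n → U (cox n) (suc (suc k)) x ≗ 𝟘) (sym e) (U-cox-top k x)
    vanish : ∀ l x a → a ℤ.+ C l r (U (C s t) (suc (suc k)) x) i ≡ a
    vanish l x a = trans (cong (λ b → a ℤ.+ b)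
      (trans (Linear.resp (C-linear l r) (top x) i) (Linear.zer (C-linear l r) i))) (ℤₚ.+-identityʳ a)

  act-relation : ∀ s t {k} → m s t ≡ suc k → ∀ {φ} → Respectful φ → act (alt s t (2 ℕ.* m s t)) φ ≐ φ
  act-relation s t e {φ} R r i = begin
    act (alt s t (2 ℕ.* m s t)) φ r i       ≡⟨ cong (λ w → act w φ r i) (alt-double s t (m s t)) ⟩
    act (h ++ inv h′) φ r i                 ≡⟨ cong (λ χ → χ r i) (act-++ h (inv h′) φ) ⟩
    act (inv h′) (act h φ) r i              ≡⟨ act-resp (inv h′) (act-braid s t e R) r i ⟩
    act (inv h′) (act h′ φ) r i             ≡⟨ cong (λ χ → χ r i) (act-++ h′ (inv h′) φ) ⟨
    act (h′ ++ inv h′) φ r i                ≡⟨ act-inverse h′ φ r i ⟩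
    φ r i                                   ∎
    where open ≡-Reasoning
          h h′ : Word
          h = alt s t (m s t)
          h′ = alt t s (m s t)

  act-Rel₀ : ∀ {u v} → Rel₀ u v → ∀ {φ} → Respectful φ → act u φ ≐ act v φ
  act-Rel₀ (cancel u v s t k e) {φ} R r i
    rewrite act-++ u (alt s t (2 ℕ.* m s t) ++ v) φ | act-++ (alt s t (2 ℕ.* m s t)) v (act u φ) | act-++ u v φ
    = act-resp v (act-relation s t e (act-respectful u R)) r i

  act-≈ : ∀ {u v} → u ≈ v → ∀ {φ} → Respectful φ → act u φ ≐ act v φ
  act-≈ ε R r i = refl
  act-≈ (fwd c ◅ e) R r i = trans (act-Rel₀ c R r i) (act-≈ e R r i)
  act-≈ (bwd c ◅ e) R r i = trans (sym (act-Rel₀ c R r i)) (act-≈ e R r i)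

  next-positive : ∀ s t (φ : Vector) k → Positive (φ s) → Positive (φ t) → k ℕ.< m s t ⊎ m s t ≡ 0 →
                  Positive (U (C s t) (suc k) (φ s) ⊕ U (C s t) k (φ t))
  next-positive s t φ zero p q h i = subst (0ℤ ℤ.<_) (sym (ℤₚ.+-identityʳ (φ s i))) (p i)
  next-positive s t φ (suc k) p q h i with m s t ℕ.≟ suc (suc k)
  -- At the last letter, U_m contributes zero and U_{m-1} alone keeps the sum positive.
  ... | yes e = ℤₚ.+-mono-≤-<
        (ℤₚ.≤-reflexive (sym (subst (λ n → U (cox n) (suc (suc k)) (φ s) i ≡ 0ℤ) (sym e) (U-cox-top k (φ s) i))))
        (U-cox-positive (m s t) k q h i)
  ... | no n = ℤₚ.+-mono-< (U-cox-positive (m s t) (suc k) p (up h) i) (U-cox-positive (m s t) k q h i)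
    where
    up : suc k ℕ.< m s t ⊎ m s t ≡ 0 → suc (suc k) ℕ.< m s t ⊎ m s t ≡ 0
    up (inj₁ l) = inj₁ (ℕₚ.≤∧≢⇒< l (λ e → n (sym e)))
    up (inj₂ z) = inj₂ z

  base : Vector
  base _ _ = 1ℤ

  abstract
    -- The sign of the root w(α_s), tested on the functional that is 1 at every simple root. These
    -- turn out to mean that w s is longer, respectively shorter, than w.
    Pos Neg : Word → S → Set
    Pos w s = ∀ i → 0ℤ ℤ.< act w base s i
    Neg w s = ∀ i → act w base s i ℤ.< 0ℤ

    Pos-resp : ∀ {u v s} → u ≈ v → Pos u s → Pos v s
    Pos-resp e p i = subst (0ℤ ℤ.<_) (act-≈ e (λ _ _ → refl) _ i) (p i)

    Neg-resp : ∀ {u v s} → u ≈ v → Neg u s → Neg v s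
    Neg-resp e p i = subst (ℤ._< 0ℤ) (act-≈ e (λ _ _ → refl) _ i) (p i)

    Pos-Neg : ∀ {w s} → Pos w s → Neg w s → ⊥
    Pos-Neg p n = ℤₚ.<-asym (p 0) (n 0)

    private
      act-end : ∀ w s i → act (w ++ [ s ]) base s i ≡ ℤ.- act w base s i
      act-end w s i = trans (cong (λ χ → χ s i) (act-++ w [ s ] base)) (reflect-self s (act w base) i)

    Pos⇒Neg : ∀ w {s} → Pos w s → Neg (w ++ [ s ]) s
    Pos⇒Neg w p i = subst (ℤ._< 0ℤ) (sym (act-end w _ i)) (ℤₚ.neg-mono-< (p i))

    Neg⇒Pos : ∀ w {s} → Neg w s → Pos (w ++ [ s ]) s
    Neg⇒Pos w n i = subst (0ℤ ℤ.<_) (sym (act-end w _ i)) (ℤₚ.neg-mono-< (n i))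

    Pos-[] : ∀ s → Pos [] s
    Pos-[] s i = +<+ (s≤s z≤n)

    Pos-same : ∀ w {s t} → m s t ≡ 1 → Pos w s → Pos w t
    Pos-same w e p i = subst (0ℤ ℤ.<_) (act-respectful w {base} (λ _ _ → refl) e i) (p i)

    Neg-same : ∀ w {s t} → m s t ≡ 1 → Neg w s → Neg w t
    Neg-same w e p i = subst (ℤ._< 0ℤ) (act-respectful w {base} (λ _ _ → refl) e i) (p i)

    Pos-alt : ∀ w s t k → Pos w s → Pos w t → k ℕ.< m s t ⊎ m s t ≡ 0 → Pos (w ++ alt s t k) (letter s t k)
    Pos-alt w s t k p q h i = subst (0ℤ ℤ.<_) (sym (trans
        (cong (λ χ → χ (letter s t k) i) (act-++ w (alt s t k) base)) (act-alt-next s t k (act w base) i)))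
      (next-positive s t (act w base) k p q h i)

-- The sign dichotomy, lengths, the word problem and exchange

data SamePair {S : Set} (x y : S) : S → S → Set where
  straight : SamePair x y x y
  crossed  : SamePair x y y x

module Lengths (Y : System) where
  open System Y
  open Core m σ renaming (_≈_ to infix 4 _≈_) public
  open Words Y public
  open Action Y public using (Pos; Neg; Pos-resp; Neg-resp; Pos-Neg; Pos⇒Neg; Neg⇒Pos; Pos-[]; Pos-same; Neg-same; Pos-alt)

  Below : ℕ → S → S → Set
  Below k x y = k ≤ m x y ⊎ m x y ≡ 0

  Below-sym : ∀ {k} x y → Below k x y → Below k y x
  Below-sym x y = subst (λ n → _ ≤ n ⊎ n ≡ 0) (m-sym x y)

  Below-pred : ∀ {k x y} → Below (suc k) x y → Below k x y
  Below-pred (inj₁ h) = inj₁ (ℕₚ.≤-trans (ℕₚ.n≤1+n _) h)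
  Below-pred (inj₂ h) = inj₂ h

  Below-1 : ∀ x y → Below 1 x y
  Below-1 x y with m x y
  ... | zero  = inj₂ refl
  ... | suc _ = inj₁ (s≤s z≤n)

  Below-suc : ∀ {k} x y → Below k x y → k ≢ m x y → Below (suc k) x y
  Below-suc x y (inj₁ h) n = inj₁ (ℕₚ.≤∧≢⇒< h n)
  Below-suc x y (inj₂ h) n = inj₂ h

  Below-2 : ∀ x y → m x y ≢ 1 → Below 2 x y
  Below-2 x y n = Below-suc x y (Below-1 x y) (λ e → n (sym e))

  alt-top : ∀ x y {k} → suc k ≡ m x y → alt x y (suc k) ≈ alt y x k ++ [ letter y x k ]
  alt-top x y {k} e = ≈trans (subst (λ n → alt x y n ≈ alt y x n) (sym e) (braid-relation x y (sym e)))
                             (≡⇒≈ (alt-snoc y x k))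

  -- The negative alternative carries a shorter word for q s, because the induction needs the sign
  -- and the shortening together: each is used to produce the other.
  Dichotomy : Word → S → Set
  Dichotomy q s = Pos q s ⊎ (Neg q s × (∃[ q′ ] (length q′ < length q × q ++ [ s ] ≈ q′)))

  record Stripped (p : Word) (x y : S) (k : ℕ) : Set where
    field
      p′    : Word
      x′ y′ : S
      k′    : ℕ
      equal : p ++ alt x y (suc k) ≈ p′ ++ alt x′ y′ (suc k′)
      size  : length p′ + k′ ≤ length p + k
      next  : letter x′ y′ (suc k′) ≡ letter x y (suc k)
      pair  : SamePair x y x′ y′
      pos   : Pos p′ x′
      stop  : (Pos p′ y′ × Below (suc (suc k′)) x′ y′) ⊎ (suc k′ ≡ m x′ y′)

  flip : ∀ {x y a b : S} → SamePair y x a b → SamePair x y a b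
  flip straight = crossed
  flip crossed  = straight

  -- If y is negative at p, then p = q y with q shorter, so y can be moved from p to the front of
  -- the alternating tail without lengthening the word. This ends when p has no descent left to
  -- move, or when the tail has its full length m. The dichotomy is a parameter since it is only
  -- known for shorter words at this stage; f bounds the number of moves.
  strip : ∀ n → (∀ q → length q < n → ∀ s → Dichotomy q s) →
          ∀ f p x y k → length p ≤ f → length p < n → Pos p x → Below (suc k) x y → Stripped p x y k
  strip n dich f p x y k p≤f p<n px h with suc k ℕ.≟ m x y
  ... | yes e = record { p′ = p ; x′ = x ; y′ = y ; k′ = k ; equal = ≈refl ; size = ℕₚ.≤-refl
                       ; next = refl ; pair = straight ; pos = px ; stop = inj₂ e }
  ... | no ne with dich p p<n y
  ...   | inj₁ py = record { p′ = p ; x′ = x ; y′ = y ; k′ = k ; equal = ≈refl ; size = ℕₚ.≤-refl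
                       ; next = refl ; pair = straight ; pos = px
                       ; stop = inj₁ (py , Below-suc x y h ne) }
  strip n dich zero p x y k p≤f p<n px h | no ne | inj₂ (ny , q , q<p , e) =
    ⊥-elim (ℕₚ.n≮0 (ℕₚ.<-≤-trans q<p p≤f))
  strip n dich (suc f) p x y k p≤f p<n px h | no ne | inj₂ (ny , q , q<p , e) = record
    { p′ = p′ ; x′ = x′ ; y′ = y′ ; k′ = k′
    ; equal = ≈trans shift equal
    ; size = ℕₚ.≤-trans size (ℕₚ.≤-trans (ℕₚ.≤-reflexive (ℕₚ.+-suc (length q) k)) (ℕₚ.+-monoˡ-≤ k q<p))
    ; next = next ; pair = flip pair ; pos = pos ; stop = stop }
    where
    rec : Stripped q y x (suc k)
    rec = strip n dich f q y x (suc k) (s≤s⁻¹ (ℕₚ.≤-trans q<p p≤f)) (ℕₚ.<-trans q<p p<n)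
            (Pos-resp e (Neg⇒Pos p ny)) (Below-sym x y (Below-suc x y h ne))
    open Stripped rec
    shift : p ++ alt x y (suc k) ≈ q ++ alt y x (suc (suc k))
    shift = begin
      p ++ alt x y (suc k)                       ≈⟨ ++ʳ (alt x y (suc k)) (≈sym (square-end p y)) ⟩
      ((p ++ [ y ]) ++ [ y ]) ++ alt x y (suc k) ≈⟨ ++ʳ (alt x y (suc k)) (++ʳ [ y ] e) ⟩
      (q ++ [ y ]) ++ alt x y (suc k)            ≡⟨ Lₚ.++-assoc q [ y ] _ ⟩
      q ++ alt y x (suc (suc k))                 ∎
      where open ≈-Reasoning

  private
    dichotomy′ : ∀ n q → length q < n → ∀ s → Dichotomy q s
    dichotomy′ (suc n) q q<n s with initLast q
    ... | []        = inj₁ (Pos-[] s)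
    ... | q₀ ∷ʳ′ t = cases (dichotomy′ n q₀ q₀<n t)
      where
      q₀<n : length q₀ < n
      q₀<n = s≤s⁻¹ (subst (_< suc n) (length-∷ʳ q₀ t) q<n)
      Q : Word
      Q = q₀ ++ [ t ]
      shorten : ∀ r → length r ≤ length q₀ → Q ≈ r → Dichotomy Q s
      shorten r r≤ e with dichotomy′ n r (ℕₚ.≤-<-trans r≤ q₀<n) s
      ... | inj₁ p = inj₁ (Pos-resp (≈sym e) p)
      ... | inj₂ (n , r′ , r′<r , e′) = inj₂ (Neg-resp (≈sym e) n , r′ ,
              ℕₚ.<-≤-trans r′<r (ℕₚ.≤-trans r≤ (subst (length q₀ ≤_) (sym (length-∷ʳ q₀ t)) (ℕₚ.n≤1+n _))) ,
              ≈trans (++ʳ [ s ] e) e′)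
      q₀<Q : length q₀ < length Q
      q₀<Q = ℕₚ.≤-reflexive (sym (length-∷ʳ q₀ t))
      drop : ∀ r → length r ≤ length q₀ → Q ≈ r ++ [ s ] → Dichotomy Q s
      drop r r≤ e with dichotomy′ n r (ℕₚ.≤-<-trans r≤ q₀<n) s
      ... | inj₁ p = inj₂ (Neg-resp (≈sym e) (Pos⇒Neg r p) , r , ℕₚ.≤-<-trans r≤ q₀<Q ,
                           ≈trans (++ʳ [ s ] e) (square-end r s))
      ... | inj₂ (_ , r′ , r′<r , e′) = shorten r′ (ℕₚ.≤-trans (ℕₚ.<⇒≤ r′<r) r≤) (≈trans e e′)
      cases : Dichotomy q₀ t → Dichotomy Q s
      cases (inj₂ (_ , r , r<q₀ , e)) = shorten r (ℕₚ.<⇒≤ r<q₀) e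
      cases (inj₁ pt) with m t s ℕ.≟ 1
      ... | yes e = inj₂ (Neg-same Q e (Pos⇒Neg q₀ pt) , q₀ , q₀<Q ,
                          ≈trans (++ˡ Q (≈sym (same-letter e))) (square-end q₀ t))
      ... | no _ = finish stop
        where
        open Stripped (strip n (dichotomy′ n) (length q₀) q₀ t s 0 ℕₚ.≤-refl q₀<n pt (Below-1 t s))
        bound : length p′ + k′ ≤ length q₀
        bound = ℕₚ.≤-trans size (ℕₚ.≤-reflexive (ℕₚ.+-identityʳ _))
        -- If the tail is not full, rank two positivity makes s an ascent. If it is full, the braid
        -- relation rewrites it so as to end in s.
        finish : (Pos p′ y′ × Below (suc (suc k′)) x′ y′) ⊎ (suc k′ ≡ m x′ y′) → Dichotomy Q s
        finish (inj₁ (py , h)) = inj₁ (Pos-resp (≈sym equal)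
          (subst (Pos _) next (Pos-alt p′ x′ y′ (suc k′) pos py h)))
        finish (inj₂ e) = drop (p′ ++ alt y′ x′ k′)
          (subst (_≤ length q₀) (sym (trans (Lₚ.length-++ p′) (cong (length p′ +_) (length-alt y′ x′ k′)))) bound)
          (begin
            Q                                           ≈⟨ equal ⟩
            p′ ++ alt x′ y′ (suc k′)                    ≈⟨ ++ˡ p′ (alt-top x′ y′ e) ⟩
            p′ ++ (alt y′ x′ k′ ++ [ letter y′ x′ k′ ]) ≡⟨ sym (Lₚ.++-assoc p′ _ _) ⟩
            (p′ ++ alt y′ x′ k′) ++ [ letter y′ x′ k′ ] ≡⟨ cong (λ l → (p′ ++ alt y′ x′ k′) ++ [ l ]) next ⟩
            (p′ ++ alt y′ x′ k′) ++ [ s ]               ∎)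
          where open ≈-Reasoning

  record Normal (w : Word) : Set where
    field
      word    : Word
      equal   : word ≈ w
      short   : length word ≤ length w
      minimal : ∀ v → v ≈ word → length word ≤ length v

  abstract
    dichotomy : ∀ q s → Dichotomy q s
    dichotomy q s = dichotomy′ (suc (length q)) q ℕₚ.≤-refl s

    private
      minimal-∷ʳ : ∀ r s → Pos r s → (∀ v → v ≈ r → length r ≤ length v) →
                   ∀ v → v ≈ r ++ [ s ] → length (r ++ [ s ]) ≤ length v
      minimal-∷ʳ r s p min v e with dichotomy v s
      ... | inj₁ p′ = ⊥-elim (Pos-Neg p′ (Neg-resp (≈sym e) (Pos⇒Neg r p)))
      ... | inj₂ (_ , q , q<v , e′) = subst (_≤ length v) (sym (length-∷ʳ r s))
              (ℕₚ.≤-<-trans (min q (≈trans (≈sym e′) (≈trans (++ʳ [ s ] e) (square-end r s)))) q<v)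

      normal′ : ∀ n w → length w ≤ n → Normal w
      normal′ n w w≤n with initLast w
      normal′ n .[] w≤n | [] = record { word = [] ; equal = ≈refl ; short = z≤n ; minimal = λ _ _ → z≤n }
      normal′ zero .(w ++ [ s ]) w≤n | w ∷ʳ′ s = ⊥-elim (ℕₚ.n≮0 (subst (_≤ 0) (length-∷ʳ w s) w≤n))
      normal′ (suc n) .(w ++ [ s ]) w≤n | w ∷ʳ′ s = cases (dichotomy word s)
        where
        w≤ : length w ≤ n
        w≤ = s≤s⁻¹ (subst (_≤ suc n) (length-∷ʳ w s) w≤n)
        open Normal (normal′ n w w≤)
        cases : Dichotomy word s → Normal (w ++ [ s ])
        cases (inj₁ p) = record
          { word = word ++ [ s ] ; equal = ++ʳ [ s ] equal
          ; short = subst₂ _≤_ (sym (length-∷ʳ word s)) (sym (length-∷ʳ w s)) (s≤s short)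
          ; minimal = minimal-∷ʳ word s p minimal }
        cases (inj₂ (_ , q , q<word , e)) = record
          { word = word′ ; equal = ≈trans equal′ (≈trans (≈sym e) (++ʳ [ s ] equal))
          ; short = ℕₚ.≤-trans short′ (ℕₚ.≤-trans q≤w (subst (length w ≤_) (sym (length-∷ʳ w s)) (ℕₚ.n≤1+n _)))
          ; minimal = minimal′ }
          where
          q≤w : length q ≤ length w
          q≤w = ℕₚ.≤-trans (ℕₚ.<⇒≤ q<word) short
          open Normal (normal′ n q (ℕₚ.≤-trans q≤w w≤))
            renaming (word to word′; equal to equal′; short to short′; minimal to minimal′)

    normal : ∀ w → Normal w
    normal w = normal′ (length w) w ℕₚ.≤-refl

  reduced : Word → Word
  reduced w = Normal.word (normal w)

  reduced-≈ : ∀ w → reduced w ≈ w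
  reduced-≈ w = Normal.equal (normal w)

  ℓ : Word → ℕ
  ℓ w = length (reduced w)

  ℓ-min : ∀ v {w} → v ≈ w → ℓ w ≤ length v
  ℓ-min v {w} e = Normal.minimal (normal w) v (≈trans e (≈sym (reduced-≈ w)))

  ℓ≤length : ∀ w → ℓ w ≤ length w
  ℓ≤length w = ℓ-min w ≈refl

  ℓ-cong : ∀ {u v} → u ≈ v → ℓ u ≡ ℓ v
  ℓ-cong {u} {v} e = ℕₚ.≤-antisym (ℓ-min (reduced v) (≈trans (reduced-≈ v) (≈sym e)))
                                  (ℓ-min (reduced u) (≈trans (reduced-≈ u) e))

  ℓ-reduced : ∀ w → ℓ (reduced w) ≡ length (reduced w)
  ℓ-reduced w = ℓ-cong (reduced-≈ w)

  ℓ-Len : ∀ w → Len w (ℓ w)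
  ℓ-Len w = (reduced w , reduced-≈ w , refl) , (λ v e → ℓ-min v e)

  Len-unique : ∀ {w k} → Len w k → k ≡ ℓ w
  Len-unique {w} ((v , e , refl) , min) = ℕₚ.≤-antisym (min (reduced w) (reduced-≈ w)) (ℓ-min v e)

  ℓ-[] : ℓ [] ≡ 0
  ℓ-[] = ℕₚ.n≤0⇒n≡0 (ℓ≤length [])

  ℓ≡0 : ∀ {w} → ℓ w ≡ 0 → w ≈ []
  ℓ≡0 {w} e with reduced w | reduced-≈ w
  ... | [] | r = ≈sym r

  sign : ∀ w s → Pos w s ⊎ Neg w s
  sign w s with dichotomy w s
  ... | inj₁ p       = inj₁ p
  ... | inj₂ (n , _) = inj₂ n

  ℓ-++ : ∀ u v → ℓ (u ++ v) ≤ ℓ u + length v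
  ℓ-++ u v = ℕₚ.≤-trans (ℓ-min (reduced u ++ v) (++ʳ v (reduced-≈ u))) (ℕₚ.≤-reflexive (Lₚ.length-++ (reduced u)))

  ℓ-Pos : ∀ {w s} → Pos w s → ℓ (w ++ [ s ]) ≡ suc (ℓ w)
  ℓ-Pos {w} {s} p = ℕₚ.≤-antisym
    (ℕₚ.≤-trans (ℓ-++ w [ s ]) (ℕₚ.≤-reflexive (ℕₚ.+-comm (ℓ w) 1)))
    (lower (dichotomy v s))
    where
    v : Word
    v = reduced (w ++ [ s ])
    e : v ≈ w ++ [ s ]
    e = reduced-≈ (w ++ [ s ])
    lower : Dichotomy v s → suc (ℓ w) ≤ length v
    lower (inj₁ p′) = ⊥-elim (Pos-Neg p′ (Neg-resp (≈sym e) (Pos⇒Neg w p)))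
    lower (inj₂ (_ , q , q<v , e′)) =
      ℕₚ.≤-<-trans (ℓ-min q (≈trans (≈sym e′) (≈trans (++ʳ [ s ] e) (square-end w s)))) q<v

  ℓ-Neg : ∀ {w s} → Neg w s → suc (ℓ (w ++ [ s ])) ≡ ℓ w
  ℓ-Neg {w} {s} n = trans (sym (ℓ-Pos (Neg⇒Pos w n))) (ℓ-cong (square-end w s))

  ℓ<⇒Neg : ∀ {w s} → ℓ (w ++ [ s ]) < ℓ w → Neg w s
  ℓ<⇒Neg {w} {s} h with sign w s
  ... | inj₂ n = n
  ... | inj₁ p = ⊥-elim (ℕₚ.<-asym h (ℕₚ.≤-reflexive (sym (ℓ-Pos p))))

  ℓ>⇒Pos : ∀ {w s} → ℓ w < ℓ (w ++ [ s ]) → Pos w s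
  ℓ>⇒Pos {w} {s} h with sign w s
  ... | inj₁ p = p
  ... | inj₂ n = ⊥-elim (ℕₚ.<-asym h (ℕₚ.≤-reflexive (ℓ-Neg n)))

  ℓ-inv : ∀ w → ℓ (inv w) ≡ ℓ w
  ℓ-inv w = ℕₚ.≤-antisym (le w) (subst (λ v → ℓ v ≤ ℓ (inv w)) (inv-inv w) (le (inv w)))
    where
    le : ∀ w → ℓ (inv w) ≤ ℓ w
    le w = ℕₚ.≤-trans (ℓ-min (inv (reduced w)) (inv-cong (reduced-≈ w))) (ℕₚ.≤-reflexive (Lₚ.length-reverse (reduced w)))

  ℓ-star : ∀ w → ℓ (star w) ≡ ℓ w
  ℓ-star w = ℕₚ.≤-antisym (le w) (subst (λ v → ℓ v ≤ ℓ (star w)) (star-star w) (le (star w)))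
    where
    le : ∀ w → ℓ (star w) ≤ ℓ w
    le w = ℕₚ.≤-trans (ℓ-min (star (reduced w)) (star-cong (reduced-≈ w))) (ℕₚ.≤-reflexive (Lₚ.length-map σ (reduced w)))

  infix 4 _≈?_
  _≈?_ : ∀ u v → Dec (u ≈ v)
  u ≈? v = map′ (λ e → quotient u v (ℓ≡0 e))
                (λ e → trans (ℓ-cong (≈trans (++ʳ (inv v) e) (inverseʳ v))) ℓ-[])
                (ℓ (u ++ inv v) ℕ.≟ 0)

  -- Left ascents and descents

  LPos LNeg : Word → S → Set
  LPos w s = Pos (inv w) s
  LNeg w s = Neg (inv w) s

  lsign : ∀ w s → LPos w s ⊎ LNeg w s
  lsign w s = sign (inv w) s

  LPos-resp : ∀ {u v s} → u ≈ v → LPos u s → LPos v s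
  LPos-resp e = Pos-resp (inv-cong e)

  LNeg-resp : ∀ {u v s} → u ≈ v → LNeg u s → LNeg v s
  LNeg-resp e = Neg-resp (inv-cong e)

  ℓ-∷ : ∀ s w → ℓ (s ∷ w) ≡ ℓ (inv w ++ [ s ])
  ℓ-∷ s w = trans (sym (ℓ-inv (s ∷ w))) (cong ℓ (inv-∷ s w))

  ℓ-LPos : ∀ {w s} → LPos w s → ℓ (s ∷ w) ≡ suc (ℓ w)
  ℓ-LPos {w} {s} p = trans (ℓ-∷ s w) (trans (ℓ-Pos p) (cong suc (ℓ-inv w)))

  ℓ-LNeg : ∀ {w s} → LNeg w s → suc (ℓ (s ∷ w)) ≡ ℓ w
  ℓ-LNeg {w} {s} n = trans (cong suc (ℓ-∷ s w)) (trans (ℓ-Neg n) (ℓ-inv w))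

  ℓ<⇒LNeg : ∀ {w s} → ℓ (s ∷ w) < ℓ w → LNeg w s
  ℓ<⇒LNeg {w} {s} h = ℓ<⇒Neg (subst₂ _<_ (ℓ-∷ s w) (sym (ℓ-inv w)) h)

  ℓ>⇒LPos : ∀ {w s} → ℓ w < ℓ (s ∷ w) → LPos w s
  ℓ>⇒LPos {w} {s} h = ℓ>⇒Pos (subst₂ _<_ (sym (ℓ-inv w)) (ℓ-∷ s w) h)

  LPos⇒LNeg : ∀ w {s} → LPos w s → LNeg (s ∷ w) s
  LPos⇒LNeg w {s} p = subst (λ v → Neg v s) (sym (inv-∷ s w)) (Pos⇒Neg (inv w) p)

  LNeg⇒LPos : ∀ w {s} → LNeg w s → LPos (s ∷ w) s
  LNeg⇒LPos w {s} n = subst (λ v → Pos v s) (sym (inv-∷ s w)) (Neg⇒Pos (inv w) n)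

  ℓ-∷-≤ : ∀ s w → ℓ (s ∷ w) ≤ suc (ℓ w)
  ℓ-∷-≤ s w with lsign w s
  ... | inj₁ p = ℕₚ.≤-reflexive (ℓ-LPos p)
  ... | inj₂ n = ℕₚ.≤-trans (ℕₚ.n≤1+n _) (ℕₚ.≤-trans (ℕₚ.≤-reflexive (ℓ-LNeg n)) (ℕₚ.n≤1+n _))

  ℓ-∷ʳ-≤ : ∀ w s → ℓ (w ++ [ s ]) ≤ suc (ℓ w)
  ℓ-∷ʳ-≤ w s = ℕₚ.≤-trans (ℓ-++ w [ s ]) (ℕₚ.≤-reflexive (ℕₚ.+-comm (ℓ w) 1))

  -- Cosets of rank two parabolic subgroups

  ℓ-alt : ∀ p x y k → Pos p x → Pos p y → Below k x y → ℓ (p ++ alt x y k) ≡ ℓ p + k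
  ℓ-alt p x y zero    px py h = trans (cong ℓ (Lₚ.++-identityʳ p)) (sym (ℕₚ.+-identityʳ _))
  ℓ-alt p x y (suc k) px py h = begin
    ℓ (p ++ alt x y (suc k))                    ≡⟨ cong ℓ (trans (cong (p ++_) (alt-snoc x y k)) (sym (Lₚ.++-assoc p _ _))) ⟩
    ℓ ((p ++ alt x y k) ++ [ letter x y k ])    ≡⟨ ℓ-Pos (Pos-alt p x y k px py h) ⟩
    suc (ℓ (p ++ alt x y k))                    ≡⟨ cong suc (ℓ-alt p x y k px py (Below-pred h)) ⟩
    suc (ℓ p + k)                               ≡⟨ sym (ℕₚ.+-suc (ℓ p) k) ⟩
    ℓ p + suc k                                 ∎
    where open ≡-Reasoning

  -- A decomposition u = p d with p minimal in its coset of ⟨t, s⟩ and d ending in t.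
  record Coset (u : Word) (t s : S) : Set where
    field
      p     : Word
      x y   : S
      k     : ℕ
      equal : u ≈ p ++ alt x y (suc k)
      size  : ℓ p + suc k ≡ ℓ u
      next  : letter x y (suc k) ≡ s
      pair  : SamePair t s x y
      posx  : Pos p x
      posy  : Pos p y
      below : Below (suc k) x y

  ≈-snoc-alt : ∀ p x y k → p ++ alt x y (suc k) ≈ (p ++ alt x y k) ++ [ letter x y k ]
  ≈-snoc-alt p x y k = ≡⇒≈ (trans (cong (p ++_) (alt-snoc x y k)) (sym (Lₚ.++-assoc p _ _)))

  coset : ∀ u t s → Neg u t → Coset u t s
  coset u t s n = record
    { p = p′ ; x = x′ ; y = y′ ; k = k′ ; equal = eq ; size = ℕₚ.≤-antisym small large
    ; next = next ; pair = pair ; posx = pos ; posy = posy′ stop ; below = below′ stop }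
    where
    q : Word
    q = reduced (u ++ [ t ])
    eq₀ : u ≈ q ++ [ t ]
    eq₀ = ≈sym (≈trans (++ʳ [ t ] (reduced-≈ (u ++ [ t ]))) (square-end u t))
    open Stripped (strip (suc (length q)) (λ r _ → dichotomy r) (length q) q t s 0 ℕₚ.≤-refl ℕₚ.≤-refl
                    (Pos-resp (≈sym (reduced-≈ (u ++ [ t ]))) (Neg⇒Pos u n)) (Below-1 t s))
    eq : u ≈ p′ ++ alt x′ y′ (suc k′)
    eq = ≈trans eq₀ equal
    small : ℓ p′ + suc k′ ≤ ℓ u
    small = begin
      ℓ p′ + suc k′          ≤⟨ ℕₚ.+-monoˡ-≤ (suc k′) (ℓ≤length p′) ⟩
      length p′ + suc k′     ≡⟨ ℕₚ.+-suc (length p′) k′ ⟩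
      suc (length p′ + k′)   ≤⟨ s≤s size ⟩
      suc (length q + 0)     ≡⟨ cong suc (ℕₚ.+-identityʳ _) ⟩
      suc (ℓ (u ++ [ t ]))   ≡⟨ ℓ-Neg n ⟩
      ℓ u                    ∎
      where open ℕₚ.≤-Reasoning
    large : ℓ u ≤ ℓ p′ + suc k′
    large = ℕₚ.≤-trans (ℕₚ.≤-reflexive (ℓ-cong eq)) (ℕₚ.≤-trans (ℓ-++ p′ (alt x′ y′ (suc k′)))
              (ℕₚ.≤-reflexive (cong (ℓ p′ +_) (length-alt x′ y′ (suc k′)))))
    below′ : (Pos p′ y′ × Below (suc (suc k′)) x′ y′) ⊎ (suc k′ ≡ m x′ y′) → Below (suc k′) x′ y′
    below′ (inj₁ (_ , h)) = Below-pred h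
    below′ (inj₂ e)       = inj₁ (ℕₚ.≤-reflexive e)
    -- With a full tail `strip` says nothing about y′. A descent y′ of p′ would cancel against the
    -- tail rewritten to begin with y′, making u too short.
    posy′ : (Pos p′ y′ × Below (suc (suc k′)) x′ y′) ⊎ (suc k′ ≡ m x′ y′) → Pos p′ y′
    posy′ (inj₁ (py , _)) = py
    posy′ (inj₂ e) with sign p′ y′
    ... | inj₁ py = py
    ... | inj₂ ny = ⊥-elim (ℕₚ.<-irrefl refl (begin-strict
      ℓ u                                       ≡⟨ ℓ-cong (≈trans eq (≈trans
                                                    (++ˡ p′ (subst (λ n → alt x′ y′ n ≈ alt y′ x′ n) (sym e) (braid-relation x′ y′ (sym e))))
                                                    (≡⇒≈ (sym (Lₚ.++-assoc p′ [ y′ ] _))))) ⟩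
      ℓ ((p′ ++ [ y′ ]) ++ alt x′ y′ k′)         ≤⟨ ℓ-++ (p′ ++ [ y′ ]) _ ⟩
      ℓ (p′ ++ [ y′ ]) + length (alt x′ y′ k′)   ≡⟨ cong (ℓ (p′ ++ [ y′ ]) +_) (length-alt x′ y′ k′) ⟩
      ℓ (p′ ++ [ y′ ]) + k′                      <⟨ ℕₚ.+-mono-<-≤ (ℕₚ.≤-reflexive (ℓ-Neg ny)) (ℕₚ.n≤1+n k′) ⟩
      ℓ p′ + suc k′                              ≤⟨ small ⟩
      ℓ u                                        ∎))
      where open ℕₚ.≤-Reasoning

  -- A full tail could be rewritten to end in s, and u s would then be shorter than u.
  coset-below : ∀ {u t s} (c : Coset u t s) → let open Coset c in Pos u s → Below (suc (suc k)) x y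
  coset-below {u} {t} {s} c ps = Below-suc x y below λ e → ℕₚ.<-irrefl refl (begin-strict
    ℓ u                                     <⟨ ℕₚ.≤-reflexive (sym (ℓ-Pos ps)) ⟩
    ℓ (u ++ [ s ])                          ≡⟨ ℓ-cong (drop e) ⟩
    ℓ (p ++ alt y x k)                      ≤⟨ ℓ-++ p _ ⟩
    ℓ p + length (alt y x k)                ≡⟨ cong (ℓ p +_) (length-alt y x k) ⟩
    ℓ p + k                                 ≤⟨ ℕₚ.+-monoʳ-≤ (ℓ p) (ℕₚ.n≤1+n k) ⟩
    ℓ p + suc k                             ≡⟨ size ⟩
    ℓ u                                     ∎)
    where
    open Coset c
    open ℕₚ.≤-Reasoning
    drop : suc k ≡ m x y → u ++ [ s ] ≈ p ++ alt y x k
    drop e = ≈trans (++ʳ [ s ] (≈trans equal (≈trans (++ˡ p (alt-top x y e))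
      (≡⇒≈ (trans (sym (Lₚ.++-assoc p _ _)) (cong (λ l → (p ++ alt y x k) ++ [ l ]) next))))))
      (square-end _ s)

  descent : ∀ u → u ≈ [] ⊎ ∃[ t ] Neg u t
  descent u = go (reduced u) (reduced-≈ u) refl
    where
    go : ∀ r → r ≈ u → length r ≡ ℓ u → u ≈ [] ⊎ ∃[ t ] Neg u t
    go r e h with initLast r
    ... | []        = inj₁ (≈sym e)
    ... | r₀ ∷ʳ′ t = inj₂ (t , ℓ<⇒Neg (ℕₚ.≤-<-trans
            (ℓ-min r₀ (≈trans (≈sym (square-end r₀ t)) (++ʳ [ t ] e)))
            (ℕₚ.≤-reflexive (trans (sym (length-∷ʳ r₀ t)) h))))

  private
    -- Write u = p d with d alternating and p minimal in its coset. If r p were minimal too, s would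
    -- be an ascent of r u. So induction on p gives r p = p x or r p = p y. The first cancels into d
    -- and contradicts that r lengthens u; the second lengthens d by one letter, and s can be a
    -- descent only if d is full by then, where the braid relation gives r u = u s.
    exchange′ : ∀ n u r s → ℓ u ≤ n → Pos u s → LPos u r → Neg (r ∷ u) s → r ∷ u ≈ u ++ [ s ]
    exchange′ n u r s u≤n ps lr ns with descent u
    exchange′ n u r s u≤n ps lr ns | inj₁ e with m r s ℕ.≟ 1
    ... | yes e₁ = ≈trans (++ˡ [ r ] e) (≈trans (same-letter e₁) (++ʳ [ s ] (≈sym e)))
    ... | no n₁  = ⊥-elim (Pos-Neg (Pos-alt [] r s 1 (Pos-[] r) (Pos-[] s) (Below-2 r s n₁))
                                     (Neg-resp (++ˡ [ r ] e) ns))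
    exchange′ n u r s u≤n ps lr ns | inj₂ (t , nt) = body n u≤n
      where
      c : Coset u t s
      c = coset u t s nt
      open Coset c
      h : Below (suc (suc k)) x y
      h = coset-below c ps
      r∷u : r ∷ u ≈ (r ∷ p) ++ alt x y (suc k)
      r∷u = ++ˡ [ r ] equal
      p<u : suc (ℓ p + k) ≡ ℓ u
      p<u = trans (sym (ℕₚ.+-suc (ℓ p) k)) size
      lp : LPos p r
      lp with lsign p r
      ... | inj₁ l = l
      ... | inj₂ l = ⊥-elim (ℕₚ.<-irrefl refl (begin-strict
        ℓ u                                      <⟨ ℕₚ.≤-reflexive (sym (ℓ-LPos lr)) ⟩
        ℓ (r ∷ u)                                ≡⟨ ℓ-cong r∷u ⟩
        ℓ ((r ∷ p) ++ alt x y (suc k))           ≤⟨ ℓ-++ (r ∷ p) _ ⟩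
        ℓ (r ∷ p) + length (alt x y (suc k))     ≡⟨ cong (ℓ (r ∷ p) +_) (length-alt x y (suc k)) ⟩
        ℓ (r ∷ p) + suc k                        ≤⟨ ℕₚ.+-monoˡ-≤ (suc k) (ℕₚ.<⇒≤ (ℕₚ.≤-reflexive (ℓ-LNeg l))) ⟩
        ℓ p + suc k                              ≡⟨ size ⟩
        ℓ u                                      ∎))
        where open ℕₚ.≤-Reasoning
      body : ∀ n → ℓ u ≤ n → r ∷ u ≈ u ++ [ s ]
      body zero u≤0 = ⊥-elim (ℕₚ.n≮0 (subst (_≤ 0) (sym p<u) u≤0))
      body (suc n) u≤n = cases (sign (r ∷ p) x) (sign (r ∷ p) y)
        where
        p≤n : ℓ p ≤ n
        p≤n = s≤s⁻¹ (ℕₚ.≤-trans (ℕₚ.≤-trans (s≤s (ℕₚ.m≤m+n (ℓ p) k)) (ℕₚ.≤-reflexive p<u)) u≤n)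
        cases : Pos (r ∷ p) x ⊎ Neg (r ∷ p) x → Pos (r ∷ p) y ⊎ Neg (r ∷ p) y → r ∷ u ≈ u ++ [ s ]
        cases (inj₁ px) (inj₁ py) = ⊥-elim (Pos-Neg
          (subst (Pos _) next (Pos-alt (r ∷ p) x y (suc k) px py h)) (Neg-resp r∷u ns))
        cases (inj₂ nx) _ = ⊥-elim (ℕₚ.<-irrefl refl (begin-strict
          ℓ u                                       <⟨ ℕₚ.≤-reflexive (sym (ℓ-LPos lr)) ⟩
          ℓ (r ∷ u)                                 ≡⟨ ℓ-cong shortened ⟩
          ℓ (p ++ alt y x k)                        ≤⟨ ℓ-++ p _ ⟩
          ℓ p + length (alt y x k)                  ≡⟨ cong (ℓ p +_) (length-alt y x k) ⟩
          ℓ p + k                                   <⟨ ℕₚ.≤-reflexive p<u ⟩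
          ℓ u                                       ∎))
          where
          open ℕₚ.≤-Reasoning
          shortened : r ∷ u ≈ p ++ alt y x k
          shortened = ≈trans r∷u (≈trans (++ʳ (alt x y (suc k)) (exchange′ n p r x p≤n posx lp nx))
            (≈trans (assoc p [ x ]) (++ˡ p (square-inner x (alt y x k)))))
        cases (inj₁ _) (inj₂ ny) = meets (suc (suc k) ℕ.≟ m y x)
          where
          r∷u′ : r ∷ u ≈ p ++ alt y x (suc (suc k))
          r∷u′ = ≈trans r∷u (≈trans (++ʳ (alt x y (suc k)) (exchange′ n p r y p≤n posy lp ny)) (assoc p [ y ]))
          meets : Dec (suc (suc k) ≡ m y x) → r ∷ u ≈ u ++ [ s ]
          meets (no ne) = ⊥-elim (Pos-Neg (subst (Pos _) next
            (Pos-alt p y x (suc (suc k)) posy posx (Below-suc y x (Below-sym x y h) ne)))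
            (Neg-resp r∷u′ ns))
          meets (yes e) = ≈trans r∷u′ (≈trans (++ˡ p (alt-top y x e)) (≈trans (≈sym (assoc p _))
            (≈trans (++ʳ _ (≈sym equal)) (≡⇒≈ (cong (λ l → u ++ [ l ]) next)))))

  exchange : ∀ {u r s} → Pos u s → LPos u r → Neg (r ∷ u) s → r ∷ u ≈ u ++ [ s ]
  exchange {u} {r} {s} = exchange′ (ℓ u) u r s ℕₚ.≤-refl

-- Demazure products and twisted involutions

module Demazure (Y : System) where
  open System Y
  open Lengths Y public

  infixl 6 _▹_ _▹*_ _⋉_
  infixr 7 _◃_ _◃*_

  _▹_ : Word → S → Word
  x ▹ s with sign x s
  ... | inj₁ _ = x ++ [ s ]
  ... | inj₂ _ = x

  _◃_ : S → Word → Word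
  s ◃ x with lsign x s
  ... | inj₁ _ = s ∷ x
  ... | inj₂ _ = x

  ▹-Pos : ∀ {x s} → Pos x s → x ▹ s ≡ x ++ [ s ]
  ▹-Pos {x} {s} p with sign x s
  ... | inj₁ _ = refl
  ... | inj₂ n = ⊥-elim (Pos-Neg p n)

  ▹-Neg : ∀ {x s} → Neg x s → x ▹ s ≡ x
  ▹-Neg {x} {s} n with sign x s
  ... | inj₁ p = ⊥-elim (Pos-Neg p n)
  ... | inj₂ _ = refl

  ◃-LPos : ∀ {x s} → LPos x s → s ◃ x ≡ s ∷ x
  ◃-LPos {x} {s} p with lsign x s
  ... | inj₁ _ = refl
  ... | inj₂ n = ⊥-elim (Pos-Neg p n)

  ◃-LNeg : ∀ {x s} → LNeg x s → s ◃ x ≡ x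
  ◃-LNeg {x} {s} n with lsign x s
  ... | inj₁ p = ⊥-elim (Pos-Neg p n)
  ... | inj₂ _ = refl

  ▹-cong : ∀ {x y} s → x ≈ y → x ▹ s ≈ y ▹ s
  ▹-cong {x} {y} s e with sign x s
  ... | inj₁ p = ≈trans (++ʳ [ s ] e) (≡⇒≈ (sym (▹-Pos (Pos-resp e p))))
  ... | inj₂ n = ≈trans e (≡⇒≈ (sym (▹-Neg (Neg-resp e n))))

  ◃-cong : ∀ {x y} s → x ≈ y → s ◃ x ≈ s ◃ y
  ◃-cong {x} {y} s e with lsign x s
  ... | inj₁ p = ≈trans (++ˡ [ s ] e) (≡⇒≈ (sym (◃-LPos (LPos-resp e p))))
  ... | inj₂ n = ≈trans e (≡⇒≈ (sym (◃-LNeg (LNeg-resp e n))))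

  inv-◃ : ∀ s x → inv (s ◃ x) ≡ inv x ▹ s
  inv-◃ s x with sign (inv x) s
  ... | inj₁ p = inv-∷ s x
  ... | inj₂ n = refl

  inv-▹ : ∀ x s → inv (x ▹ s) ≡ s ◃ inv x
  inv-▹ x s = trans (cong (λ y → inv (y ▹ s)) (sym (inv-inv x)))
                    (trans (cong inv (sym (inv-◃ s (inv x)))) (inv-inv _))

  Neg-▹ : ∀ x s → Neg (x ▹ s) s
  Neg-▹ x s with sign x s
  ... | inj₁ p = Pos⇒Neg x p
  ... | inj₂ n = n

  ▹-fixed : ∀ {x s} → x ▹ s ≈ x → Neg x s
  ▹-fixed {x} {s} e = Neg-resp e (Neg-▹ x s)

  -- The associativity behind everything below. The one case that lengths do not settle is that r
  -- and s both ascend from x but not one after the other; then r x = x s by exchange, and both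
  -- sides equal r x.
  ◃-▹ : ∀ r x s → r ◃ (x ▹ s) ≈ (r ◃ x) ▹ s
  ◃-▹ r x s with sign x s | lsign x r
  ... | inj₁ p | inj₁ l = go (sign (r ∷ x) s)
    where
    go : Pos (r ∷ x) s ⊎ Neg (r ∷ x) s → r ◃ (x ++ [ s ]) ≈ (r ∷ x) ▹ s
    go (inj₁ p′) = ≡⇒≈ (trans (◃-LPos (ℓ>⇒LPos (ℕₚ.≤-reflexive (trans (cong suc (trans (ℓ-Pos p) (sym (ℓ-LPos l))))
                                 (sym (ℓ-Pos p′)))))) (sym (▹-Pos p′)))
    go (inj₂ n)  = begin
      r ◃ (x ++ [ s ])   ≈⟨ ◃-cong r (≈sym (exchange p l n)) ⟩
      r ◃ (r ∷ x)        ≡⟨ ◃-LNeg (LPos⇒LNeg x l) ⟩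
      r ∷ x              ≡⟨ sym (▹-Neg n) ⟩
      (r ∷ x) ▹ s        ∎
      where open ≈-Reasoning
  ... | inj₁ p | inj₂ l = ≡⇒≈ (trans (◃-LNeg (ℓ<⇒LNeg (begin-strict
      ℓ ((r ∷ x) ++ [ s ])  ≤⟨ ℓ-∷ʳ-≤ (r ∷ x) s ⟩
      suc (ℓ (r ∷ x))       ≡⟨ ℓ-LNeg l ⟩
      ℓ x                   <⟨ ℕₚ.≤-reflexive (sym (ℓ-Pos p)) ⟩
      ℓ (x ++ [ s ])        ∎))) (sym (▹-Pos p)))
    where open ℕₚ.≤-Reasoning
  ... | inj₂ n | inj₁ l = ≡⇒≈ (trans (◃-LPos l) (sym (▹-Neg (ℓ<⇒Neg (begin-strict
      ℓ (r ∷ (x ++ [ s ]))  ≤⟨ ℓ-∷-≤ r (x ++ [ s ]) ⟩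
      suc (ℓ (x ++ [ s ]))  ≡⟨ ℓ-Neg n ⟩
      ℓ x                   <⟨ ℕₚ.≤-reflexive (sym (ℓ-LPos l)) ⟩
      ℓ (r ∷ x)             ∎)))))
    where open ℕₚ.≤-Reasoning
  ... | inj₂ n | inj₂ l = ≡⇒≈ (trans (◃-LNeg l) (sym (▹-Neg n)))

  -- A right descent amounts to being fixed by `▹ s`, a condition that commutes with left products.
  Neg-◃ : ∀ {x s} r → Neg x s → Neg (r ◃ x) s
  Neg-◃ {x} {s} r n = ▹-fixed (≈trans (≈sym (◃-▹ r x s)) (≡⇒≈ (cong (r ◃_) (▹-Neg n))))

  ℓ-▹ : ∀ x s → ℓ x ≤ ℓ (x ▹ s) × ℓ (x ▹ s) ≤ suc (ℓ x)
  ℓ-▹ x s with sign x s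
  ... | inj₁ p = subst (ℓ x ≤_) (sym (ℓ-Pos p)) (ℕₚ.n≤1+n _) , ℕₚ.≤-reflexive (ℓ-Pos p)
  ... | inj₂ n = ℕₚ.≤-refl , ℕₚ.n≤1+n _

  ℓ-◃ : ∀ s x → ℓ x ≤ ℓ (s ◃ x) × ℓ (s ◃ x) ≤ suc (ℓ x)
  ℓ-◃ s x with lsign x s
  ... | inj₁ p = subst (ℓ x ≤_) (sym (ℓ-LPos p)) (ℕₚ.n≤1+n _) , ℕₚ.≤-reflexive (ℓ-LPos p)
  ... | inj₂ n = ℕₚ.≤-refl , ℕₚ.n≤1+n _

  -- Demazure products with words

  _▹*_ : Word → Word → Word
  x ▹* []      = x
  x ▹* (s ∷ w) = (x ▹ s) ▹* w

  _◃*_ : Word → Word → Word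
  []      ◃* x = x
  (s ∷ w) ◃* x = s ◃ (w ◃* x)

  ▹*-cong : ∀ {x y} w → x ≈ y → x ▹* w ≈ y ▹* w
  ▹*-cong []      e = e
  ▹*-cong (s ∷ w) e = ▹*-cong w (▹-cong s e)

  ◃*-cong : ∀ {x y} w → x ≈ y → w ◃* x ≈ w ◃* y
  ◃*-cong []      e = e
  ◃*-cong (s ∷ w) e = ◃-cong s (◃*-cong w e)

  ▹*-++ : ∀ x u v → x ▹* (u ++ v) ≡ (x ▹* u) ▹* v
  ▹*-++ x []      v = refl
  ▹*-++ x (s ∷ u) v = ▹*-++ (x ▹ s) u v

  ◃*-++ : ∀ u v x → (u ++ v) ◃* x ≡ u ◃* (v ◃* x)
  ◃*-++ []      v x = refl
  ◃*-++ (s ∷ u) v x = cong (s ◃_) (◃*-++ u v x)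

  ◃-▹* : ∀ r x w → r ◃ (x ▹* w) ≈ (r ◃ x) ▹* w
  ◃-▹* r x []      = ≈refl
  ◃-▹* r x (s ∷ w) = ≈trans (◃-▹* r (x ▹ s) w) (▹*-cong w (◃-▹ r x s))

  ◃*-▹* : ∀ v x w → v ◃* (x ▹* w) ≈ (v ◃* x) ▹* w
  ◃*-▹* []      x w = ≈refl
  ◃*-▹* (r ∷ v) x w = ≈trans (◃-cong r (◃*-▹* v x w)) (◃-▹* r (v ◃* x) w)

  inv-◃* : ∀ w x → inv (w ◃* x) ≡ inv x ▹* inv w
  inv-◃* []      x = refl
  inv-◃* (s ∷ w) x = begin
    inv (s ◃ (w ◃* x))            ≡⟨ inv-◃ s (w ◃* x) ⟩
    inv (w ◃* x) ▹ s              ≡⟨ cong (_▹ s) (inv-◃* w x) ⟩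
    (inv x ▹* inv w) ▹ s          ≡⟨ sym (▹*-++ (inv x) (inv w) [ s ]) ⟩
    inv x ▹* (inv w ++ [ s ])     ≡⟨ cong (inv x ▹*_) (sym (inv-∷ s w)) ⟩
    inv x ▹* inv (s ∷ w)          ∎
    where open ≡-Reasoning

  ◃*-reduced : ∀ r → ℓ r ≡ length r → r ◃* [] ≈ r
  ◃*-reduced []      e = ≈refl
  ◃*-reduced (s ∷ r) e = ≈trans (◃-cong s (◃*-reduced r e′))
      (≡⇒≈ (◃-LPos (ℓ>⇒LPos (ℕₚ.≤-reflexive (trans (cong suc e′) (sym e))))))
    where
    e′ : ℓ r ≡ length r
    e′ = ℕₚ.≤-antisym (ℓ≤length r) (s≤s⁻¹ (subst (_≤ suc (ℓ r)) e (ℓ-∷-≤ s r)))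

  -- Moving x to the left shows that w acts only through its own Demazure product, so that words
  -- with equal products may be exchanged after any x.
  ▹*-product : ∀ x w → x ▹* w ≈ reduced x ◃* ([] ▹* w)
  ▹*-product x w = ≈sym (≈trans (◃*-▹* (reduced x) [] w)
    (▹*-cong w (≈trans (◃*-reduced (reduced x) (ℓ-reduced x)) (reduced-≈ x))))

  []▹*-alt : ∀ s t k → Below k s t → [] ▹* alt s t k ≈ alt s t k
  []▹*-alt s t zero    h = ≈refl
  []▹*-alt s t (suc k) h = begin
    [] ▹* alt s t (suc k)                 ≡⟨ cong ([] ▹*_) (alt-snoc s t k) ⟩
    [] ▹* (alt s t k ++ [ letter s t k ]) ≡⟨ ▹*-++ [] (alt s t k) _ ⟩
    ([] ▹* alt s t k) ▹ letter s t k      ≈⟨ ▹-cong _ ([]▹*-alt s t k (Below-pred h)) ⟩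
    alt s t k ▹ letter s t k              ≡⟨ ▹-Pos (Pos-alt [] s t k (Pos-[] s) (Pos-[] t) h) ⟩
    alt s t k ++ [ letter s t k ]         ≡⟨ sym (alt-snoc s t k) ⟩
    alt s t (suc k)                       ∎
    where open ≈-Reasoning

  ▹*-braid : ∀ x s t {k} → m s t ≡ suc k → x ▹* alt s t (m s t) ≈ x ▹* alt t s (m s t)
  ▹*-braid x s t e = begin
    x ▹* alt s t (m s t)                       ≈⟨ ▹*-product x (alt s t (m s t)) ⟩
    reduced x ◃* ([] ▹* alt s t (m s t))       ≈⟨ ◃*-cong (reduced x) ([]▹*-alt s t _ (inj₁ ℕₚ.≤-refl)) ⟩
    reduced x ◃* alt s t (m s t)               ≈⟨ ◃*-cong (reduced x) (braid-relation s t e) ⟩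
    reduced x ◃* alt t s (m s t)               ≈⟨ ◃*-cong (reduced x) (≈sym ([]▹*-alt t s _ (inj₁ (ℕₚ.≤-reflexive (m-sym s t))))) ⟩
    reduced x ◃* ([] ▹* alt t s (m s t))       ≈⟨ ≈sym (▹*-product x (alt t s (m s t))) ⟩
    x ▹* alt t s (m s t)                       ∎
    where open ≈-Reasoning

  -- The twisted action

  _⋉_ : Word → S → Word
  x ⋉ s = σ s ◃ (x ▹ s)

  δ : Word → Word → Word
  δ x []      = x
  δ x (s ∷ w) = δ (x ⋉ s) w

  ⋉-cong : ∀ {x y} s → x ≈ y → x ⋉ s ≈ y ⋉ s
  ⋉-cong s e = ◃-cong (σ s) (▹-cong s e)

  δ-cong : ∀ {x y} w → x ≈ y → δ x w ≈ δ y w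
  δ-cong []      e = e
  δ-cong (s ∷ w) e = δ-cong w (⋉-cong s e)

  δ-++ : ∀ x u v → δ x (u ++ v) ≡ δ (δ x u) v
  δ-++ x []      v = refl
  δ-++ x (s ∷ u) v = δ-++ (x ⋉ s) u v

  private
    Len-< : ∀ {u v a b} → Len u a → Len v b → a < b → ℓ u < ℓ v
    Len-< p q = subst₂ _<_ (Len-unique p) (Len-unique q)

    Len-≤ : ∀ {u v a b} → Len u a → Len v b → b ≤ a → ℓ v ≤ ℓ u
    Len-≤ p q = subst₂ _≤_ (Len-unique q) (Len-unique p)

  RDem⇒ : ∀ {x s z} → RDem x s z → z ≈ x ▹ s
  RDem⇒ (inj₁ (a , b , p , q , a<b , e)) = ≈trans e (≡⇒≈ (sym (▹-Pos (ℓ>⇒Pos (Len-< p q a<b)))))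
  RDem⇒ {x} {s} (inj₂ (a , b , p , q , b≤a , e)) with sign x s
  ... | inj₁ pos = ⊥-elim (ℕₚ.<-irrefl refl (ℕₚ.≤-<-trans (Len-≤ p q b≤a) (ℕₚ.≤-reflexive (sym (ℓ-Pos pos)))))
  ... | inj₂ _   = e

  LDem⇒ : ∀ {x s z} → LDem s x z → z ≈ s ◃ x
  LDem⇒ (inj₁ (a , b , p , q , a<b , e)) = ≈trans e (≡⇒≈ (sym (◃-LPos (ℓ>⇒LPos (Len-< p q a<b)))))
  LDem⇒ {x} {s} (inj₂ (a , b , p , q , b≤a , e)) with lsign x s
  ... | inj₁ pos = ⊥-elim (ℕₚ.<-irrefl refl (ℕₚ.≤-<-trans (Len-≤ p q b≤a) (ℕₚ.≤-reflexive (sym (ℓ-LPos pos)))))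
  ... | inj₂ _   = e

  ▹-RDem : ∀ x s → RDem x s (x ▹ s)
  ▹-RDem x s with sign x s
  ... | inj₁ p = inj₁ (_ , _ , ℓ-Len x , ℓ-Len (x ++ [ s ]) , ℕₚ.≤-reflexive (sym (ℓ-Pos p)) , ≈refl)
  ... | inj₂ n = inj₂ (_ , _ , ℓ-Len x , ℓ-Len (x ++ [ s ]) , ℕₚ.<⇒≤ (ℕₚ.≤-reflexive (ℓ-Neg n)) , ≈refl)

  ◃-LDem : ∀ s x → LDem s x (s ◃ x)
  ◃-LDem s x with lsign x s
  ... | inj₁ p = inj₁ (_ , _ , ℓ-Len x , ℓ-Len (s ∷ x) , ℕₚ.≤-reflexive (sym (ℓ-LPos p)) , ≈refl)
  ... | inj₂ n = inj₂ (_ , _ , ℓ-Len x , ℓ-Len (s ∷ x) , ℕₚ.<⇒≤ (ℕₚ.≤-reflexive (ℓ-LNeg n)) , ≈refl)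

  Reach⇒ : ∀ {x w y} → Reach x w y → δ x w ≈ y
  Reach⇒ (done e) = e
  Reach⇒ {w = s ∷ w} (step (z , R , L) r) =
    ≈trans (δ-cong w (≈sym (≈trans (LDem⇒ L) (◃-cong (σ s) (RDem⇒ R))))) (Reach⇒ r)

  ⇒Reach : ∀ {x y} w → δ x w ≈ y → Reach x w y
  ⇒Reach []      e = done e
  ⇒Reach {x} (s ∷ w) e = step (x ▹ s , ▹-RDem x s , ◃-LDem (σ s) (x ▹ s)) (⇒Reach w e)

  δ-product : ∀ x w → δ x w ≈ inv (star w) ◃* (x ▹* w)
  δ-product x []      = ≈refl
  δ-product x (s ∷ w) = begin
    δ (x ⋉ s) w                                       ≈⟨ δ-product (x ⋉ s) w ⟩
    inv (star w) ◃* ((x ⋉ s) ▹* w)                    ≈⟨ ◃*-cong (inv (star w)) (≈sym (◃-▹* (σ s) (x ▹ s) w)) ⟩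
    inv (star w) ◃* ([ σ s ] ◃* ((x ▹ s) ▹* w))       ≡⟨ sym (◃*-++ (inv (star w)) [ σ s ] _) ⟩
    (inv (star w) ++ [ σ s ]) ◃* ((x ▹ s) ▹* w)       ≡⟨ cong (_◃* ((x ▹ s) ▹* w)) (sym (inv-∷ (σ s) (star w))) ⟩
    inv (star (s ∷ w)) ◃* (x ▹* (s ∷ w))              ∎
    where open ≈-Reasoning

  -- The right factors change by the ordinary braid relation; the left ones do so too after
  -- inversion, since * preserves m.
  δ-braid : ∀ x s t {k} → m s t ≡ suc k → δ x (alt s t (m s t)) ≈ δ x (alt t s (m s t))
  δ-braid x s t e = begin
    δ x A                            ≈⟨ δ-product x A ⟩
    inv (star A) ◃* (x ▹* A)         ≈⟨ ◃*-cong (inv (star A)) (▹*-braid x s t e) ⟩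
    inv (star A) ◃* (x ▹* B)         ≈⟨ inv-cancel left ⟩
    inv (star B) ◃* (x ▹* B)         ≈⟨ ≈sym (δ-product x B) ⟩
    δ x B                            ∎
    where
    open ≈-Reasoning
    A B z : Word
    A = alt s t (m s t)
    B = alt t s (m s t)
    z = x ▹* B
    braid* : inv z ▹* star A ≈ inv z ▹* star B
    braid* = subst₂ (λ a b → inv z ▹* a ≈ inv z ▹* b)
      (trans (cong (alt (σ s) (σ t)) (σ-m s t)) (sym (map-alt σ s t (m s t))))
      (trans (cong (alt (σ t) (σ s)) (σ-m s t)) (sym (map-alt σ t s (m s t))))
      (▹*-braid (inv z) (σ s) (σ t) (trans (σ-m s t) e))
    left : inv (inv (star A) ◃* z) ≈ inv (inv (star B) ◃* z)
    left = begin
      inv (inv (star A) ◃* z)        ≡⟨ inv-◃* (inv (star A)) z ⟩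
      inv z ▹* inv (inv (star A))    ≡⟨ cong (inv z ▹*_) (inv-inv (star A)) ⟩
      inv z ▹* star A                ≈⟨ braid* ⟩
      inv z ▹* star B                ≡⟨ cong (inv z ▹*_) (sym (inv-inv (star B))) ⟩
      inv z ▹* inv (inv (star B))    ≡⟨ sym (inv-◃* (inv (star B)) z) ⟩
      inv (inv (star B) ◃* z)        ∎

  -- Twisted involutions

  Invol : Word → Set
  Invol x = inv x ≈ star x

  star-∷ʳ : ∀ x s → star (x ++ [ s ]) ≡ star x ++ [ σ s ]
  star-∷ʳ x s = Lₚ.map-++ σ x [ s ]

  ℓ-star-∷ʳ : ∀ x s → ℓ (star x ++ [ σ s ]) ≡ ℓ (x ++ [ s ])
  ℓ-star-∷ʳ x s = trans (cong ℓ (sym (star-∷ʳ x s))) (ℓ-star (x ++ [ s ]))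

  Pos-star : ∀ {x s} → Pos x s → Pos (star x) (σ s)
  Pos-star {x} {s} p = ℓ>⇒Pos (subst₂ _<_ (sym (ℓ-star x)) (sym (ℓ-star-∷ʳ x s)) (ℕₚ.≤-reflexive (sym (ℓ-Pos p))))

  Neg-star : ∀ {x s} → Neg x s → Neg (star x) (σ s)
  Neg-star {x} {s} n = ℓ<⇒Neg (subst₂ _<_ (sym (ℓ-star-∷ʳ x s)) (sym (ℓ-star x)) (ℕₚ.≤-reflexive (ℓ-Neg n)))

  star-▹ : ∀ x s → star (x ▹ s) ≡ star x ▹ σ s
  star-▹ x s with sign x s
  ... | inj₁ p = trans (star-∷ʳ x s) (sym (▹-Pos (Pos-star p)))
  ... | inj₂ n = sym (▹-Neg (Neg-star n))

  star-◃ : ∀ s x → star (s ◃ x) ≡ σ s ◃ star x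
  star-◃ s x = begin
    star (s ◃ x)               ≡⟨ cong star (sym (inv-inv (s ◃ x))) ⟩
    star (inv (inv (s ◃ x)))   ≡⟨ star-inv (inv (s ◃ x)) ⟩
    inv (star (inv (s ◃ x)))   ≡⟨ cong (λ y → inv (star y)) (inv-◃ s x) ⟩
    inv (star (inv x ▹ s))     ≡⟨ cong inv (star-▹ (inv x) s) ⟩
    inv (star (inv x) ▹ σ s)   ≡⟨ inv-▹ (star (inv x)) (σ s) ⟩
    σ s ◃ inv (star (inv x))   ≡⟨ cong (σ s ◃_) (trans (sym (star-inv (inv x))) (cong star (inv-inv x))) ⟩
    σ s ◃ star x               ∎
    where open ≡-Reasoning

  Invol-⋉ : ∀ {x} s → Invol x → Invol (x ⋉ s)
  Invol-⋉ {x} s i = begin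
    inv (σ s ◃ (x ▹ s))         ≡⟨ inv-◃ (σ s) (x ▹ s) ⟩
    inv (x ▹ s) ▹ σ s           ≡⟨ cong (_▹ σ s) (inv-▹ x s) ⟩
    (s ◃ inv x) ▹ σ s           ≈⟨ ▹-cong (σ s) (◃-cong s i) ⟩
    (s ◃ star x) ▹ σ s          ≈⟨ ≈sym (◃-▹ s (star x) (σ s)) ⟩
    s ◃ (star x ▹ σ s)          ≡⟨ cong₂ _◃_ (sym (σ-invol s)) (sym (star-▹ x s)) ⟩
    σ (σ s) ◃ star (x ▹ s)      ≡⟨ sym (star-◃ (σ s) (x ▹ s)) ⟩
    star (σ s ◃ (x ▹ s))        ∎
    where open ≈-Reasoning

  Invol-δ : ∀ {x} w → Invol x → Invol (δ x w)
  Invol-δ []      i = i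
  Invol-δ (s ∷ w) i = Invol-δ w (Invol-⋉ s i)

  Invol-LPos : ∀ {x s} → Invol x → Pos x s → LPos x (σ s)
  Invol-LPos i p = Pos-resp (≈sym i) (Pos-star p)

  Invol-LNeg : ∀ {x s} → Invol x → Neg x s → LNeg x (σ s)
  Invol-LNeg i n = Neg-resp (≈sym i) (Neg-star n)

  ⋉-Neg : ∀ {x s} → Invol x → Neg x s → x ⋉ s ≡ x
  ⋉-Neg {x} {s} i n = trans (cong (σ s ◃_) (▹-Neg n)) (◃-LNeg (Invol-LNeg i n))

  Neg-⋉ : ∀ x s → Neg (x ⋉ s) s
  Neg-⋉ x s = Neg-◃ (σ s) (Neg-▹ x s)

  ℓ-⋉ : ∀ x s → ℓ (x ⋉ s) ≤ 2 + ℓ x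
  ℓ-⋉ x s = ℕₚ.≤-trans (proj₂ (ℓ-◃ (σ s) (x ▹ s))) (s≤s (proj₂ (ℓ-▹ x s)))

  -- A descent fixes a twisted involution under `⋉`, so these are the words none of whose letters is
  -- idle.
  Asc : Word → Word → Set
  Asc x []      = ⊤
  Asc x (s ∷ w) = Pos x s × Asc (x ⋉ s) w

  Asc-resp : ∀ {x y} w → x ≈ y → Asc x w → Asc y w
  Asc-resp []      e a       = tt
  Asc-resp (s ∷ w) e (p , a) = Pos-resp e p , Asc-resp w (⋉-cong s e) a

  Asc-++ : ∀ x u v → Asc x u → Asc (δ x u) v → Asc x (u ++ v)
  Asc-++ x []      v a       b = b
  Asc-++ x (s ∷ u) v (p , a) b = p , Asc-++ (x ⋉ s) u v a b

  Asc-split : ∀ x u v → Asc x (u ++ v) → Asc x u × Asc (δ x u) v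
  Asc-split x []      v a = tt , a
  Asc-split x (s ∷ u) v (p , a) with Asc-split (x ⋉ s) u v a
  ... | b , c = (p , b) , c

  -- The alternative in `short` is what shows that shortest words are ascending: otherwise pruning
  -- would strictly shorten them.
  record Pruned (x w : Word) : Set where
    field
      word  : Word
      asc   : Asc x word
      equal : δ x word ≈ δ x w
      short : Asc x w ⊎ length word < length w

  pruned-≤ : ∀ {x w} → Invol x → Pruned x w → ∃[ v ] (Asc x v × δ x v ≈ δ x w × length v ≤ length w)
  pruned-≤ {w = w} i P with Pruned.short P
  ... | inj₁ a = w , a , ≈refl , ℕₚ.≤-refl
  ... | inj₂ h = Pruned.word P , Pruned.asc P , Pruned.equal P , ℕₚ.<⇒≤ h

  prune : ∀ x w → Invol x → Pruned x w
  prune x [] i = record { word = [] ; asc = tt ; equal = ≈refl ; short = inj₁ tt }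
  prune x (s ∷ w) i with sign x s
  prune x (s ∷ w) i | inj₁ p = record
    { word = s ∷ word ; asc = p , asc ; equal = equal ; short = longer short }
    where
    open Pruned (prune (x ⋉ s) w (Invol-⋉ s i))
    longer : Asc (x ⋉ s) w ⊎ length word < length w → Asc x (s ∷ w) ⊎ suc (length word) < suc (length w)
    longer (inj₁ a) = inj₁ (p , a)
    longer (inj₂ h) = inj₂ (s≤s h)
  prune x (s ∷ w) i | inj₂ n with pruned-≤ i (prune x w i)
  ... | v , a , e , h = record
    { word = v ; asc = a ; equal = ≈trans e (≡⇒≈ (cong (λ y → δ y w) (sym (⋉-Neg i n))))
    ; short = inj₂ (s≤s h) }

  -- The solution y of y ⋉ s = w is w s or s* w s, according to whether s* w = w s.
  record Down (w : Word) (s : S) : Set where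
    field
      y     : Word
      invol : Invol y
      pos   : Pos y s
      equal : y ⋉ s ≈ w
      lower : ℓ y < ℓ w

  -- If s* w ≠ w s, then s* must still be a left descent of w s: otherwise exchange at w s would
  -- give s* w s = w. So s* w s lies two below w.
  down : ∀ {w s} → Invol w → Neg w s → Down w s
  down {w} {s} i n with σ s ∷ w ≈? w ++ [ s ]
  ... | yes e = record
    { y = w ++ [ s ]
    ; invol = begin
        inv (w ++ [ s ])        ≡⟨ inv-++ w [ s ] ⟩
        s ∷ inv w               ≈⟨ ++ˡ [ s ] i ⟩
        s ∷ star w              ≡⟨ cong (_∷ star w) (sym (σ-invol s)) ⟩
        star (σ s ∷ w)          ≈⟨ star-cong e ⟩
        star (w ++ [ s ])       ∎
    ; pos = Neg⇒Pos w n
    ; equal = begin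
        σ s ◃ ((w ++ [ s ]) ▹ s)       ≡⟨ cong (σ s ◃_) (▹-Pos (Neg⇒Pos w n)) ⟩
        σ s ◃ ((w ++ [ s ]) ++ [ s ])  ≈⟨ ◃-cong (σ s) (square-end w s) ⟩
        σ s ◃ w                        ≡⟨ ◃-LNeg (Invol-LNeg i n) ⟩
        w                              ∎
    ; lower = ℕₚ.≤-reflexive (ℓ-Neg n) }
    where open ≈-Reasoning
  ... | no ne = go (lsign (w ++ [ s ]) (σ s))
    where
    ln : LNeg w (σ s)
    ln = Invol-LNeg i n
    go : LPos (w ++ [ s ]) (σ s) ⊎ LNeg (w ++ [ s ]) (σ s) → Down w s
    go (inj₁ lp) = ⊥-elim (ne (≈trans (≈sym (square-end (σ s ∷ w) s)) (++ʳ [ s ]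
        (≈trans (exchange (Neg⇒Pos w n) lp (ℓ<⇒Neg below)) (square-end w s)))))
      where
      below : ℓ ((σ s ∷ (w ++ [ s ])) ++ [ s ]) < ℓ (σ s ∷ (w ++ [ s ]))
      below = begin-strict
        ℓ ((σ s ∷ (w ++ [ s ])) ++ [ s ])   ≡⟨ ℓ-cong (square-end (σ s ∷ w) s) ⟩
        ℓ (σ s ∷ w)                         <⟨ ℕₚ.≤-reflexive (ℓ-LNeg ln) ⟩
        ℓ w                                 ≡⟨ sym (ℓ-Neg n) ⟩
        suc (ℓ (w ++ [ s ]))                ≡⟨ sym (ℓ-LPos lp) ⟩
        ℓ (σ s ∷ (w ++ [ s ]))              ∎
        where open ℕₚ.≤-Reasoning
    go (inj₂ lw) = record
      { y = y ; invol = invol-y ; pos = pos-y ; equal = equal-y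
      ; lower = ℕₚ.<-trans (ℕₚ.≤-reflexive (ℓ-LNeg lw)) (ℕₚ.≤-reflexive (ℓ-Neg n)) }
      where
      y : Word
      y = σ s ∷ (w ++ [ s ])
      yss : y ++ [ s ] ≈ σ s ∷ w
      yss = square-end (σ s ∷ w) s
      pos-y : Pos y s
      pos-y = ℓ>⇒Pos (begin-strict
        ℓ y                     <⟨ ℕₚ.≤-reflexive (ℓ-LNeg lw) ⟩
        ℓ (w ++ [ s ])          ≡⟨ ℕₚ.suc-injective (trans (ℓ-Neg n) (sym (ℓ-LNeg ln))) ⟩
        ℓ (σ s ∷ w)             ≡⟨ sym (ℓ-cong yss) ⟩
        ℓ (y ++ [ s ])          ∎)
        where open ℕₚ.≤-Reasoning
      open ≈-Reasoning
      invol-y : Invol y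
      invol-y = begin
        inv (σ s ∷ (w ++ [ s ]))           ≡⟨ inv-∷ (σ s) (w ++ [ s ]) ⟩
        inv (w ++ [ s ]) ++ [ σ s ]        ≡⟨ cong (_++ [ σ s ]) (inv-++ w [ s ]) ⟩
        (s ∷ inv w) ++ [ σ s ]             ≈⟨ ++ʳ [ σ s ] (++ˡ [ s ] i) ⟩
        (s ∷ star w) ++ [ σ s ]            ≡⟨ cong₂ _∷_ (sym (σ-invol s)) (sym (star-∷ʳ w s)) ⟩
        star (σ s ∷ (w ++ [ s ]))          ∎
      equal-y : y ⋉ s ≈ w
      equal-y = begin
        σ s ◃ (y ▹ s)          ≡⟨ cong (σ s ◃_) (▹-Pos pos-y) ⟩
        σ s ◃ (y ++ [ s ])     ≈⟨ ◃-cong (σ s) yss ⟩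
        σ s ◃ (σ s ∷ w)        ≡⟨ ◃-LPos (LNeg⇒LPos w ln) ⟩
        σ s ∷ σ s ∷ w          ≈⟨ square-inner (σ s) w ⟩
        w                      ∎

  private
    Form : Word → Word → S → Set
    Form w y s = (σ s ∷ w ≈ w ++ [ s ] × y ≈ w ++ [ s ]) ⊎ (ℓ w ≡ 2 + ℓ y × y ≈ (σ s ∷ w) ++ [ s ])

    form : ∀ {w y s} → Invol y → Pos y s → y ⋉ s ≈ w → Form w y s
    form {w} {y} {s} i p e = go (lsign (y ++ [ s ]) (σ s))
      where
      open ≈-Reasoning
      e′ : σ s ◃ (y ++ [ s ]) ≈ w
      e′ = subst (λ z → σ s ◃ z ≈ w) (▹-Pos p) e
      go : LPos (y ++ [ s ]) (σ s) ⊎ LNeg (y ++ [ s ]) (σ s) → Form w y s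
      go (inj₁ lp) = inj₂ (trans (sym (ℓ-cong w≈)) (trans (ℓ-LPos lp) (cong suc (ℓ-Pos p))) , (begin
        y                                          ≈⟨ ≈sym (square-end y s) ⟩
        (y ++ [ s ]) ++ [ s ]                      ≈⟨ ++ʳ [ s ] (≈sym (square-inner (σ s) _)) ⟩
        (σ s ∷ σ s ∷ (y ++ [ s ])) ++ [ s ]        ≈⟨ ++ʳ [ s ] (++ˡ [ σ s ] w≈) ⟩
        (σ s ∷ w) ++ [ s ]                         ∎))
        where
        w≈ : σ s ∷ (y ++ [ s ]) ≈ w
        w≈ = subst (_≈ w) (◃-LPos lp) e′
      go (inj₂ ln) = inj₁ ((begin
          σ s ∷ w              ≈⟨ ++ˡ [ σ s ] (≈sym w≈) ⟩
          σ s ∷ (y ++ [ s ])   ≈⟨ ++ˡ [ σ s ] (≈sym ex) ⟩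
          σ s ∷ σ s ∷ y        ≈⟨ square-inner (σ s) y ⟩
          y                    ≈⟨ y≈ ⟩
          w ++ [ s ]           ∎) , y≈)
        where
        w≈ : y ++ [ s ] ≈ w
        w≈ = subst (_≈ w) (◃-LNeg ln) e′
        lp : LPos y (σ s)
        lp = Invol-LPos i p
        ex : σ s ∷ y ≈ y ++ [ s ]
        ex = exchange p lp (ℓ<⇒Neg (ℕₚ.≤-reflexive (trans (ℓ-LNeg ln) (trans (ℓ-Pos p) (sym (ℓ-LPos lp))))))
        y≈ : y ≈ w ++ [ s ]
        y≈ = ≈trans (≈sym (square-end y s)) (++ʳ [ s ] w≈)

  -- A solution is w s or s* w s, and w decides which: if s* w = w s, then s* w s is w itself and
  -- cannot be two shorter than w. This allows last letters to be cancelled.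
  down-unique : ∀ {y y′ s} → Invol y → Invol y′ → Pos y s → Pos y′ s → y ⋉ s ≈ y′ ⋉ s → y ≈ y′
  down-unique {y} {y′} {s} i i′ p p′ e = go (form i p ≈refl) (form i′ p′ (≈sym e))
    where
    w : Word
    w = y ⋉ s
    mixed : ∀ {u} → σ s ∷ w ≈ w ++ [ s ] → ℓ w ≡ 2 + ℓ u → u ≈ (σ s ∷ w) ++ [ s ] → ⊥
    mixed c h e = ℕₚ.<-irrefl (trans (ℓ-cong (≈trans e (≈trans (++ʳ [ s ] c) (square-end w s)))) h)
                              (ℕₚ.m≤n+m _ 1)
    go : Form w y s → Form w y′ s → y ≈ y′
    go (inj₁ (_ , a)) (inj₁ (_ , b)) = ≈trans a (≈sym b)
    go (inj₂ (_ , a)) (inj₂ (_ , b)) = ≈trans a (≈sym b)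
    go (inj₁ (c , _)) (inj₂ (h , b)) = ⊥-elim (mixed c h b)
    go (inj₂ (h , a)) (inj₁ (c , _)) = ⊥-elim (mixed c h a)

-- Alternating chains and their tops

letter-elim : ∀ {S : Set} (P : S → Set) {s t} k → P s → P t → P (letter s t k)
letter-elim P zero    ps pt = ps
letter-elim P (suc k) ps pt = letter-elim P k pt ps

module Chains (Y : System) where
  open System Y
  open Demazure Y public

  Top : Word → S → S → Set
  Top w s t = Neg w s × Neg w t

  Asc-next : ∀ x s t j d → Asc x (alt s t (j + suc d)) → Pos (δ x (alt s t j)) (letter s t j)
  Asc-next x s t j d a =
    proj₁ (proj₂ (Asc-split x (alt s t j) _ (subst (Asc x) (alt-+ s t j (suc d)) a)))

  not-past-top : ∀ {x s t} j j′ → j < j′ → Top (δ x (alt s t j)) s t → Asc x (alt s t j′) → ⊥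
  not-past-top {x} {s} {t} j j′ h (ns , nt) a with ℕₚ.m≤n⇒∃[o]m+o≡n h
  ... | d , refl = Pos-Neg (Asc-next x s t j d (subst (λ i → Asc x (alt s t i)) (sym (ℕₚ.+-suc j d)) a))
                           (letter-elim (Neg _) j ns nt)

  top-unique : ∀ {x s t} j j′ → Asc x (alt s t j) → Top (δ x (alt s t j)) s t →
               Asc x (alt s t j′) → Top (δ x (alt s t j′)) s t → j ≡ j′
  top-unique j j′ a n a′ n′ with ℕₚ.<-cmp j j′
  ... | tri≈ _ e _ = e
  ... | tri< h _ _ = ⊥-elim (not-past-top j j′ h n a′)
  ... | tri> _ _ h = ⊥-elim (not-past-top j′ j h n′ a)

  -- Left multiplications that u turns into right multiplications can be moved to the right.
  δ-moved : ∀ {B : Set} (ι : B → S) (τ : B → B) u → (∀ b → σ (ι b) ◃ u ≈ u ▹ ι (τ b)) →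
            ∀ w → δ u (map ι w) ≈ u ▹* map ι (reverse (map τ w) ++ w)
  δ-moved ι τ u h w = begin
    δ u (map ι w)                                     ≈⟨ δ-product u (map ι w) ⟩
    inv (star (map ι w)) ◃* (u ▹* map ι w)            ≈⟨ ◃*-▹* (inv (star (map ι w))) u (map ι w) ⟩
    (inv (star (map ι w)) ◃* u) ▹* map ι w            ≈⟨ ▹*-cong (map ι w) (move w) ⟩
    (u ▹* map ι (reverse (map τ w))) ▹* map ι w       ≡⟨ sym (▹*-++ u (map ι (reverse (map τ w))) _) ⟩
    u ▹* (map ι (reverse (map τ w)) ++ map ι w)       ≡⟨ cong (u ▹*_) (sym (Lₚ.map-++ ι (reverse (map τ w)) w)) ⟩
    u ▹* map ι (reverse (map τ w) ++ w)               ∎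
    where
    open ≈-Reasoning
    move : ∀ w → inv (star (map ι w)) ◃* u ≈ u ▹* map ι (reverse (map τ w))
    move []      = ≈refl
    move (b ∷ w) = begin
      inv (star (map ι (b ∷ w))) ◃* u                      ≡⟨ cong (_◃* u) (inv-∷ (σ (ι b)) v) ⟩
      (inv v ++ [ σ (ι b) ]) ◃* u                          ≡⟨ ◃*-++ (inv v) [ σ (ι b) ] u ⟩
      inv v ◃* (σ (ι b) ◃ u)                               ≈⟨ ◃*-cong (inv v) (h b) ⟩
      inv v ◃* (u ▹* [ ι (τ b) ])                          ≈⟨ ◃*-▹* (inv v) u [ ι (τ b) ] ⟩
      (inv v ◃* u) ▹ ι (τ b)                               ≈⟨ ▹-cong (ι (τ b)) (move w) ⟩
      (u ▹* map ι (reverse (map τ w))) ▹ ι (τ b)           ≡⟨ sym (▹*-++ u (map ι (reverse (map τ w))) [ ι (τ b) ]) ⟩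
      u ▹* (map ι (reverse (map τ w)) ++ [ ι (τ b) ])      ≡⟨ cong (u ▹*_) (sym (Lₚ.map-++ ι (reverse (map τ w)) [ τ b ])) ⟩
      u ▹* map ι (reverse (map τ w) ++ [ τ b ])            ≡⟨ cong (λ z → u ▹* map ι z) (sym (Lₚ.unfold-reverse (τ b) (map τ w))) ⟩
      u ▹* map ι (reverse (map τ (b ∷ w)))                 ∎
      where
      v : Word
      v = star (map ι w)

-- Finite dihedral groups and their transfer into W

-- c = false gives the trivial twist, c = true the swap of the two generators.
Dih : ℕ → Bool → System
Dih M c = record
  { S = Bool ; m = dihedral M ; σ = c xor_
  ; m-sym = m-sym ; m-diag = m-diag ; m-cong = λ {s} {t} → m-cong s t
  ; σ-invol = σ-invol c ; σ-m = σ-m c }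
  where
  m-sym : ∀ s t → dihedral M s t ≡ dihedral M t s
  m-sym false false = refl
  m-sym false true  = refl
  m-sym true  false = refl
  m-sym true  true  = refl
  m-diag : ∀ s → dihedral M s s ≡ 1
  m-diag false = refl
  m-diag true  = refl
  m-cong : ∀ s t → dihedral M s t ≡ 1 → ∀ r → dihedral M s r ≡ dihedral M t r
  m-cong false false e r     = refl
  m-cong true  true  e r     = refl
  m-cong false true  e false = sym e
  m-cong false true  e true  = e
  m-cong true  false e false = e
  m-cong true  false e true  = sym e
  σ-invol : ∀ c s → c xor (c xor s) ≡ s
  σ-invol false s     = refl
  σ-invol true  false = refl
  σ-invol true  true  = refl
  σ-m : ∀ c s t → dihedral M (c xor s) (c xor t) ≡ dihedral M s t
  σ-m false s     t     = refl
  σ-m true  false false = refl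
  σ-m true  false true  = refl
  σ-m true  true  false = refl
  σ-m true  true  true  = refl

module Dihedral (M j : ℕ) (M≡ : M ≡ suc j) (c : Bool) where
  open Chains (Dih M c) public

  off-diagonal : ∀ b → dihedral M b (not b) ≡ M
  off-diagonal false = refl
  off-diagonal true  = refl

  Δ : Word
  Δ = alt false true M

  braid-D : ∀ b → alt b (not b) M ≈ alt (not b) b M
  braid-D false = braid-relation false true M≡
  braid-D true  = braid-relation true false M≡

  top-Δ : ∀ b → alt b (not b) M ≈ Δ
  top-Δ false = ≈refl
  top-Δ true  = braid-D true

  shape : ∀ g → ∃[ b ] ∃[ k ] (k ≤ M × g ≈ alt b (not b) k)
  shape [] = false , 0 , z≤n , ≈refl
  shape (a ∷ g) with shape g
  ... | b , zero , h , e = a , 1 , subst (1 ≤_) (sym M≡) (s≤s z≤n) , ++ˡ [ a ] e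
  ... | b , suc k , h , e with a Boolₚ.≟ b
  ...   | yes refl = not b , k , ℕₚ.<⇒≤ h ,
            ≈trans (++ˡ [ b ] e) (≈trans (square-inner b _) (≡⇒≈ (cong (λ z → alt (not b) z k) (sym (Boolₚ.not-involutive b)))))
  ...   | no a≢b with Boolₚ.¬-not a≢b | suc k ℕ.≟ M
  ...     | refl | no ne = not b , suc (suc k) , ℕₚ.≤∧≢⇒< h ne , ≈trans (++ˡ [ not b ] e)
              (≡⇒≈ (cong (λ z → not b ∷ alt z (not b) (suc k)) (sym (Boolₚ.not-involutive b))))
  ...     | refl | yes eM = b , k , ℕₚ.<⇒≤ h , ≈trans (++ˡ [ not b ] (≈trans e
              (subst (λ n → alt b (not b) n ≈ alt (not b) b n) (sym eM) (braid-D b))))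
              (square-inner (not b) (alt b (not b) k))

  ℓ-shape : ∀ b k → k ≤ M → ℓ (alt b (not b) k) ≡ k
  ℓ-shape b k h = trans (ℓ-alt [] b (not b) k (Pos-[] b) (Pos-[] (not b))
    (inj₁ (ℕₚ.≤-trans h (ℕₚ.≤-reflexive (sym (off-diagonal b)))))) (cong (_+ k) ℓ-[])

  -- An alternating word of fewer than M letters has its next letter as an ascent.
  Top⇒Δ : ∀ {g} → Top g false true → g ≈ Δ
  Top⇒Δ {g} (nf , nt) with shape g
  ... | b , k , h , e with k ℕ.≟ M
  ...   | yes refl = ≈trans e (top-Δ b)
  ...   | no ne = ⊥-elim (Pos-Neg
            (Pos-alt [] b (not b) k (Pos-[] b) (Pos-[] (not b))
              (inj₁ (ℕₚ.≤-trans (ℕₚ.≤∧≢⇒< h ne) (ℕₚ.≤-reflexive (sym (off-diagonal b))))))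
            (Neg-resp e (any (letter b (not b) k))))
    where
    any : ∀ a → Neg g a
    any false = nf
    any true  = nt

  -- The letter just applied is a descent, so in an ascending word it cannot be repeated at once.
  Asc-alternating : ∀ x v → Asc x v → ∃[ b ] (v ≡ alt b (not b) (length v))
  Asc-alternating x [] a = false , refl
  Asc-alternating x (b ∷ []) a = b , refl
  Asc-alternating x (b ∷ b′ ∷ v) (p , p′ , a) with Asc-alternating (x ⋉ b) (b′ ∷ v) (p′ , a)
  ... | b″ , e = b , cong (b ∷_) (trans e (cong₂ (λ y z → alt y z (suc (length v))) eq
                       (trans (cong not eq) (Boolₚ.not-involutive b))))
    where
    eq : b″ ≡ not b
    eq = trans (sym (Lₚ.∷-injectiveˡ e)) (Boolₚ.¬-not λ { refl → Pos-Neg p′ (Neg-⋉ x b) })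

module Transfer (Y : System) (α β : System.S Y) (M j : ℕ) (mαβ : System.m Y α β ≡ M) (M≡ : M ≡ suc j) (c : Bool) where
  open System Y
  open Chains Y
  module D = Dihedral M j M≡ c

  ι : Bool → S
  ι false = α
  ι true  = β

  ι* : D.Word → Word
  ι* = map ι

  m-ι : ∀ a b → m (ι a) (ι b) ≡ dihedral M a b
  m-ι false false = m-diag α
  m-ι false true  = mαβ
  m-ι true  false = trans (m-sym β α) mαβ
  m-ι true  true  = m-diag β

  ι-≈ : ∀ {u v} → u D.≈ v → ι* u ≈ ι* v
  ι-≈ = Eq.gmap ι* onRel
    where
    onRel : ∀ {u v} → D.Rel₀ u v → Rel₀ (ι* u) (ι* v)
    onRel (Core.cancel u v s t k e) = subst₂ Rel₀
      (sym (trans (Lₚ.map-++ ι u _) (cong (ι* u ++_) (trans (Lₚ.map-++ ι (alt s t (2 ℕ.* dihedral M s t)) v)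
        (cong (_++ ι* v) (trans (map-alt ι s t (2 ℕ.* dihedral M s t)) (cong (λ n → alt (ι s) (ι t) (2 ℕ.* n)) (sym (m-ι s t)))))))))
      (sym (Lₚ.map-++ ι u v))
      (cancel (ι* u) (ι* v) (ι s) (ι t) k (trans (m-ι s t) e))

  ι-Δ : ι* D.Δ ≡ alt α β M
  ι-Δ = map-alt ι false true M

  module At {x : Word} (pα : Pos x α) (pβ : Pos x β) where

    pι : ∀ b → Pos x (ι b)
    pι false = pα
    pι true  = pβ

    -- Ascents and descents are visible in lengths, so additivity carries them over from g to x g.
    ℓ-ι : ∀ g → ℓ (x ++ ι* g) ≡ ℓ x + D.ℓ g
    ℓ-ι g with D.shape g
    ... | b , k , h , e = begin
      ℓ (x ++ ι* g)                          ≡⟨ ℓ-cong (++ˡ x (ι-≈ e)) ⟩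
      ℓ (x ++ ι* (alt b (not b) k))          ≡⟨ cong (λ w → ℓ (x ++ w)) (map-alt ι b (not b) k) ⟩
      ℓ (x ++ alt (ι b) (ι (not b)) k)       ≡⟨ ℓ-alt x (ι b) (ι (not b)) k (pι b) (pι (not b))
                                                 (inj₁ (ℕₚ.≤-trans h (ℕₚ.≤-reflexive (sym (trans (m-ι b (not b)) (D.off-diagonal b)))))) ⟩
      ℓ x + k                                ≡⟨ cong (ℓ x +_) (sym (trans (D.ℓ-cong e) (D.ℓ-shape b k h))) ⟩
      ℓ x + D.ℓ g                            ∎
      where open ≡-Reasoning

    snoc-ι : ∀ g b → (x ++ ι* g) ++ [ ι b ] ≡ x ++ ι* (g ++ [ b ])
    snoc-ι g b = trans (Lₚ.++-assoc x (ι* g) [ ι b ]) (cong (x ++_) (sym (Lₚ.map-++ ι g [ b ])))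

    private
      mono : ∀ {g h} → D.ℓ g < D.ℓ h → ℓ (x ++ ι* g) < ℓ (x ++ ι* h)
      mono {g} {h} l = subst₂ _<_ (sym (ℓ-ι g)) (sym (ℓ-ι h)) (ℕₚ.+-monoʳ-< (ℓ x) l)

    Pos-ι : ∀ {g b} → D.Pos g b → Pos (x ++ ι* g) (ι b)
    Pos-ι {g} {b} p = ℓ>⇒Pos (subst (λ w → ℓ (x ++ ι* g) < ℓ w) (sym (snoc-ι g b))
      (mono (ℕₚ.≤-reflexive (sym (D.ℓ-Pos p)))))

    Neg-ι : ∀ {g b} → D.Neg g b → Neg (x ++ ι* g) (ι b)
    Neg-ι {g} {b} n = ℓ<⇒Neg (subst (λ w → ℓ w < ℓ (x ++ ι* g)) (sym (snoc-ι g b))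
      (mono (ℕₚ.≤-reflexive (D.ℓ-Neg n))))

    Pos-ι⁻¹ : ∀ {g b} → Pos (x ++ ι* g) (ι b) → D.Pos g b
    Pos-ι⁻¹ {g} {b} p with D.sign g b
    ... | inj₁ p′ = p′
    ... | inj₂ n  = ⊥-elim (Pos-Neg p (Neg-ι n))

    Neg-ι⁻¹ : ∀ {g b} → Neg (x ++ ι* g) (ι b) → D.Neg g b
    Neg-ι⁻¹ {g} {b} n with D.sign g b
    ... | inj₁ p  = ⊥-elim (Pos-Neg (Pos-ι p) n)
    ... | inj₂ n′ = n′

    ▹-ι : ∀ g b → (x ++ ι* g) ▹ ι b ≡ x ++ ι* (g D.▹ b)
    ▹-ι g b with D.sign g b
    ... | inj₁ p = trans (▹-Pos (Pos-ι p)) (snoc-ι g b)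
    ... | inj₂ n = ▹-Neg (Neg-ι n)

    ▹*-ι : ∀ g w → (x ++ ι* g) ▹* ι* w ≡ x ++ ι* (g D.▹* w)
    ▹*-ι g []      = refl
    ▹*-ι g (b ∷ w) = trans (cong (_▹* ι* w) (▹-ι g b)) (▹*-ι (g D.▹ b) w)

    -- The hypothesis is θ_x(ι b) = ι (c xor b) with the inverse of x cleared: on the two letters
    -- θ_x is the diagram automorphism c.
    module Twisting (tw : ∀ b → σ (ι (c xor b)) ∷ x ≈ x ++ [ ι b ]) where

      cons-ι : ∀ g b → σ (ι b) ∷ (x ++ ι* g) ≈ x ++ ι* ((c xor b) ∷ g)
      cons-ι g b = ≈trans (++ʳ (ι* g) (subst (λ a → σ (ι a) ∷ x ≈ x ++ [ ι (c xor b) ])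
                            (System.σ-invol (Dih M c) b) (tw (c xor b))))
                          (assoc x [ ι (c xor b) ])

      ◃-ι : ∀ g b → σ (ι b) ◃ (x ++ ι* g) ≈ x ++ ι* ((c xor b) D.◃ g)
      ◃-ι g b with D.lsign g (c xor b)
      ... | inj₁ p = ≈trans (≡⇒≈ (◃-LPos (ℓ>⇒LPos (subst (ℓ (x ++ ι* g) <_) (sym (ℓ-cong (cons-ι g b)))
                       (mono (ℕₚ.≤-reflexive (sym (D.ℓ-LPos p)))))))) (cons-ι g b)
      ... | inj₂ n = ≡⇒≈ (◃-LNeg (ℓ<⇒LNeg (subst (_< ℓ (x ++ ι* g)) (sym (ℓ-cong (cons-ι g b)))
                       (mono (ℕₚ.≤-reflexive (D.ℓ-LNeg n))))))

      ⋉-ι : ∀ g b → (x ++ ι* g) ⋉ ι b ≈ x ++ ι* (g D.⋉ b)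
      ⋉-ι g b = ≈trans (◃-cong (σ (ι b)) (≡⇒≈ (▹-ι g b))) (◃-ι (g D.▹ b) b)

      δ-ι : ∀ g w → δ (x ++ ι* g) (ι* w) ≈ x ++ ι* (D.δ g w)
      δ-ι g []      = ≈refl
      δ-ι g (b ∷ w) = ≈trans (δ-cong (ι* w) (⋉-ι g b)) (δ-ι (g D.⋉ b) w)

      Asc-ι⁻¹ : ∀ g w → Asc (x ++ ι* g) (ι* w) → D.Asc g w
      Asc-ι⁻¹ g []      a       = tt
      Asc-ι⁻¹ g (b ∷ w) (p , a) = Pos-ι⁻¹ p , Asc-ι⁻¹ (g D.⋉ b) w (Asc-resp (ι* w) (⋉-ι g b) a)

      Top-ι⁻¹ : ∀ {g} → Top (x ++ ι* g) α β → D.Top g false true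
      Top-ι⁻¹ (nα , nβ) = Neg-ι⁻¹ nα , Neg-ι⁻¹ nβ

  -- Here u is not assumed to be minimal in its coset.
  δ-Δ : ∀ u → (∀ b → σ (ι (c xor b)) ∷ u ≈ u ++ [ ι b ]) → ∀ w → D.δ [] w D.≈ D.Δ →
        δ u (ι* w) ≈ reduced u ◃* alt α β M
  δ-Δ u tw w e = begin
    δ u (ι* w)                           ≈⟨ δ-moved ι (c xor_) u moved w ⟩
    u ▹* ι* w′                           ≈⟨ ▹*-product u (ι* w′) ⟩
    reduced u ◃* ([] ▹* ι* w′)           ≡⟨ cong (reduced u ◃*_) (At.▹*-ι (Pos-[] α) (Pos-[] β) [] w′) ⟩
    reduced u ◃* ι* ([] D.▹* w′)         ≈⟨ ◃*-cong (reduced u) (ι-≈ (D.≈trans (D.≈sym product) e)) ⟩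
    reduced u ◃* ι* D.Δ                  ≡⟨ cong (reduced u ◃*_) ι-Δ ⟩
    reduced u ◃* alt α β M               ∎
    where
    open ≈-Reasoning
    w′ : D.Word
    w′ = reverse (map (c xor_) w) ++ w
    product : D.δ [] w D.≈ [] D.▹* w′
    product = subst₂ (λ a b → D.δ [] a D.≈ [] D.▹* b) (Lₚ.map-id w) (Lₚ.map-id w′)
      (D.δ-moved (λ b → b) (c xor_) []
        (λ b → D.≡⇒≈ (trans (D.◃-LPos (D.Pos-[] _)) (sym (D.▹-Pos (D.Pos-[] _))))) w)
    moved : ∀ b → σ (ι b) ◃ u ≈ u ▹ ι (c xor b)
    moved b = go (sign u (ι (c xor b)))
      where
      tw′ : σ (ι b) ∷ u ≈ u ++ [ ι (c xor b) ]
      tw′ = subst (λ a → σ (ι a) ∷ u ≈ u ++ [ ι (c xor b) ]) (System.σ-invol (Dih M c) b) (tw (c xor b))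
      go : Pos u (ι (c xor b)) ⊎ Neg u (ι (c xor b)) → σ (ι b) ◃ u ≈ u ▹ ι (c xor b)
      go (inj₁ p) = ≈trans (≡⇒≈ (◃-LPos (ℓ>⇒LPos (ℕₚ.≤-reflexive (sym (trans (ℓ-cong tw′) (ℓ-Pos p)))))))
                      (≈trans tw′ (≡⇒≈ (sym (▹-Pos p))))
      go (inj₂ n) = ≡⇒≈ (trans (◃-LNeg (ℓ<⇒LNeg (ℕₚ.≤-reflexive (trans (cong suc (ℓ-cong tw′)) (ℓ-Neg n)))))
                      (sym (▹-Neg n)))

module DihedralChains (M j : ℕ) (M≡ : M ≡ suc j) (c : Bool) where
  open Dihedral M j M≡ c public
  private
    -- Interchanging the generators is a transfer of the dihedral group into itself, used at x = 1;
    -- it commutes with either twist.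
    module T = Transfer (Dih M c) true false M j refl M≡ c

    xor-not : ∀ c b → c xor (T.ι (c xor b)) ≡ T.ι b
    xor-not false b     = refl
    xor-not true  false = refl
    xor-not true  true  = refl

    open T.At (Pos-[] true) (Pos-[] false) using (module Twisting)
    open Twisting (λ b → ≡⇒≈ (cong [_] (xor-not c b)))

  swap-chain : ∀ k → Asc [] (alt true false k) → Top (δ [] (alt true false k)) false true →
               Asc [] (alt false true k) × Top (δ [] (alt false true k)) false true
  swap-chain k a (nf , nt) = Asc-ι⁻¹ [] (alt false true k) (subst (Asc []) eq a) ,
    Top-ι⁻¹ (Neg-resp shift nt , Neg-resp shift nf)
    where
    eq : alt true false k ≡ T.ι* (alt false true k)
    eq = sym (map-alt T.ι false true k)
    shift : δ [] (alt true false k) ≈ T.ι* (δ [] (alt false true k))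
    shift = ≈trans (≡⇒≈ (cong (δ []) eq)) (δ-ι [] (alt false true k))

  -- Any competing word can be pruned, then alternates, and after a possible interchange of
  -- generators begins with `false`. Ascending alternating words that reach the top from one start
  -- have one length.
  hat-length : ∀ k → Asc [] (alt false true k) → Top (δ [] (alt false true k)) false true → HatLen Δ k
  hat-length k a top = alt false true k , (⇒Reach (alt false true k) end≈Δ , minimal) , length-alt false true k
    where
    end≈Δ : δ [] (alt false true k) ≈ Δ
    end≈Δ = Top⇒Δ top
    top-from : ∀ {g} → g ≈ Δ → Top g false true
    top-from e = Neg-resp (≈trans end≈Δ (≈sym e)) (proj₁ top) , Neg-resp (≈trans end≈Δ (≈sym e)) (proj₂ top)
    minimal : ∀ v → Reach [] v Δ → length (alt false true k) ≤ length v
    minimal v r with pruned-≤ {w = v} ≈refl (prune [] v ≈refl)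
    ... | v′ , a′ , e , h with Asc-alternating [] v′ a′
    ...   | b , eq = ℕₚ.≤-trans (ℕₚ.≤-reflexive (trans (length-alt false true k) (same b eq))) h
      where
      end : δ [] v′ ≈ Δ
      end = ≈trans e (Reach⇒ r)
      same : ∀ b → v′ ≡ alt b (not b) (length v′) → k ≡ length v′
      same false eq = top-unique k (length v′) a top
        (subst (Asc []) eq a′) (top-from (subst (λ z → δ [] z ≈ Δ) eq end))
      same true eq with swap-chain (length v′) (subst (Asc []) eq a′) (top-from (subst (λ z → δ [] z ≈ Δ) eq end))
      ... | a″ , top″ = top-unique k (length v′) a top a″ top″

  -- A shortest word is ascending, hence alternating; its first letter remains unspecified.
  hat-alternating : ∀ {k} → HatLen Δ k → ∃[ b ] (δ [] (alt b (not b) k) ≈ Δ)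
  hat-alternating (w , (r , min) , refl) with prune [] w ≈refl
  ... | P with Pruned.short P
  ...   | inj₂ h = ⊥-elim (ℕₚ.<⇒≱ h (min (Pruned.word P) (⇒Reach (Pruned.word P) (≈trans (Pruned.equal P) (Reach⇒ r)))))
  ...   | inj₁ a with Asc-alternating [] w a
  ...     | b , eq = b , subst (λ z → δ [] z ≈ Δ) eq (Reach⇒ r)

-- Orbits of twisted involutions under two generators

letter-cover : ∀ {S : Set} (P : S → Set) {s t} k → P (letter s t k) → P (letter t s k) → P s × P t
letter-cover P zero    p q = p , q
letter-cover P (suc k) p q = letter-cover P k q p

module Orbits (Y : System) where
  open System Y
  open Chains Y public

  -- In an infinite dihedral coset an alternating tail never becomes full, so the letter after it is
  -- always an ascent.
  Top-finite : ∀ {w s t} → Top w s t → m s t ≢ 0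
  Top-finite {w} {s} {t} (ns , nt) z = Pos-Neg
    (Pos-resp (≈sym equal) (subst (Pos _) next (Pos-alt p x y (suc k) posx posy (inj₂ (infinite pair)))))  ns
    where
    open Coset (coset w t s nt)
    infinite : ∀ {a b} → SamePair t s a b → m a b ≡ 0
    infinite straight = trans (m-sym t s) z
    infinite crossed  = z

  ▹*-alt : ∀ p s t k → Pos p s → Pos p t → Below k s t → p ▹* alt s t k ≈ p ++ alt s t k
  ▹*-alt p s t zero    ps pt h = ≡⇒≈ (sym (Lₚ.++-identityʳ p))
  ▹*-alt p s t (suc k) ps pt h = begin
    p ▹* alt s t (suc k)                       ≡⟨ cong (p ▹*_) (alt-snoc s t k) ⟩
    p ▹* (alt s t k ++ [ letter s t k ])       ≡⟨ ▹*-++ p (alt s t k) _ ⟩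
    (p ▹* alt s t k) ▹ letter s t k            ≈⟨ ▹-cong _ (▹*-alt p s t k ps pt (Below-pred h)) ⟩
    (p ++ alt s t k) ▹ letter s t k            ≡⟨ ▹-Pos (Pos-alt p s t k ps pt h) ⟩
    (p ++ alt s t k) ++ [ letter s t k ]       ≈⟨ ≈sym (≈-snoc-alt p s t k) ⟩
    p ++ alt s t (suc k)                       ∎
    where open ≈-Reasoning

  Neg-◃* : ∀ {x s} v → Neg x s → Neg (v ◃* x) s
  Neg-◃* []      n = n
  Neg-◃* (r ∷ v) n = Neg-◃ r (Neg-◃* v n)

  δ-stuck : ∀ {x s t} k → Invol x → Top x s t → δ x (alt s t k) ≡ x
  δ-stuck zero    i n = refl
  δ-stuck (suc k) i (ns , nt) = trans (cong (λ y → δ y (alt _ _ k)) (⋉-Neg i ns)) (δ-stuck k i (nt , ns))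

  -- The left factors of w = Δ* ∘ x ∘ Δ are accounted for one letter at a time: as long as the
  -- partial product L_h x stays minimal in its right coset, L_h ∘ (xΔ) = (L_h x)Δ.
  module Growth {x : Word} (ix : Invol x) where

    L : S → S → ℕ → Word
    L a b h = inv (alt (σ a) (σ b) h)

    L-suc : ∀ a b h → L a b (suc h) ≡ letter (σ a) (σ b) h ∷ L a b h
    L-suc a b h = trans (cong inv (alt-snoc (σ a) (σ b) h)) (inv-++ (alt (σ a) (σ b) h) _)

    Stage : S → S → ℕ → ℕ → Set
    Stage a b M h = Pos (L a b h ++ x) a × Pos (L a b h ++ x) b ×
                    L a b h ◃* (x ++ alt a b M) ≈ (L a b h ++ x) ++ alt a b M

    module _ {a b : S} (pa : Pos x a) (pb : Pos x b) {M : ℕ} (mab : m a b ≡ M) where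

      private
        below : ∀ {h} → h ≤ M → Below h (σ a) (σ b)
        below l = inj₁ (ℕₚ.≤-trans l (ℕₚ.≤-reflexive (trans (sym mab) (sym (σ-m a b)))))

        inv-L : ∀ h → inv (L a b h ++ x) ≡ inv x ++ alt (σ a) (σ b) h
        inv-L h = trans (inv-++ (L a b h) x) (cong (inv x ++_) (inv-inv _))

      LPos-L : ∀ h → h < M → LPos (L a b h ++ x) (letter (σ a) (σ b) h)
      LPos-L h l = subst (λ w → Pos w (letter (σ a) (σ b) h)) (sym (inv-L h))
        (Pos-alt (inv x) (σ a) (σ b) h (Invol-LPos ix pa) (Invol-LPos ix pb) (below l))

      ℓ-L : ∀ h → h ≤ M → ℓ (L a b h ++ x) ≡ ℓ x + h
      ℓ-L h l = begin
        ℓ (L a b h ++ x)                    ≡⟨ sym (ℓ-inv (L a b h ++ x)) ⟩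
        ℓ (inv (L a b h ++ x))              ≡⟨ cong ℓ (inv-L h) ⟩
        ℓ (inv x ++ alt (σ a) (σ b) h)      ≡⟨ ℓ-alt (inv x) (σ a) (σ b) h (Invol-LPos ix pa) (Invol-LPos ix pb) (below l) ⟩
        ℓ (inv x) + h                       ≡⟨ cong (_+ h) (ℓ-inv x) ⟩
        ℓ x + h                             ∎
        where open ≡-Reasoning

      ℓ-top : ∀ y → Pos y a → Pos y b → ℓ (y ++ alt a b M) ≡ ℓ y + M
      ℓ-top y ya yb = ℓ-alt y a b M ya yb (inj₁ (ℕₚ.≤-reflexive (sym mab)))

      stage-0 : Stage a b M 0
      stage-0 = pa , pb , ≈refl

      -- If r y loses an ascent, exchange gives r y = y a or r y = y b. This can only happen at the
      -- first letter, where it says that θ_x sends a or b to a.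
      stage-suc : ∀ h → suc h < M → Stage a b M h →
                  Stage a b M (suc h) ⊎ (h ≡ 0 × (σ a ∷ x ≈ x ++ [ a ] ⊎ σ a ∷ x ≈ x ++ [ b ]))
      stage-suc h l (ya , yb , e) = go (sign (r ∷ y) a) (sign (r ∷ y) b)
        where
        y : Word
        y = L a b h ++ x
        r : S
        r = letter (σ a) (σ b) h
        lp : LPos y r
        lp = LPos-L h (ℕₚ.<-trans ℕₚ.≤-refl l)
        fold : L a b (suc h) ++ x ≡ r ∷ y
        fold = cong (_++ x) (L-suc a b h)
        collapse : ∀ h → (suc h < M) → letter (σ a) (σ b) h ∷ (L a b h ++ x) ≈ (L a b h ++ x) ++ [ a ]
                                       ⊎ letter (σ a) (σ b) h ∷ (L a b h ++ x) ≈ (L a b h ++ x) ++ [ b ] →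
                   h ≡ 0 × (σ a ∷ x ≈ x ++ [ a ] ⊎ σ a ∷ x ≈ x ++ [ b ])
        collapse zero    l c = refl , c
        collapse (suc h) l c = ⊥-elim (absurd c)
          where
          -- q is the outermost letter of the current left factor and also the letter that comes
          -- after the next one. Multiplying by q therefore adds length on one side of the supposed
          -- equation and cancels on the other.
          q : S
          q = letter (σ a) (σ b) h
          y′ : Word
          y′ = L a b h ++ x
          top : Word
          top = letter (σ a) (σ b) (suc h) ∷ (L a b (suc h) ++ x)
          high : ℓ (q ∷ top) ≡ suc (suc (ℓ (L a b (suc h) ++ x)))
          high = trans (ℓ-LPos (subst (λ w → LPos w q) (cong (_++ x) (L-suc a b (suc h))) (LPos-L (suc (suc h)) l)))
                       (cong suc (ℓ-LPos (LPos-L (suc h) (ℕₚ.<-trans ℕₚ.≤-refl l))))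
          shrink : ∀ z → top ≈ (L a b (suc h) ++ x) ++ [ z ] → ⊥
          shrink z c = ℕₚ.<-irrefl refl (begin-strict
            ℓ (q ∷ top)                              ≡⟨ ℓ-cong (++ˡ [ q ] c) ⟩
            ℓ (q ∷ ((L a b (suc h) ++ x) ++ [ z ]))  ≡⟨ cong (λ w → ℓ (q ∷ ((w ++ x) ++ [ z ]))) (L-suc a b h) ⟩
            ℓ (q ∷ q ∷ (y′ ++ [ z ]))                ≡⟨ ℓ-cong (square-inner q (y′ ++ [ z ])) ⟩
            ℓ (y′ ++ [ z ])                          ≤⟨ ℓ-∷ʳ-≤ y′ z ⟩
            suc (ℓ y′)                               ≡⟨ sym (ℓ-LPos (LPos-L h (ℕₚ.<-trans (s≤s (ℕₚ.n≤1+n h)) l))) ⟩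
            ℓ (q ∷ y′)                               ≡⟨ cong (λ w → ℓ (w ++ x)) (sym (L-suc a b h)) ⟩
            ℓ (L a b (suc h) ++ x)                   <⟨ s≤s (ℕₚ.n≤1+n _) ⟩
            suc (suc (ℓ (L a b (suc h) ++ x)))       ≡⟨ sym high ⟩
            ℓ (q ∷ top)                              ∎)
            where open ℕₚ.≤-Reasoning
          absurd : top ≈ (L a b (suc h) ++ x) ++ [ a ] ⊎ top ≈ (L a b (suc h) ++ x) ++ [ b ] → ⊥
          absurd (inj₁ c) = shrink a c
          absurd (inj₂ c) = shrink b c
        go : Pos (r ∷ y) a ⊎ Neg (r ∷ y) a → Pos (r ∷ y) b ⊎ Neg (r ∷ y) b →
             Stage a b M (suc h) ⊎ (h ≡ 0 × (σ a ∷ x ≈ x ++ [ a ] ⊎ σ a ∷ x ≈ x ++ [ b ]))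
        go (inj₂ na) _ = inj₂ (collapse h l (inj₁ (exchange ya lp na)))
        go (inj₁ _) (inj₂ nb) = inj₂ (collapse h l (inj₂ (exchange yb lp nb)))
        go (inj₁ ra) (inj₁ rb) = inj₁ (subst (λ w → Pos w a) (sym fold) ra , subst (λ w → Pos w b) (sym fold) rb , (begin
          L a b (suc h) ◃* (x ++ alt a b M)          ≡⟨ cong (_◃* (x ++ alt a b M)) (L-suc a b h) ⟩
          r ◃ (L a b h ◃* (x ++ alt a b M))          ≈⟨ ◃-cong r e ⟩
          r ◃ (y ++ alt a b M)                       ≡⟨ ◃-LPos (ℓ>⇒LPos (ℕₚ.≤-reflexive (sym up))) ⟩
          r ∷ (y ++ alt a b M)                       ≡⟨ cong (_++ alt a b M) (sym fold) ⟩
          (L a b (suc h) ++ x) ++ alt a b M          ∎))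
          where
          open ≈-Reasoning
          up : ℓ ((r ∷ y) ++ alt a b M) ≡ suc (ℓ (y ++ alt a b M))
          up = trans (ℓ-top (r ∷ y) ra rb) (trans (cong (_+ M) (ℓ-LPos lp)) (cong suc (sym (ℓ-top y ya yb))))

      stages : ∀ h → suc h < M → Stage a b M 1 → Stage a b M (suc h)
      stages zero    l s = s
      stages (suc h) l s with stage-suc (suc h) l (stages h (ℕₚ.<-trans ℕₚ.≤-refl l) s)
      ... | inj₁ s′ = s′

      -- All M right letters and the first M - 1 left letters add one each; the last left letter may
      -- be absorbed and is not counted.
      stage-bound : ∀ j → M ≡ suc j → Stage a b M j → ℓ x + (j + M) ≤ ℓ (δ x (alt a b M))
      stage-bound j refl (ya , yb , e) = begin
        ℓ x + (j + M)                                              ≡⟨ sym (ℕₚ.+-assoc (ℓ x) j M) ⟩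
        (ℓ x + j) + M                                              ≡⟨ cong (_+ M) (sym (ℓ-L j (ℕₚ.n≤1+n j))) ⟩
        ℓ (L a b j ++ x) + M                                       ≡⟨ sym (ℓ-top _ ya yb) ⟩
        ℓ ((L a b j ++ x) ++ alt a b M)                            ≡⟨ sym (ℓ-cong e) ⟩
        ℓ (L a b j ◃* (x ++ alt a b M))                            ≤⟨ proj₁ (ℓ-◃ (letter (σ a) (σ b) j) _) ⟩
        ℓ (letter (σ a) (σ b) j ◃ (L a b j ◃* (x ++ alt a b M)))   ≡⟨ cong (λ v → ℓ (v ◃* (x ++ alt a b M))) (sym (L-suc a b j)) ⟩
        ℓ (L a b M ◃* (x ++ alt a b M))                            ≡⟨ cong (λ v → ℓ (inv v ◃* (x ++ alt a b M))) (sym (map-alt σ a b M)) ⟩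
        ℓ (inv (star (alt a b M)) ◃* (x ++ alt a b M))             ≡⟨ sym (ℓ-cong (≈trans (δ-product x (alt a b M))
              (◃*-cong (inv (star (alt a b M))) (▹*-alt x a b M pa pb (inj₁ (ℕₚ.≤-reflexive (sym mab))))))) ⟩
        ℓ (δ x (alt a b M))                                        ∎
        where open ℕₚ.≤-Reasoning

    -- Only the first left letter can obstruct, and δ-invariance under the full braid permits
    -- starting with either α or β. If both starts fail, θ_x fixes or swaps the two letters, or else
    -- α* = β*, which is impossible for m > 1.
    growth : ∀ {α β} → Pos x α → Pos x β → ∀ j → m α β ≡ suc j →
             ¬ (σ α ∷ x ≈ x ++ [ α ] × σ β ∷ x ≈ x ++ [ β ]) →
             ¬ (σ β ∷ x ≈ x ++ [ α ] × σ α ∷ x ≈ x ++ [ β ]) →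
             ℓ x + (j + suc j) ≤ ℓ (δ x (alt α β (suc j)))
    growth {α} {β} pα pβ zero    e ¬fix ¬swap = stage-bound pα pβ e 0 refl (stage-0 pα pβ e)
    growth {α} {β} pα pβ (suc j) e ¬fix ¬swap = go (stage-suc pα pβ e 0 two (stage-0 pα pβ e))
                                                    (stage-suc pβ pα e′ 0 two (stage-0 pβ pα e′))
      where
      M : ℕ
      M = suc (suc j)
      two : 1 < M
      two = s≤s (s≤s z≤n)
      e′ : m β α ≡ M
      e′ = trans (m-sym β α) e
      distinct : ¬ ([ σ α ] ≈ [ σ β ])
      distinct d = Pos-Neg
        (Pos-alt [] (σ α) (σ β) 1 (Pos-[] _) (Pos-[] _) (inj₁ (ℕₚ.≤-trans two (ℕₚ.≤-reflexive (sym (trans (σ-m α β) e))))))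
        (Neg-resp (≈sym d) (Pos⇒Neg [] (Pos-[] (σ β))))
      from : ∀ {a b} → Pos x a → Pos x b → m a b ≡ M → Stage a b M 1 → ℓ x + (suc j + M) ≤ ℓ (δ x (alt a b M))
      from pa pb e s = stage-bound pa pb e (suc j) refl (stages pa pb e j ℕₚ.≤-refl s)
      go : Stage α β M 1 ⊎ (0 ≡ 0 × (σ α ∷ x ≈ x ++ [ α ] ⊎ σ α ∷ x ≈ x ++ [ β ])) →
           Stage β α M 1 ⊎ (0 ≡ 0 × (σ β ∷ x ≈ x ++ [ β ] ⊎ σ β ∷ x ≈ x ++ [ α ])) →
           ℓ x + (suc j + M) ≤ ℓ (δ x (alt α β M))
      go (inj₁ s) _ = from pα pβ e s
      go (inj₂ _) (inj₁ s) = subst (ℓ x + (suc j + M) ≤_)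
        (ℓ-cong (subst (λ n → δ x (alt β α n) ≈ δ x (alt α β n)) e′ (δ-braid x β α e′))) (from pβ pα e′ s)
      go (inj₂ (_ , inj₁ c)) (inj₂ (_ , inj₁ d)) = ⊥-elim (¬fix (c , d))
      go (inj₂ (_ , inj₂ c)) (inj₂ (_ , inj₂ d)) = ⊥-elim (¬swap (d , c))
      go (inj₂ (_ , inj₁ c)) (inj₂ (_ , inj₂ d)) = ⊥-elim (distinct (cancelʳ x (≈trans c (≈sym d))))
      go (inj₂ (_ , inj₂ c)) (inj₂ (_ , inj₁ d)) = ⊥-elim (distinct (cancelʳ x (≈trans c (≈sym d))))

  module _ {x : Word} (ix : Invol x) where

    -- Both letters are descents of xΔ, and left Demazure factors keep right descents.
    Top-braid : ∀ {α β} → Pos x α → Pos x β → ∀ j → m α β ≡ suc j → Top (δ x (alt α β (suc j))) α β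
    Top-braid {α} {β} pα pβ j e = down-to (proj₁ both) , down-to (proj₂ both)
      where
      M : ℕ
      M = suc j
      z : Word
      z = x ++ alt α β M
      δ≈ : inv (star (alt α β M)) ◃* z ≈ δ x (alt α β M)
      δ≈ = ≈sym (≈trans (δ-product x (alt α β M)) (◃*-cong (inv (star (alt α β M)))
             (▹*-alt x α β M pα pβ (inj₁ (ℕₚ.≤-reflexive (sym e))))))
      down-to : ∀ {s} → Neg z s → Neg (δ x (alt α β M)) s
      down-to n = Neg-resp δ≈ (Neg-◃* (inv (star (alt α β M))) n)
      both : Neg z α × Neg z β
      both = letter-cover (Neg z) j
        (Neg-resp (≈sym (≈-snoc-alt x α β j)) (Pos⇒Neg _ (Pos-alt x α β j pα pβ (inj₁ (ℕₚ.≤-reflexive (sym e))))))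
        (Neg-resp (≈trans (≈sym (≈-snoc-alt x β α j)) (++ˡ x (≈sym (subst (λ n → alt α β n ≈ alt β α n) e (braid-relation α β e)))))
          (Pos⇒Neg _ (Pos-alt x β α j pβ pα (inj₁ (ℕₚ.≤-reflexive (sym (trans (m-sym β α) e)))))))

    ℓ-δ : ∀ w → ℓ (δ x w) ≤ ℓ x + (length w + length w)
    ℓ-δ w = go x w
      where
      go : ∀ x w → ℓ (δ x w) ≤ ℓ x + (length w + length w)
      go x [] = ℕₚ.≤-reflexive (sym (ℕₚ.+-identityʳ _))
      go x (s ∷ w) = begin
        ℓ (δ (x ⋉ s) w)                         ≤⟨ go (x ⋉ s) w ⟩
        ℓ (x ⋉ s) + (n + n)                     ≤⟨ ℕₚ.+-monoˡ-≤ (n + n) (ℓ-⋉ x s) ⟩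
        suc (suc (ℓ x + (n + n)))               ≡⟨ cong suc (sym (ℕₚ.+-suc (ℓ x) (n + n))) ⟩
        suc (ℓ x + suc (n + n))                 ≡⟨ sym (ℕₚ.+-suc (ℓ x) (suc (n + n))) ⟩
        ℓ x + suc (suc (n + n))                 ≡⟨ cong (λ k → ℓ x + suc k) (sym (ℕₚ.+-suc n n)) ⟩
        ℓ x + (suc n + suc n)                   ∎
        where open ℕₚ.≤-Reasoning
              n : ℕ
              n = length w

    -- The two negated hypotheses say that θ_x does not preserve {α, β}.
    unpreserved : ∀ {α β} → Pos x α → Pos x β → ∀ j → m α β ≡ suc j →
                  ¬ (σ α ∷ x ≈ x ++ [ α ] × σ β ∷ x ≈ x ++ [ β ]) →
                  ¬ (σ β ∷ x ≈ x ++ [ α ] × σ α ∷ x ≈ x ++ [ β ]) →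
                  ∀ k → Asc x (alt α β k) → Top (δ x (alt α β k)) α β → k ≡ suc j
    unpreserved {α} {β} pα pβ j e ¬fix ¬swap k a top with ℕₚ.<-cmp k (suc j)
    ... | tri≈ _ eq _ = eq
    ... | tri> _ _ h = ⊥-elim (not-past-top (suc j) k h (Top-braid pα pβ j e) a)
    ... | tri< (s≤s h) _ _ with ℕₚ.m≤n⇒∃[o]m+o≡n (ℕₚ.m≤n⇒m≤1+n h)
    ...   | d , eq = ⊥-elim (ℕₚ.<-irrefl refl (begin-strict
      ℓ x + (j + j)                               <⟨ ℕₚ.+-monoʳ-< (ℓ x) (ℕₚ.≤-reflexive (sym (ℕₚ.+-suc j j))) ⟩
      ℓ x + (j + suc j)                           ≤⟨ Growth.growth ix pα pβ j e ¬fix ¬swap ⟩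
      ℓ (δ x (alt α β (suc j)))                   ≡⟨ cong (λ n → ℓ (δ x (alt α β n))) (sym eq) ⟩
      ℓ (δ x (alt α β (k + d)))                   ≡⟨ cong ℓ same ⟩
      ℓ (δ x (alt α β k))                         ≤⟨ ℓ-δ (alt α β k) ⟩
      ℓ x + (length (alt α β k) + length (alt α β k)) ≡⟨ cong (λ n → ℓ x + (n + n)) (length-alt α β k) ⟩
      ℓ x + (k + k)                               ≤⟨ ℕₚ.+-monoʳ-≤ (ℓ x) (ℕₚ.+-mono-≤ h h) ⟩
      ℓ x + (j + j)                               ∎))
      where
      open ℕₚ.≤-Reasoning
      same : δ x (alt α β (k + d)) ≡ δ x (alt α β k)
      same = trans (cong (δ x) (alt-+ α β k d)) (trans (δ-++ x (alt α β k) _)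
        (δ-stuck d (Invol-δ (alt α β k) ix)
          (letter-elim (Neg _) k (proj₁ top) (proj₂ top) , letter-elim (Neg _) k (proj₂ top) (proj₁ top))))

  -- Once a letter of an alternating word is idle both letters are descents, so all later letters
  -- are idle and can be cut off.
  saturate : ∀ {x α β} K → Invol x → Pos x α →
             ∃[ j ] (j ≤ K × Asc x (alt α β (suc j)) × δ x (alt α β (suc j)) ≡ δ x (alt α β (suc K)))
  saturate zero ix p = 0 , z≤n , (p , tt) , refl
  saturate {x} {α} {β} (suc K) ix p = go (sign (x ⋉ α) β)
    where
    go : Pos (x ⋉ α) β ⊎ Neg (x ⋉ α) β →
         ∃[ j ] (j ≤ suc K × Asc x (alt α β (suc j)) × δ x (alt α β (suc j)) ≡ δ x (alt α β (suc (suc K))))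
    go (inj₂ n)  = 0 , z≤n , (p , tt) , sym (δ-stuck (suc K) (Invol-⋉ α ix) (n , Neg-⋉ x α))
    go (inj₁ p′) with saturate {β = α} K (Invol-⋉ α ix) p′
    ... | j , h , a , e = suc j , s≤s h , (p , a) , e

  -- The parity of k decides which of α, β is s; `final` and `final′` keep track of it.
  record Chain (w : Word) (s t : S) : Set where
    field
      x      : Word
      α β    : S
      k      : ℕ
      invol  : Invol x
      posα   : Pos x α
      posβ   : Pos x β
      asc    : Asc x (alt α β (suc k))
      equal  : δ x (alt α β (suc k)) ≈ w
      final  : letter α β k ≡ s
      final′ : letter β α k ≡ t

  chain : ∀ {w s t} → Invol w → Neg w s → Chain w s t
  chain {w} {s} {t} i n = go (ℓ D.y) D.y s t 0 ℕₚ.≤-refl D.invol (D.pos , tt) D.equal refl refl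
    where
    module D = Down (down i n)
    go : ∀ f y α β k → ℓ y ≤ f → Invol y → Asc y (alt α β (suc k)) → δ y (alt α β (suc k)) ≈ w →
         letter α β k ≡ s → letter β α k ≡ t → Chain w s t
    go f y α β k y≤f iy a e l l′ with sign y β
    ... | inj₁ pβ = record { x = y ; α = α ; β = β ; k = k ; invol = iy ; posα = proj₁ a ; posβ = pβ
                           ; asc = a ; equal = e ; final = l ; final′ = l′ }
    ... | inj₂ nβ = next f y≤f (down iy nβ)
      where
      next : ∀ f → ℓ y ≤ f → Down y β → Chain w s t
      next zero y≤0 d = ⊥-elim (ℕₚ.n≮0 (ℕₚ.<-≤-trans (Down.lower d) y≤0))
      next (suc f) y≤f d = go f (Down.y d) β α (suc k) (s≤s⁻¹ (ℕₚ.≤-trans (Down.lower d) y≤f)) (Down.invol d)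
        (Down.pos d , Asc-resp (alt α β (suc k)) (≈sym (Down.equal d)) a)
        (≈trans (δ-cong (alt α β (suc k)) (Down.equal d)) e) l l′

  word-of : ∀ {x} → Invol x → ∃[ c ] (Asc [] c × δ [] c ≈ x)
  word-of {x} i = go (ℓ x) x ℕₚ.≤-refl i
    where
    go : ∀ n x → ℓ x ≤ n → Invol x → ∃[ c ] (Asc [] c × δ [] c ≈ x)
    go n x x≤n i with descent x
    ... | inj₁ e = [] , tt , ≈sym e
    ... | inj₂ (t , nt) = extend n x≤n (down i nt)
      where
      extend : ∀ n → ℓ x ≤ n → Down x t → ∃[ c ] (Asc [] c × δ [] c ≈ x)
      extend zero x≤0 d = ⊥-elim (ℕₚ.n≮0 (ℕₚ.<-≤-trans (Down.lower d) x≤0))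
      extend (suc n) x≤n d with go n (Down.y d) (s≤s⁻¹ (ℕₚ.≤-trans (Down.lower d) x≤n)) (Down.invol d)
      ... | c , a , e = c ++ [ t ] , Asc-++ [] c [ t ] a (Pos-resp (≈sym e) (Down.pos d) , tt) ,
              ≈trans (≡⇒≈ (δ-++ [] c [ t ])) (≈trans (⋉-cong t e) (Down.equal d))

-- Braid classes of words for twisted involutions

system : (C : CoxeterMatrix) → Twist C → System
system C T = record
  { S = S ; m = m ; σ = σ ; m-sym = m-sym ; m-diag = m-diag
  -- Equality in S may be undecidable, but equality of the matrix entries is decidable and so may be
  -- proved by contradiction: s ≢ t would contradict m s t ≡ 1.
  ; m-cong = λ {s} {t} e r → decidable-stable (m s r ℕ.≟ m t r)
      λ ne → m-off s t (λ { refl → ne refl }) e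
  ; σ-invol = σ-invol ; σ-m = σ-m }
  where open CoxeterMatrix C
        open Twist T

module Main (C : CoxeterMatrix) (T : Twist C) where
  Y : System
  Y = system C T
  open System Y
  open Orbits Y
  open Twisted C T using (θ; MVal; fixes; swaps; other; BraidStep; braid) renaming (_∼_ to infix 4 _∼_)

  conjugation : ∀ {u s s′} → θ u [ s ] ≈ [ s′ ] → σ s′ ∷ u ≈ u ++ [ s ]
  conjugation {u} {s} {s′} e = begin
    σ s′ ∷ u                         ≈⟨ ++ʳ u (≈sym (star-cong e)) ⟩
    star (θ u [ s ]) ++ u            ≡⟨ cong (_++ u) (star-star _) ⟩
    (u ++ (s ∷ inv u)) ++ u          ≡⟨ trans (Lₚ.++-assoc u _ u) (sym (Lₚ.++-assoc u [ s ] _)) ⟩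
    (u ++ [ s ]) ++ (inv u ++ u)     ≈⟨ ++ˡ (u ++ [ s ]) (inverseˡ u) ⟩
    (u ++ [ s ]) ++ []               ≡⟨ Lₚ.++-identityʳ _ ⟩
    u ++ [ s ]                       ∎
    where open ≈-Reasoning

  conjugation⁻¹ : ∀ {u s s′} → σ s′ ∷ u ≈ u ++ [ s ] → θ u [ s ] ≈ [ s′ ]
  conjugation⁻¹ {u} {s} {s′} e = begin
    star (u ++ ([ s ] ++ inv u))     ≡⟨ cong star (sym (Lₚ.++-assoc u [ s ] (inv u))) ⟩
    star ((u ++ [ s ]) ++ inv u)     ≈⟨ star-cong (++ʳ (inv u) (≈sym e)) ⟩
    star (σ s′ ∷ (u ++ inv u))       ≈⟨ star-cong (++ˡ [ σ s′ ] (inverseʳ u)) ⟩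
    [ σ (σ s′) ]                     ≡⟨ cong [_] (σ-invol s′) ⟩
    [ s′ ]                           ∎
    where open ≈-Reasoning

  module _ {s t : S} {j : ℕ} (e : m s t ≡ suc j) (c : Bool) where
    private
      module DC = DihedralChains (m s t) j e c
      module T₁ = Transfer Y s t (m s t) j refl e c
      module T₂ = Transfer Y t s (m s t) j (m-sym t s) e c

    -- Both words are images of one dihedral word, under two embeddings that differ by interchanging
    -- s and t, and both embeddings send Δ to the same element. The prefix of a braid step is
    -- arbitrary, so u may have s or t as a descent.
    preserved-braid : ∀ u → (∀ b → σ (T₁.ι (c xor b)) ∷ u ≈ u ++ [ T₁.ι b ]) →
      (∀ b → σ (T₂.ι (c xor b)) ∷ u ≈ u ++ [ T₂.ι b ]) →
      ∀ {k} → DC.HatLen DC.Δ k → δ u (alt s t k) ≈ δ u (alt t s k)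
    preserved-braid u tw₁ tw₂ {k} hat = go (DC.hat-alternating hat)
      where
      tops : reduced u ◃* alt s t (m s t) ≈ reduced u ◃* alt t s (m s t)
      tops = ◃*-cong (reduced u) (braid-relation s t e)
      go : ∃[ b ] (DC.δ [] (alt b (not b) k) DC.≈ DC.Δ) → δ u (alt s t k) ≈ δ u (alt t s k)
      go (false , h) = subst₂ (λ v v′ → δ u v ≈ δ u v′) (map-alt T₁.ι false true k) (map-alt T₂.ι false true k)
        (≈trans (T₁.δ-Δ u tw₁ (alt false true k) h) (≈trans tops (≈sym (T₂.δ-Δ u tw₂ (alt false true k) h))))
      go (true , h) = subst₂ (λ v v′ → δ u v ≈ δ u v′) (map-alt T₂.ι true false k) (map-alt T₁.ι true false k)
        (≈trans (T₂.δ-Δ u tw₂ (alt true false k) h) (≈trans (≈sym tops) (≈sym (T₁.δ-Δ u tw₁ (alt true false k) h))))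

    module _ {x : Word} (pα : Pos x s) (pβ : Pos x t) (tw : ∀ b → σ (T₁.ι (c xor b)) ∷ x ≈ x ++ [ T₁.ι b ]) where
      private
        open module A = T₁.At pα pβ using (module Twisting)
        module W = Twisting tw

        pull : ∀ v → Asc x (T₁.ι* v) → Top (δ x (T₁.ι* v)) s t → DC.Asc [] v × DC.Top (DC.δ [] v) false true
        pull v a (ns , nt) = W.Asc-ι⁻¹ [] v (Asc-resp (T₁.ι* v) x≈ a) , W.Top-ι⁻¹ (Neg-resp end ns , Neg-resp end nt)
          where
          x≈ : x ≈ x ++ []
          x≈ = ≡⇒≈ (sym (Lₚ.++-identityʳ x))
          end : δ x (T₁.ι* v) ≈ x ++ T₁.ι* (DC.δ [] v)
          end = ≈trans (δ-cong (T₁.ι* v) x≈) (W.δ-ι [] v)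

        pull-alt : ∀ b k → Asc x (alt (T₁.ι b) (T₁.ι (not b)) k) → Top (δ x (alt (T₁.ι b) (T₁.ι (not b)) k)) s t →
                   DC.Asc [] (alt b (not b) k) × DC.Top (DC.δ [] (alt b (not b) k)) false true
        pull-alt b k a top = pull (alt b (not b) k) (subst (Asc x) eq a) (subst (λ v → Top (δ x v) s t) eq top)
          where
          eq : alt (T₁.ι b) (T₁.ι (not b)) k ≡ T₁.ι* (alt b (not b) k)
          eq = sym (map-alt T₁.ι b (not b) k)

      preserved-length : ∀ k → Asc x (alt s t k) → Top (δ x (alt s t k)) s t → DC.HatLen DC.Δ k
      preserved-length k a top with pull-alt false k a top
      ... | a′ , top′ = DC.hat-length k a′ top′

      preserved-equal : ∀ k k′ → Asc x (alt s t k) → Top (δ x (alt s t k)) s t →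
                        Asc x (alt t s k′) → Top (δ x (alt t s k′)) s t → k ≡ k′
      preserved-equal k k′ a top a′ top′ with pull-alt false k a top | pull-alt true k′ a′ top′
      ... | b , n | b′ , n′ with DC.swap-chain k′ b′ n′
      ...   | b″ , n″ = DC.top-unique k k′ b n b″ n″

  sound : ∀ {a s t k j} → m s t ≡ suc j → MVal a s t k → δ [] (a ++ alt s t k) ≈ δ [] (a ++ alt t s k)
  sound {a} {s} {t} {k} e M = subst₂ _≈_ (sym (δ-++ [] a (alt s t k))) (sym (δ-++ [] a (alt t s k))) (go M)
    where
    at : ∀ {u} k → Reach [] a u → δ u (alt s t k) ≈ δ u (alt t s k) →
         δ (δ [] a) (alt s t k) ≈ δ (δ [] a) (alt t s k)
    at k r h = ≈trans (δ-cong (alt s t k) (Reach⇒ r)) (≈trans h (δ-cong (alt t s k) (≈sym (Reach⇒ r))))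
    go : ∀ {k} → MVal a s t k → δ (δ [] a) (alt s t k) ≈ δ (δ [] a) (alt t s k)
    go {k} (fixes {u} r es et hat) = at k r (preserved-braid e false u
      (λ { false → conjugation es ; true → conjugation et })
      (λ { false → conjugation et ; true → conjugation es }) hat)
    go {k} (swaps {u} r es et hat) = at k r (preserved-braid e true u
      (λ { false → conjugation es ; true → conjugation et })
      (λ { false → conjugation et ; true → conjugation es }) hat)
    go (other {u} r _ _) = at (m s t) r (δ-braid u s t e)

  BraidStep-δ : ∀ {v v′} → BraidStep v v′ → δ [] v ≈ δ [] v′
  BraidStep-δ (braid a b s t k j e M) = subst₂ _≈_
    (trans (sym (δ-++ [] (a ++ alt s t k) b)) (cong (δ []) (Lₚ.++-assoc a _ b)))
    (trans (sym (δ-++ [] (a ++ alt t s k) b)) (cong (δ []) (Lₚ.++-assoc a _ b)))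
    (δ-cong b (sound e M))

  BraidStep-length : ∀ {v v′} → BraidStep v v′ → length v ≡ length v′
  BraidStep-length (braid a b s t k j e M) = begin
    length (a ++ alt s t k ++ b)                ≡⟨ lengths s t ⟩
    length a + (k + length b)                   ≡⟨ sym (lengths t s) ⟩
    length (a ++ alt t s k ++ b)                ∎
    where
    open ≡-Reasoning
    lengths : ∀ s t → length (a ++ alt s t k ++ b) ≡ length a + (k + length b)
    lengths s t = trans (Lₚ.length-++ a) (cong (length a +_) (trans (Lₚ.length-++ (alt s t k)) (cong (_+ length b) (length-alt s t k))))

  ∼-HatR : ∀ {w v v′} → v ∼ v′ → HatR [] w v → HatR [] w v′
  ∼-HatR ε h = h
  ∼-HatR {w} (b ◅ bs) (r , min) = ∼-HatR bs
    (⇒Reach _ (≈trans (≈sym (BraidStep-δ b)) (Reach⇒ r)) ,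
     λ u ru → subst (_≤ length u) (BraidStep-length b) (min u ru))

  ∼-length : ∀ {v v′} → v ∼ v′ → length v ≡ length v′
  ∼-length ε        = refl
  ∼-length (b ◅ bs) = trans (BraidStep-length b) (∼-length bs)

  ∼-++ : ∀ {v v′} z → v ∼ v′ → v ++ z ∼ v′ ++ z
  ∼-++ z = Star.gmap (_++ z) extend
    where
    extend : ∀ {v v′} → BraidStep v v′ → BraidStep (v ++ z) (v′ ++ z)
    extend (braid a b s t k j e M) = subst₂ BraidStep (reassoc s t) (reassoc t s) (braid a (b ++ z) s t k j e M)
      where
      reassoc : ∀ s t → a ++ alt s t k ++ (b ++ z) ≡ (a ++ alt s t k ++ b) ++ z
      reassoc s t = trans (cong (a ++_) (sym (Lₚ.++-assoc (alt s t k) b z))) (sym (Lₚ.++-assoc a _ z))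

  -- The word problem decides which case of `MVal` applies. The second component is needed because
  -- the chain that begins with β must be shown to have the same length before it is known to be
  -- ascending.
  MVal-chain : ∀ {c x α β} k → Reach [] c x → Invol x → Pos x α → Pos x β → ∀ j → m α β ≡ suc j →
               Asc x (alt α β k) → Top (δ x (alt α β k)) α β →
               MVal c α β k × (∀ k′ → Asc x (alt β α k′) → Top (δ x (alt β α k′)) α β → k ≡ k′)
  MVal-chain {c} {x} {α} {β} k r i pα pβ j e a top
    with (σ α ∷ x ≈? x ++ [ α ]) ×-dec (σ β ∷ x ≈? x ++ [ β ])
       | (σ β ∷ x ≈? x ++ [ α ]) ×-dec (σ α ∷ x ≈? x ++ [ β ])
  ... | yes (f , g) | _ =
    fixes r (conjugation⁻¹ f) (conjugation⁻¹ g) (preserved-length e false pα pβ tw k a top) ,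
    λ k′ → preserved-equal e false pα pβ tw k k′ a top
    where
    tw : ∀ b → _
    tw false = f
    tw true  = g
  ... | no _ | yes (f , g) =
    swaps r (conjugation⁻¹ f) (conjugation⁻¹ g) (preserved-length e true pα pβ tw k a top) ,
    λ k′ → preserved-equal e true pα pβ tw k k′ a top
    where
    tw : ∀ b → _
    tw false = f
    tw true  = g
  ... | no ¬fix | no ¬swap =
    subst (MVal c α β) (trans e (sym k≡))
      (other r (λ (f , g) → ¬fix (conjugation f , conjugation g)) (λ (f , g) → ¬swap (conjugation f , conjugation g))) ,
    λ k′ a′ (nα , nβ) → trans k≡ (sym (unpreserved i pβ pα j (trans (m-sym β α) e)
      (λ (f , g) → ¬fix (g , f)) (λ (f , g) → ¬swap (g , f)) k′ a′ (nβ , nα)))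
    where
    k≡ : k ≡ suc j
    k≡ = unpreserved i pα pβ j e ¬fix ¬swap k a top

  Neg-end : ∀ b t → Neg (δ [] (b ++ [ t ])) t
  Neg-end b t = subst (λ z → Neg z t) (sym (δ-++ [] b [ t ])) (Neg-⋉ _ t)

  -- The route is b s ∼ c⋯s ∼ c⋯t ∼ b′ t, with a single braid step in the middle. The induction
  -- hypothesis bounds only the length of its first word, since nothing is known yet about the
  -- length of b′.
  complete-step : ∀ b s b′ t →
    (∀ u u′ → length u ≤ length b → Asc [] u → Asc [] u′ → δ [] u ≈ δ [] u′ → u ∼ u′) →
    ∀ w → Neg w s → Neg w t → δ [] (b ++ [ s ]) ≈ w → δ [] (b′ ++ [ t ]) ≈ w →
    Asc [] (b ++ [ s ]) → Asc [] (b′ ++ [ t ]) →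
    (ch : Chain w s t) → ∀ c → Asc [] c → δ [] c ≈ Chain.x ch → b ++ [ s ] ∼ b′ ++ [ t ]
  complete-step b s b′ t IH w ns nt e e′ a a′ ch c ac c≈x =
    ∼-++ [ s ] first ◅◅ middle ◅◅ ∼-++ [ t ] (IH (c ++ alt β α k) b′ length-c ac₂ ab′ same₂)
    where
    open Chain ch
    topw : Top w α β
    topw = letter-cover (Neg w) k (subst (Neg w) (sym final) ns) (subst (Neg w) (sym final′) nt)
    finite : ∃[ j ] (m α β ≡ suc j)
    finite with m α β in eq
    ... | zero  = ⊥-elim (Top-finite topw eq)
    ... | suc j = j , refl
    at-w : ∀ {z} → z ≈ w → Top z α β
    at-w z≈w = Neg-resp (≈sym z≈w) (proj₁ topw) , Neg-resp (≈sym z≈w) (proj₂ topw)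
    M : MVal c α β (suc k) × (∀ k′ → Asc x (alt β α k′) → Top (δ x (alt β α k′)) α β → suc k ≡ k′)
    M = MVal-chain (suc k) (⇒Reach c c≈x) invol posα posβ (proj₁ finite) (proj₂ finite) asc (at-w equal)
    V₁ V₂ : Word
    V₁ = c ++ alt α β (suc k)
    V₂ = c ++ alt β α (suc k)
    δ-c : ∀ z → δ [] (c ++ z) ≈ δ x z
    δ-c z = ≈trans (≡⇒≈ (δ-++ [] c z)) (δ-cong z c≈x)
    δV₁ : δ [] V₁ ≈ w
    δV₁ = ≈trans (δ-c (alt α β (suc k))) equal
    δV₂ : δ [] V₂ ≈ w
    δV₂ = ≈trans (≈sym (sound {c} (proj₂ finite) (proj₁ M))) δV₁
    -- Cutting off idle letters leaves an ascending word with the same end w, which is a top; `M`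
    -- forces its length to be k + 1, so nothing was cut off.
    asc₂ : Asc x (alt β α (suc k))
    asc₂ with saturate {β = α} k invol posβ
    ... | i , i≤k , ai , ei = subst (λ z → Asc x (alt β α z)) (sym (proj₂ M (suc i) ai
            (at-w (≈trans (≡⇒≈ ei) (≈trans (≈sym (δ-c (alt β α (suc k)))) δV₂))))) ai
    split : ∀ y z l → letter y z k ≡ l → c ++ alt y z (suc k) ≡ (c ++ alt y z k) ++ [ l ]
    split y z l refl = trans (cong (c ++_) (alt-snoc y z k)) (sym (Lₚ.++-assoc c _ _))
    middle : ((c ++ alt α β k) ++ [ s ]) ∼ ((c ++ alt β α k) ++ [ t ])
    middle = subst₂ _∼_ (trans (cong (c ++_) (Lₚ.++-identityʳ _)) (split α β s final))
                        (trans (cong (c ++_) (Lₚ.++-identityʳ _)) (split β α t final′))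
                        (braid c [] α β (suc k) (proj₁ finite) (proj₂ finite) (proj₁ M) ◅ ε)
    ascV : ∀ {z} → Asc x z → Asc [] (c ++ z)
    ascV {z} az = Asc-++ [] c z ac (Asc-resp z (≈sym c≈x) az)
    parts₁ : Asc [] (c ++ alt α β k) × Asc (δ [] (c ++ alt α β k)) [ s ]
    parts₁ = Asc-split [] (c ++ alt α β k) [ s ] (subst (Asc []) (split α β s final) (ascV asc))
    parts₂ : Asc [] (c ++ alt β α k) × Asc (δ [] (c ++ alt β α k)) [ t ]
    parts₂ = Asc-split [] (c ++ alt β α k) [ t ] (subst (Asc []) (split β α t final′) (ascV asc₂))
    parts : Asc [] b × Asc (δ [] b) [ s ]
    parts = Asc-split [] b [ s ] a
    parts′ : Asc [] b′ × Asc (δ [] b′) [ t ]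
    parts′ = Asc-split [] b′ [ t ] a′
    ab : Asc [] b
    ab = proj₁ parts
    ab′ : Asc [] b′
    ab′ = proj₁ parts′
    ac₁ : Asc [] (c ++ alt α β k)
    ac₁ = proj₁ parts₁
    ac₂ : Asc [] (c ++ alt β α k)
    ac₂ = proj₁ parts₂
    same₁ : δ [] b ≈ δ [] (c ++ alt α β k)
    same₁ = down-unique (Invol-δ b ≈refl) (Invol-δ (c ++ alt α β k) ≈refl) (proj₁ (proj₂ parts)) (proj₁ (proj₂ parts₁))
      (subst₂ _≈_ (δ-++ [] b [ s ]) (trans (cong (δ []) (split α β s final)) (δ-++ [] (c ++ alt α β k) [ s ])) (≈trans e (≈sym δV₁)))
    same₂ : δ [] (c ++ alt β α k) ≈ δ [] b′
    same₂ = down-unique (Invol-δ (c ++ alt β α k) ≈refl) (Invol-δ b′ ≈refl) (proj₁ (proj₂ parts₂)) (proj₁ (proj₂ parts′))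
      (subst₂ _≈_ (trans (cong (δ []) (split β α t final′)) (δ-++ [] (c ++ alt β α k) [ t ])) (δ-++ [] b′ [ t ]) (≈trans δV₂ (≈sym e′)))
    first : b ∼ c ++ alt α β k
    first = IH b (c ++ alt α β k) ℕₚ.≤-refl ab ac₁ same₁
    -- The length of c becomes known only through `first`, as braid steps preserve length.
    length-c : length (c ++ alt β α k) ≤ length b
    length-c = ℕₚ.≤-reflexive (sym (trans (∼-length first) (trans (Lₚ.length-++ c)
      (trans (cong (length c +_) (trans (length-alt α β k) (sym (length-alt β α k)))) (sym (Lₚ.length-++ c))))))

  complete : ∀ n v v′ → length v ≤ n → Asc [] v → Asc [] v′ → δ [] v ≈ δ [] v′ → v ∼ v′
  complete n v v′ v≤n a a′ e with initLast v | initLast v′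
  ... | [] | [] = ε
  ... | [] | b ∷ʳ′ t = ⊥-elim (Pos-Neg (Pos-[] t) (Neg-resp (≈sym e) (Neg-end b t)))
  ... | b ∷ʳ′ s | [] = ⊥-elim (Pos-Neg (Pos-[] s) (Neg-resp e (Neg-end b s)))
  complete zero .(b ++ [ s ]) v′ v≤n a a′ e | b ∷ʳ′ s | _ ∷ʳ′ t = ⊥-elim (ℕₚ.n≮0 (subst (_≤ 0) (length-∷ʳ b s) v≤n))
  complete (suc n) .(b ++ [ s ]) .(b′ ++ [ t ]) v≤n a a′ e | b ∷ʳ′ s | b′ ∷ʳ′ t =
    from-chain (chain (Invol-δ (b ++ [ s ]) ≈refl) (Neg-end b s))
    where
    b≤n : length b ≤ n
    b≤n = s≤s⁻¹ (subst (_≤ suc n) (length-∷ʳ b s) v≤n)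
    from-chain : Chain (δ [] (b ++ [ s ])) s t → b ++ [ s ] ∼ b′ ++ [ t ]
    from-chain ch with word-of (Chain.invol ch)
    ... | c , ac , c≈x = complete-step b s b′ t (λ u u′ u≤b → complete n u u′ (ℕₚ.≤-trans u≤b b≤n))
            (δ [] (b ++ [ s ])) (Neg-end b s) (Neg-resp (≈sym e) (Neg-end b′ t)) ≈refl (≈sym e) a a′ ch c ac c≈x

  HatR⇒Asc : ∀ {w v} → HatR [] w v → Asc [] v
  HatR⇒Asc {w} {v} (r , min) with Pruned.short (prune [] v ≈refl)
  ... | inj₁ a = a
  ... | inj₂ h = ⊥-elim (ℕₚ.<⇒≱ h (min _ (⇒Reach (Pruned.word P) (≈trans (Pruned.equal P) (Reach⇒ r)))))
    where P : Pruned [] v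
          P = prune [] v ≈refl

  classes : ∀ w → Inv w → ∃[ e ] (∀ v → (HatR [] w v ⇔ (e ∼ v)))
  classes w i with word-of i
  ... | e , a , eq = e , λ v → mk⇔
      (λ h → complete (length e) e v ℕₚ.≤-refl a (HatR⇒Asc h) (≈trans eq (≈sym (Reach⇒ (proj₁ h)))))
      (λ e∼v → ∼-HatR e∼v (⇒Reach e eq , minimal))
    where
    -- A competitor prunes to an ascending word, which is braid equivalent to e and hence as long as
    -- e.
    minimal : ∀ u → Reach [] u w → length e ≤ length u
    minimal u r with pruned-≤ {w = u} ≈refl (prune [] u ≈refl)
    ... | v , av , ev , h = ℕₚ.≤-trans
      (ℕₚ.≤-reflexive (∼-length (complete (length e) e v ℕₚ.≤-refl a av (≈trans eq (≈sym (≈trans ev (Reach⇒ r))))))) h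

theorem7p9 : (C : CoxeterMatrix) (T : Twist C) →
    let open Twisted C T in
    ∀ w → Inv w → ∃[ e ] (∀ v → (HatR [] w v ⇔ (e ∼ v)))
theorem7p9 C T = Main.classes C T
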